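{- Let $a,b,c,d$ be positive integers with $b>1$, $d>1$ and $a(b-1)=c(d-1)=:N$, and let $f=P(a,b,c,d)$ be the permutation of $\mathbb{N}_0$ defined below. Then for every positive integer $m$, $f$ has only finitely many $m$-cycles, and these $m$-cycles can be computed (there is an algorithm which, given $a,b,c,d,m$, outputs all $m$-cycles of $f$).
   Context: $\mathbb{N}_0=\{0,1,2,\dots\}$. Let $r_1<r_2<\dots<r_N$ be the elements of $\{1,\dots,ab-1\}$ not divisible by $b$, and $s_1<\dots<s_N$ the elements of $\{1,\dots,cd-1\}$ not divisible by $d$. The map $P(a,b,c,d):\mathbb{N}_0\to\mathbb{N}_0$ is defined for $n\in\mathbb{N}_0$ by $f(bn)=dn$ and $f(abn+r_i)=cdn+s_i$ for $i=1,\dots,N$; it is a bijection. A cycle of $f$ is a finite sequence of distinct elements $x_0,\dots,x_{p-1}$ with $f(x_i)=x_{i+1}$ (indices mod $p$). An $m$-cycle is a cycle which, read cyclically, has exactly $m$ local minima and $m$ local maxima (an element $x_i$ is a local minimum if $x_{i-1}>x_i<x_{i+1}$ and a local maximum if $x_{i-1}<x_i>x_{i+1}$, indices mod $p$). -}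

module Defs where

open import Data.Nat using (ℕ; zero; suc; _+_; _*_; _∸_; _%_; _<_; _≤_; _<ᵇ_)
open import Data.Nat.Divisibility using (_∣?_)
open import Data.Bool using (Bool; _∧_)
open import Data.List using (List; []; _∷_; length; filter; filterᵇ; applyUpTo; upTo)
open import Data.List.Relation.Unary.Unique.Propositional using (Unique)
open import Data.Product using (Σ; _×_)
open import Data.Sum using (_⊎_)
open import Relation.Nullary using (¬?)
open import Relation.Binary.PropositionalEquality using (_≡_)

oneTo : ℕ → List ℕ
oneTo n = applyUpTo suc n

-- elements of {1,…,k*q-1} not divisible by q, in increasing order
-- (r_1 < … < r_N for (k,q) = (a,b); s_1 < … < s_N for (k,q) = (c,d))
nonMultiples : ℕ → ℕ → List ℕ
nonMultiples k q = filter (λ x → ¬? (q ∣? x)) (oneTo (k * q ∸ 1))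

data Nth : List ℕ → ℕ → ℕ → Set where
  here  : ∀ {x xs} → Nth (x ∷ xs) zero x
  there : ∀ {y xs i x} → Nth xs i x → Nth (y ∷ xs) (suc i) x

-- Graph of the map P(a,b,c,d):  P a b c d x y  means  f(x) = y, where
--   f(b n) = d n   and   f(a b n + r_i) = c d n + s_i .
P : ℕ → ℕ → ℕ → ℕ → ℕ → ℕ → Set
P a b c d x y =
  (Σ ℕ λ n → x ≡ b * n × y ≡ d * n)
  ⊎ (Σ ℕ λ n → Σ ℕ λ i → Σ ℕ λ r → Σ ℕ λ s →
       Nth (nonMultiples a b) i r × Nth (nonMultiples c d) i s ×
       x ≡ a * b * n + r × y ≡ c * d * n + s)

-- 0-based indexing with default 0 (only used at indices < length)
at : List ℕ → ℕ → ℕ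
at []       _       = 0
at (x ∷ xs) zero    = x
at (x ∷ xs) (suc i) = at xs i

nextIx : (xs : List ℕ) → ℕ → ℕ
nextIx [] i = 0
nextIx xs@(_ ∷ _) i = suc i % length xs

prevIx : (xs : List ℕ) → ℕ → ℕ
prevIx [] i = 0
prevIx xs@(_ ∷ _) i = (i + length xs ∸ 1) % length xs

IsCycle : (ℕ → ℕ → Set) → List ℕ → Set
IsCycle F xs =
  1 ≤ length xs × Unique xs ×
  (∀ i → i < length xs → F (at xs i) (at xs (nextIx xs i)))

isLocalMin : List ℕ → ℕ → Bool
isLocalMin xs i = (at xs i <ᵇ at xs (prevIx xs i)) ∧ (at xs i <ᵇ at xs (nextIx xs i))

isLocalMax : List ℕ → ℕ → Bool
isLocalMax xs i = (at xs (prevIx xs i) <ᵇ at xs i) ∧ (at xs (nextIx xs i) <ᵇ at xs i)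

numLocalMin : List ℕ → ℕ
numLocalMin xs = length (filterᵇ (isLocalMin xs) (upTo (length xs)))

numLocalMax : List ℕ → ℕ
numLocalMax xs = length (filterᵇ (isLocalMax xs) (upTo (length xs)))

IsMCycle : (ℕ → ℕ → Set) → ℕ → List ℕ → Set
IsMCycle F m xs = IsCycle F xs × numLocalMin xs ≡ m × numLocalMax xs ≡ m

{-# OPTIONS --safe #-}
module Submission where

-- By symmetry let b < d (reverse the cycles if d < b; if b = d then f is the identity).  A step from x either multiplies x by
-- α = d/b > 1 or divides it, up to a factor 1 + O(1/x), by γ = b(d-1)/(d(b-1)) > 1.  A cycle with minimum X, K ascents and
-- L descents therefore gives αᴷ = γᴸ (1 + O(1/X))ᴸ.  A run of k ascents from z needs (b/gcd(b,d))ᵏ ∣ z, so that k is at most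
-- log₂ z and the run ends below a fixed power of z; having m runs, a cycle satisfies 2ᴷ ≤ X^Q and lies below X^Q, where Q
-- depends on b, d, m only.  It remains to bound X, that is, to show that αᴷ is not exponentially close to γᴸ.
--
-- This is Gelfond's theorem for two logarithms.  Choose θ = t/M₀ very close to α^(1/L), so that γ is very close to θᴷ.  The
-- pigeonhole principle gives integers c_ki, not all 0 and not too large, such that F(x) = Σ c_ki x(x-1)⋯(x-i+1) θ^(kx) is
-- tiny for all x up to a large bound: one makes its first T coefficients in the basis of binomial polynomials small, the
-- others being small anyway.  At x = rL + sK the number F(x) is very close to Σ c_ki x(x-1)⋯(x-i+1) (αʳγˢ)ᵏ, a rational
-- number of small denominator, which therefore vanishes.  A zero estimate shows that it cannot do so for so many (r, s).
--
-- All inequalities between rationals are stated in ℕ with the denominators multiplied out.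

-- The obstacle is that Q may be large. Comparing two unequal integers (Liouville) only gives X ≤
-- 2^O(K+L), which does not contradict 2ᴷ ≤ X^Q. The interpolation argument shows that X is at most
-- 2^O((log L)⁶) for large L; since K and L have the same order of magnitude, 2ᴷ ≤ X^Q then bounds
-- L, and only after that does Liouville's inequality bound X. A single θ serves for both numbers
-- because αᴷ ≈ γᴸ: θᴸ ≈ α implies θᴷ ≈ γ. The points rL + sK are therefore natural numbers, where
-- θ^(kx) = (1 + (θᵏ - 1))ˣ is a finite binomial sum. Since θᴸ is bounded, θ is close to 1 and the
-- terms of high order are small. This tail estimate replaces the maximum principle of complex
-- analysis. Multiplicative independence of α and γ, which rests on d and d - 1 being coprime,
-- enters twice: it makes the points rL + sK of a square distinct, and it makes the two integers in
-- Liouville's inequality different.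

module ZeroEstimate where
  open import Data.Nat.Base as ℕ using (ℕ; zero; suc; z≤n; s≤s)
  import Data.Nat.Properties as ℕ
  import Data.Nat.Tactic.RingSolver as ℕ-Solver
  open import Data.Fin.Base using (Fin; zero; suc; toℕ; combine; remQuot; punchIn; punchOut; inject≤; _↑ˡ_; _↑ʳ_)
  open import Data.Fin.Properties as Fin using (any?; all?; toℕ<n)
  open import Data.Product using (Σ; ∃; _×_; _,_; proj₁; proj₂; uncurry)
  open import Data.Sum using (_⊎_; inj₁; inj₂; [_,_]′)
  open import Data.Empty using (⊥; ⊥-elim)
  open import Function using (_∘_; id)
  open import Relation.Nullary using (yes; no; contradiction; ¬?; decidable-stable)
  open import Relation.Binary.PropositionalEquality hiding (J)
  open import Data.Integer.Base using (ℤ; 0ℤ; 1ℤ; -1ℤ; _+_; _*_; -_; _-_; _^_) renaming (+_ to pos)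
  open import Data.Integer.Properties
  open import Data.Integer.Tactic.RingSolver using (solve-∀)
  open import Algebra.Properties.Semiring.Sum +-*-semiring using (sum; sum-cong-≗; ∑-distrib-+; ∑-comm; *-distribˡ-sum; *-distribʳ-sum; sum-remove)
  open import Algebra.Properties.CommutativeSemigroup *-commutativeSemigroup using (x∙yz≈y∙xz; x∙yz≈y∙zx)
  open import Data.Vec.Functional using (insertAt)
  open import Data.Vec.Functional.Properties using (insertAt-lookup; insertAt-punchIn)

  -- Linear algebra over ℤ

  *-≢0 : ∀ {i j} → i ≢ 0ℤ → j ≢ 0ℤ → i * j ≢ 0ℤ
  *-≢0 {i} i≢0 j≢0 ij≡0 = [ i≢0 , j≢0 ]′ (i*j≡0⇒i≡0∨j≡0 i ij≡0)

  *-cancel-≡0 : ∀ {i j} → i ≢ 0ℤ → i * j ≡ 0ℤ → j ≡ 0ℤ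
  *-cancel-≡0 {i} i≢0 ij≡0 = [ (λ i≡0 → contradiction i≡0 i≢0) , id ]′ (i*j≡0⇒i≡0∨j≡0 i ij≡0)

  sum-zero : ∀ {n} (f : Fin n → ℤ) → (∀ i → f i ≡ 0ℤ) → sum f ≡ 0ℤ
  sum-zero {zero} f f≡0 = refl
  sum-zero {suc n} f f≡0 = cong₂ _+_ (f≡0 zero) (sum-zero (f ∘ suc) (f≡0 ∘ suc))

  sum-++ : ∀ m {n} (f : Fin (m ℕ.+ n) → ℤ) → sum f ≡ sum (λ i → f (i ↑ˡ n)) + sum (λ j → f (m ↑ʳ j))
  sum-++ zero f = sym (+-identityˡ (sum f))
  sum-++ (suc m) f = trans (cong (f zero +_) (sum-++ m (f ∘ suc))) (sym (+-assoc (f zero) _ _))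

  sum-combine : ∀ m n (f : Fin (m ℕ.* n) → ℤ) → sum f ≡ sum (λ i → sum (λ j → f (combine {m} {n} i j)))
  sum-combine zero n f = refl
  sum-combine (suc m) n f = trans (sum-++ n f) (cong (sum (λ i → f (i ↑ˡ (m ℕ.* n))) +_) (sum-combine m n (λ j → f (n ↑ʳ j))))

  -- Fraction-free Gaussian elimination, one equation at a time.
  underdetermined : ∀ n m → n ℕ.< m → (f : Fin n → Fin m → ℤ) →
    Σ (Fin m → ℤ) λ a → (∃ λ j → a j ≢ 0ℤ) × (∀ i → sum (λ j → f i j * a j) ≡ 0ℤ)
  underdetermined zero (suc m) _ f = (λ _ → 1ℤ) , (zero , λ ()) , λ ()
  underdetermined (suc n) (suc m) (s≤s n<m) f with any? (λ j → ¬? (f zero j ≟ 0ℤ))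
  ... | no allZero = a , a≢0 , λ { zero → sum-zero _ (λ j → cong (_* a j) (f₀≡0 j)) ; (suc i) → eqs i }
    where
    f₀≡0 : ∀ j → f zero j ≡ 0ℤ
    f₀≡0 j = decidable-stable (f zero j ≟ 0ℤ) (λ f₀j≢0 → allZero (j , f₀j≢0))
    solution = underdetermined n (suc m) (ℕ.m<n⇒m<1+n n<m) (f ∘ suc)
    a = proj₁ solution
    a≢0 = proj₁ (proj₂ solution)
    eqs = proj₂ (proj₂ solution)
  ... | yes (p , f₀p≢0) = a , (punchIn p j₀ , λ aj≡0 → *-≢0 f₀p≢0 a′j₀≢0 (trans (sym (a-rest j₀)) aj≡0)) , eqs
    where
    g : Fin n → Fin m → ℤ
    g i j = f zero p * f (suc i) (punchIn p j) - f (suc i) p * f zero (punchIn p j)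
    solution = underdetermined n m n<m g
    a′ = proj₁ solution
    j₀ = proj₁ (proj₁ (proj₂ solution))
    a′j₀≢0 = proj₂ (proj₁ (proj₂ solution))
    s₀ = sum (λ j → f zero (punchIn p j) * a′ j)
    a : Fin (suc m) → ℤ
    -- The other unknowns are multiplied by the pivot, so that the pivot unknown solves the first
    -- equation without a division.
    a = insertAt (λ j → f zero p * a′ j) p (- s₀)
    a-rest : ∀ j → a (punchIn p j) ≡ f zero p * a′ j
    a-rest = insertAt-punchIn (λ j → f zero p * a′ j) p (- s₀)
    split : ∀ (h : Fin (suc m) → ℤ) → sum (λ j → h j * a j) ≡ f zero p * sum (λ j → h (punchIn p j) * a′ j) - h p * s₀
    split h = begin
      sum (λ j → h j * a j)
        ≡⟨ sum-remove {i = p} (λ j → h j * a j) ⟩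
      h p * a p + sum (λ j → h (punchIn p j) * a (punchIn p j))
        ≡⟨ cong₂ _+_ (cong (h p *_) (insertAt-lookup (λ j → f zero p * a′ j) p (- s₀)))
             (trans (sum-cong-≗ (λ j → trans (cong (h (punchIn p j) *_) (a-rest j)) (x∙yz≈y∙xz (h (punchIn p j)) (f zero p) (a′ j))))
               (sym (*-distribˡ-sum (f zero p) (λ j → h (punchIn p j) * a′ j)))) ⟩
      h p * (- s₀) + f zero p * sum (λ j → h (punchIn p j) * a′ j)
        ≡⟨ rearrange (h p) s₀ _ ⟩
      f zero p * sum (λ j → h (punchIn p j) * a′ j) - h p * s₀ ∎
      where
      open ≡-Reasoning
      rearrange : ∀ x y z → x * (- y) + z ≡ z - x * y
      rearrange = solve-∀
    combined : ∀ i → f zero p * sum (λ j → f (suc i) (punchIn p j) * a′ j) - f (suc i) p * s₀ ≡ sum (λ j → g i j * a′ j)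
    combined i = begin
      f zero p * sum u - f (suc i) p * s₀
        ≡⟨ cong₂ _+_ (*-distribˡ-sum (f zero p) u) (trans (neg-distribˡ-* (f (suc i) p) s₀) (*-distribˡ-sum (- f (suc i) p) v)) ⟩
      sum (λ j → f zero p * u j) + sum (λ j → - f (suc i) p * v j)
        ≡⟨ sym (∑-distrib-+ (λ j → f zero p * u j) (λ j → - f (suc i) p * v j)) ⟩
      sum (λ j → f zero p * u j + - f (suc i) p * v j)
        ≡⟨ sum-cong-≗ (λ j → collect (f zero p) (f (suc i) (punchIn p j)) (a′ j) (f (suc i) p) (f zero (punchIn p j))) ⟩
      sum (λ j → g i j * a′ j) ∎
      where
      open ≡-Reasoning
      u v : Fin m → ℤ
      u j = f (suc i) (punchIn p j) * a′ j
      v j = f zero (punchIn p j) * a′ j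
      collect : ∀ x y z w t → x * (y * z) + - w * (t * z) ≡ (x * y - w * t) * z
      collect = solve-∀
    eqs : ∀ i → sum (λ j → f i j * a j) ≡ 0ℤ
    eqs zero = trans (split (f zero)) (+-inverseʳ (f zero p * s₀))
    eqs (suc i) = trans (split (f (suc i))) (trans (combined i) (proj₂ (proj₂ solution) i))

  -- Poly n a f: the function f is a polynomial of formal degree n (in Horner form) whose xⁿ-coefficient is a, possibly 0.
  data Poly : ℕ → ℤ → (ℤ → ℤ) → Set where
    const  : ∀ {a f} → (∀ x → f x ≡ a) → Poly 0 a f
    horner : ∀ {n a f} c {g} → Poly n a g → (∀ x → f x ≡ c + x * g x) → Poly (suc n) a f

  Poly-cong : ∀ {n a f g} → (∀ x → g x ≡ f x) → Poly n a f → Poly n a g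
  Poly-cong g≗f (const f≡a) = const (λ x → trans (g≗f x) (f≡a x))
  Poly-cong g≗f (horner c p eq) = horner c p (λ x → trans (g≗f x) (eq x))

  Poly-lead : ∀ {n a b f} → a ≡ b → Poly n a f → Poly n b f
  Poly-lead refl p = p

  Poly-+ : ∀ {n a b f g} → Poly n a f → Poly n b g → Poly n (a + b) (λ x → f x + g x)
  Poly-+ (const p) (const q) = const (λ x → cong₂ _+_ (p x) (q x))
  Poly-+ (horner c p eq) (horner d q eq′) =
    horner (c + d) (Poly-+ p q) (λ x → trans (cong₂ _+_ (eq x) (eq′ x)) (rearrange c d x _ _))
    where
    rearrange : ∀ c d x y z → (c + x * y) + (d + x * z) ≡ (c + d) + x * (y + z)
    rearrange = solve-∀

  Poly-scale : ∀ {n a f} s → Poly n a f → Poly n (s * a) (λ x → s * f x)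
  Poly-scale s (const p) = const (λ x → cong (s *_) (p x))
  Poly-scale s (horner c p eq) = horner (s * c) (Poly-scale s p) (λ x → trans (cong (s *_) (eq x)) (rearrange s c x _))
    where
    rearrange : ∀ s c x y → s * (c + x * y) ≡ s * c + x * (s * y)
    rearrange = solve-∀

  Poly-raise : ∀ {n a f} → Poly n a f → Poly (suc n) 0ℤ f
  Poly-raise {a = a} (const p) = horner a (const {f = λ _ → 0ℤ} (λ _ → refl)) (λ x → trans (p x) (rearrange a x))
    where
    rearrange : ∀ a x → a ≡ a + x * 0ℤ
    rearrange = solve-∀
  Poly-raise (horner c p eq) = horner c (Poly-raise p) eq

  Poly-raise+ : ∀ k {n a f} → Poly n a f → Poly (suc k ℕ.+ n) 0ℤ f
  Poly-raise+ zero p = Poly-raise p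
  Poly-raise+ (suc k) p = Poly-raise (Poly-raise+ k p)

  Poly-x* : ∀ {n a f} → Poly n a f → Poly (suc n) a (λ x → x * f x)
  Poly-x* p = horner 0ℤ p (λ x → sym (+-identityˡ _))

  Poly-* : ∀ {n m a b f g} → Poly n a f → Poly m b g → Poly (n ℕ.+ m) (a * b) (λ x → f x * g x)
  Poly-* {a = a} {g = g} (const p) q = Poly-cong (λ x → cong (_* g x) (p x)) (Poly-scale a q)
  Poly-* {suc n} {g = g} (horner c {f′} p eq) q =
    Poly-lead (+-identityˡ _) (Poly-cong (λ x → trans (cong (_* g x) (eq x)) (rearrange c x (f′ x) (g x)))
      (Poly-+ (Poly-raise+ n (Poly-scale c q)) (Poly-x* (Poly-* p q))))
    where
    rearrange : ∀ c x y z → (c + x * y) * z ≡ c * z + x * (y * z)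
    rearrange = solve-∀

  Poly-shift : ∀ {n a f} t → Poly n a f → Poly n a (λ x → f (x + t))
  Poly-shift t (const p) = const (λ x → p (x + t))
  Poly-shift t (horner c {g} p eq) =
    Poly-lead (+-identityˡ _) (Poly-cong (λ x → trans (eq (x + t)) (rearrange c x t (g (x + t))))
      (Poly-+ (Poly-raise (Poly-scale t (Poly-shift t p)))
              (horner c (Poly-shift t p) (λ x → refl))))
    where
    rearrange : ∀ c x t y → c + (x + t) * y ≡ t * y + (c + x * y)
    rearrange = solve-∀

  Poly-sum : ∀ {m n} (a : Fin m → ℤ) (f : Fin m → ℤ → ℤ) → (∀ i → Poly n (a i) (f i)) → Poly n (sum a) (λ x → sum (λ i → f i x))
  Poly-sum {zero} {zero} a f p = const (λ _ → refl)
  Poly-sum {zero} {suc n} a f p = Poly-raise (Poly-sum {zero} {n} a f (λ ()))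
  Poly-sum {suc m} a f p = Poly-+ (p zero) (Poly-sum (a ∘ suc) (f ∘ suc) (p ∘ suc))

  -- Synthetic division that keeps the leading coefficient: once `g` is divided with quotient `h`,
  -- the quotient of `c + x * g x` is `g x + r * h x`.
  factor : ∀ {n a f} → Poly (suc n) a f → ∀ r → Σ (ℤ → ℤ) λ g → Poly n a g × (∀ x → f x ≡ f r + (x - r) * g x)
  factor {zero} {a} (horner c {g} (const p) eq) r = g , const p , λ x →
    trans (eq x) (trans (cong (λ y → c + x * y) (p x)) (trans (rearrange c x r a)
      (cong₂ (λ y z → y + (x - r) * z) (sym (trans (eq r) (cong (λ y → c + r * y) (p r)))) (sym (p x)))))
    where
    rearrange : ∀ c x r a → c + x * a ≡ (c + r * a) + (x - r) * a
    rearrange = solve-∀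
  factor {suc n} {a} {f} (horner c {g} p eq) r with factor p r
  ... | h , q , eq′ = (λ x → g x + r * h x) ,
    Poly-lead (+-identityʳ a) (Poly-+ p (Poly-lead (*-zeroʳ r) (Poly-scale r (Poly-raise q)))) ,
    λ x → begin
      f x                                              ≡⟨ eq x ⟩
      c + x * g x                                      ≡⟨ solve₁ c x (g x) r ⟩
      c + r * g x + (x - r) * g x                      ≡⟨ cong (λ y → c + r * y + (x - r) * g x) (eq′ x) ⟩
      c + r * (g r + (x - r) * h x) + (x - r) * g x    ≡⟨ solve₂ c r (g r) x (h x) (g x) ⟩
      (c + r * g r) + (x - r) * (g x + r * h x)        ≡⟨ cong (_+ (x - r) * (g x + r * h x)) (sym (eq r)) ⟩
      f r + (x - r) * (g x + r * h x)                  ∎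
    where
    open ≡-Reasoning
    solve₁ : ∀ c x y r → c + x * y ≡ c + r * y + (x - r) * y
    solve₁ = solve-∀
    solve₂ : ∀ c r y x z w → c + r * (y + (x - r) * z) + (x - r) * w ≡ (c + r * y) + (x - r) * (w + r * z)
    solve₂ = solve-∀

  too-many-roots : ∀ {n a f} → Poly n a f → (ρ : Fin (suc n) → ℤ) → (∀ {i j} → ρ i ≡ ρ j → i ≡ j) →
    (∀ i → f (ρ i) ≡ 0ℤ) → ∀ x → f x ≡ 0ℤ
  too-many-roots (const p) ρ ρ-inj f≡0 x = trans (p x) (trans (sym (p (ρ zero))) (f≡0 zero))
  too-many-roots {suc n} {f = f} p@(horner _ _ _) ρ ρ-inj f≡0 x with factor p (ρ zero)
  ... | g , q , eq = trans (eq x) (trans (cong₂ (λ y z → y + (x - ρ zero) * z) (f≡0 zero) (g≡0 x)) (trans (+-identityˡ ((x - ρ zero) * 0ℤ)) (*-zeroʳ (x - ρ zero))))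
    where
    root : ∀ i → g (ρ (suc i)) ≡ 0ℤ
    root i = *-cancel-≡0 {ρ (suc i) - ρ zero} (λ d≡0 → Fin.0≢1+n (sym (ρ-inj (i-j≡0⇒i≡j _ _ d≡0))))
      (trans (sym (+-identityˡ _)) (trans (cong (_+ (ρ (suc i) - ρ zero) * g (ρ (suc i))) (sym (f≡0 zero))) (trans (sym (eq (ρ (suc i)))) (f≡0 (suc i)))))
    g≡0 : ∀ x → g x ≡ 0ℤ
    g≡0 = too-many-roots q (ρ ∘ suc) (λ e → Fin.suc-injective (ρ-inj e)) root

  -- When `c` is zero, the vanishing of `x * g x` says nothing about `g 0`. So `g` is shown to
  -- vanish by its roots 1, 2, 3, ..., and the recursion continues with `g`.
  lead-of-zero : ∀ {n a f} → Poly n a f → (∀ x → f x ≡ 0ℤ) → a ≡ 0ℤ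
  lead-of-zero (const p) f≡0 = trans (sym (p 0ℤ)) (f≡0 0ℤ)
  lead-of-zero {f = f} (horner c {g} p eq) f≡0 = lead-of-zero p (too-many-roots p ρ (λ e → Fin.toℕ-injective (ℕ.suc-injective (+-injective e))) root)
    where
    ρ : ∀ {n} → Fin n → ℤ
    ρ i = pos (suc (toℕ i))
    c≡0 : c ≡ 0ℤ
    c≡0 = trans (sym (+-identityʳ c)) (trans (sym (eq 0ℤ)) (f≡0 0ℤ))
    root : ∀ {n} (i : Fin n) → g (ρ i) ≡ 0ℤ
    root i = *-cancel-≡0 {ρ i} (λ ()) (trans (sym (+-identityˡ _)) (trans (cong (_+ ρ i * g (ρ i)) (sym c≡0)) (trans (sym (eq (ρ i))) (f≡0 (ρ i)))))

  -- Coefficient vectors in the monomial and the falling-factorial basis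

  eval : ∀ {n} → (Fin n → ℤ) → ℤ → ℤ
  eval {zero} c x = 0ℤ
  eval {suc n} c x = c zero + x * eval (c ∘ suc) x

  -- Nested form of the sum of c_i x(x-1)⋯(x-i+1), the basis in which the auxiliary function is
  -- written.
  newton : ∀ {n} → (Fin n → ℤ) → ℤ → ℤ
  newton {zero} c x = 0ℤ
  newton {suc n} c x = c zero + x * newton (c ∘ suc) (x + -1ℤ)

  eval-zero : ∀ {n} (c : Fin n → ℤ) → (∀ t → c t ≡ 0ℤ) → ∀ x → eval c x ≡ 0ℤ
  eval-zero {zero} c c≡0 x = refl
  eval-zero {suc n} c c≡0 x = cong₂ _+_ (c≡0 zero) (trans (cong (x *_) (eval-zero (c ∘ suc) (c≡0 ∘ suc) x)) (*-zeroʳ x))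

  newton-zero : ∀ {n} (c : Fin n → ℤ) → (∀ t → c t ≡ 0ℤ) → ∀ x → newton c x ≡ 0ℤ
  newton-zero {zero} c c≡0 x = refl
  newton-zero {suc n} c c≡0 x = cong₂ _+_ (c≡0 zero) (trans (cong (x *_) (newton-zero (c ∘ suc) (c≡0 ∘ suc) (x + -1ℤ))) (*-zeroʳ x))

  eval≡sum : ∀ {n} (c : Fin n → ℤ) x → eval c x ≡ sum (λ t → c t * x ^ toℕ t)
  eval≡sum {zero} c x = refl
  eval≡sum {suc n} c x = cong₂ _+_ (sym (*-identityʳ (c zero))) (begin
    x * eval (c ∘ suc) x                          ≡⟨ cong (x *_) (eval≡sum (c ∘ suc) x) ⟩
    x * sum (λ t → c (suc t) * x ^ toℕ t)         ≡⟨ *-distribˡ-sum x (λ t → c (suc t) * x ^ toℕ t) ⟩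
    sum (λ t → x * (c (suc t) * x ^ toℕ t))       ≡⟨ sum-cong-≗ (λ t → x∙yz≈y∙xz x (c (suc t)) (x ^ toℕ t)) ⟩
    sum (λ t → c (suc t) * (x * x ^ toℕ t))       ∎)
    where
    open ≡-Reasoning

  -- `d` is the largest exponent at which some row has a nonzero coefficient. With one degree shared
  -- by all rows, their top coefficients form a single nonzero vector, and this vector is what
  -- `Elimination` refutes.
  common-degree : ∀ {m} n (c : Fin m → Fin n → ℤ) →
    (∀ i t → c i t ≡ 0ℤ) ⊎
    (∃ λ d → d ℕ.< n × Σ (Fin m → ℤ) λ a → (∃ λ i → a i ≢ 0ℤ) × (∀ i → Poly d (a i) (eval (c i))))
  common-degree zero c = inj₁ (λ i ())
  common-degree (suc n) c with common-degree n (λ i → c i ∘ suc)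
  ... | inj₂ (d , d<n , a , a≢0 , p) = inj₂ (suc d , s≤s d<n , a , a≢0 , λ i → horner (c i zero) (p i) (λ x → refl))
  ... | inj₁ tails≡0 with any? (λ i → ¬? (c i zero ≟ 0ℤ))
  ... | yes c₀≢0 = inj₂ (0 , s≤s z≤n , (λ i → c i zero) , c₀≢0 , λ i → const (λ x →
      trans (cong (λ y → c i zero + x * y) (eval-zero (c i ∘ suc) (tails≡0 i) x)) (trans (cong (c i zero +_) (*-zeroʳ x)) (+-identityʳ _))))
  ... | no c₀≡0 = inj₁ λ { i zero → decidable-stable (c i zero ≟ 0ℤ) (λ c₀ → c₀≡0 (i , c₀)) ; i (suc t) → tails≡0 i t }

  newton-degree : ∀ n (c : Fin n → ℤ) → (∀ t → c t ≡ 0ℤ) ⊎ (∃ λ d → d ℕ.< n × ∃ λ a → a ≢ 0ℤ × Poly d a (newton c))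
  newton-degree zero c = inj₁ λ ()
  newton-degree (suc n) c with newton-degree n (c ∘ suc)
  ... | inj₂ (d , d<n , a , a≢0 , p) = inj₂ (suc d , s≤s d<n , a , a≢0 , horner (c zero) (Poly-shift -1ℤ p) (λ x → refl))
  ... | inj₁ tail≡0 with c zero ≟ 0ℤ
  ... | yes c₀≡0 = inj₁ λ { zero → c₀≡0 ; (suc t) → tail≡0 t }
  ... | no c₀≢0 = inj₂ (0 , s≤s z≤n , c zero , c₀≢0 , const (λ x →
      trans (cong (λ y → c zero + x * y) (newton-zero (c ∘ suc) tail≡0 (x + -1ℤ))) (trans (cong (c zero +_) (*-zeroʳ x)) (+-identityʳ _))))

  -- No determinant is computed: a nonzero `c` would be a polynomial of degree below `n` with `n`
  -- distinct roots.
  vandermonde : ∀ {n} (c β : Fin n → ℤ) → (∀ {i j} → β i ≡ β j → i ≡ j) → (∀ k → eval c (β k) ≡ 0ℤ) → ∀ t → c t ≡ 0ℤ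
  vandermonde {n} c β β-inj c≡0 with common-degree {1} n (λ _ → c)
  ... | inj₁ z = z zero
  ... | inj₂ (d , d<n , a , (i , a≢0) , p) = contradiction
    (lead-of-zero (p i) (too-many-roots (p i) (λ k → β (inject≤ k d<n)) (λ e → Fin.inject≤-injective d<n d<n _ _ (β-inj e)) (λ k → c≡0 (inject≤ k d<n))))
    a≢0

  private
    rotate : ∀ x y z → x * y * z ≡ y * z * x
    rotate = solve-∀
    rearrange : ∀ e f A g P → e * f * (A * (g * P)) ≡ A * (P * (e * g * f))
    rearrange = solve-∀
    regroup : ∀ r s ρ L K → r ℕ.* L ℕ.+ s ℕ.* K ℕ.+ ρ ℕ.* L ≡ (r ℕ.+ ρ) ℕ.* L ℕ.+ s ℕ.* K
    regroup = ℕ-Solver.solve-∀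
    count : ∀ j I → suc (j ℕ.* (suc j ℕ.* I) ℕ.+ j) ≡ suc j ℕ.* suc (j ℕ.* I)
    count = ℕ-Solver.solve-∀

  -- The shifts r ↦ r + ρ of the vanishing relation are combined with polynomial multipliers A_ρ, found by linear algebra, so that
  -- only the term k = 0 survives.  It has too many roots, hence vanishes as well, and the leading coefficients of the A_ρ then
  -- solve a Vandermonde system.
  module Elimination (j I S L K : ℕ) (η ξ : Fin (suc j) → ℤ)
    (η-inj : ∀ {i k} → η i ≡ η k → i ≡ k) (η≢0 : ∀ k → η k ≢ 0ℤ) (ξ≢0 : ∀ k → ξ k ≢ 0ℤ)
    (JI≤SS : suc j ℕ.* I ℕ.≤ S ℕ.* S)
    (distinct : ∀ r s r′ s′ → r ℕ.< S → s ℕ.< S → r′ ℕ.< S → s′ ℕ.< S →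
                r ℕ.* L ℕ.+ s ℕ.* K ≡ r′ ℕ.* L ℕ.+ s′ ℕ.* K → r ≡ r′ × s ≡ s′)
    (P : Fin (suc j) → ℤ → ℤ) (deg : Fin (suc j) → ℕ) (lead : Fin (suc j) → ℤ)
    (deg<I : ∀ k → deg k ℕ.< I) (lead≢0 : ∀ k → lead k ≢ 0ℤ) (P-poly : ∀ k → Poly (deg k) (lead k) (P k))
    (vanishes : ∀ r s → r ℕ.< S ℕ.+ suc j → s ℕ.< S →
                sum (λ k → P k (pos (r ℕ.* L ℕ.+ s ℕ.* K)) * (η k ^ r * ξ k ^ s)) ≡ 0ℤ) where

    J D W : ℕ
    J = suc j
    -- `j * I + 1` coefficients per multiplier are the fewest for which the `J * D` unknowns
    -- outnumber the `j * W` equations.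
    D = suc (j ℕ.* I)
    -- `W` exceeds the degree of every combined term, which is at most `j * I` + (`I` - 1).
    -- Vanishing at 0, ..., W - 1 is therefore vanishing identically.
    W = J ℕ.* I

    shifted : Fin J → ℤ → Fin J → ℤ
    shifted k x ρ = η k ^ toℕ ρ * P k (x + pos (toℕ ρ ℕ.* L))

    row : Fin j × Fin W → Fin J × Fin D → ℤ
    row (k , x) (ρ , t) = pos (toℕ x) ^ toℕ t * shifted (suc k) (pos (toℕ x)) ρ

    fewer-equations : j ℕ.* W ℕ.< J ℕ.* D
    fewer-equations = ℕ.≤-trans (s≤s (ℕ.m≤m+n (j ℕ.* W) j)) (ℕ.≤-reflexive (count j I))

    Solves : (Fin (J ℕ.* D) → ℤ) → Set
    Solves sol = ∀ e → sum (λ u → row (remQuot {j} W e) (remQuot {J} D u) * sol u) ≡ 0ℤ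

    row-sum : ∀ sol → Solves sol → ∀ k (x : Fin W) →
      sum (λ ρ → eval (λ t → sol (combine ρ t)) (pos (toℕ x)) * shifted (suc k) (pos (toℕ x)) ρ) ≡ 0ℤ
    row-sum sol equations k x = begin
      sum (λ ρ → eval (a ρ) z * shifted (suc k) z ρ)
        ≡⟨ sum-cong-≗ (λ ρ → trans (cong (_* shifted (suc k) z ρ) (eval≡sum (a ρ) z)) (*-distribʳ-sum (shifted (suc k) z ρ) (λ t → a ρ t * z ^ toℕ t))) ⟩
      sum (λ ρ → sum (λ t → a ρ t * z ^ toℕ t * shifted (suc k) z ρ))
        ≡⟨ sum-cong-≗ (λ ρ → sum-cong-≗ (λ t → trans (rotate (a ρ t) (z ^ toℕ t) (shifted (suc k) z ρ))
             (cong (_* a ρ t) (cong₂ row (sym (Fin.remQuot-combine k x)) (sym (Fin.remQuot-combine ρ t)))))) ⟩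
      sum (λ ρ → sum (λ t → row (remQuot {j} W (combine k x)) (remQuot {J} D (combine ρ t)) * a ρ t))
        ≡⟨ sym (sum-combine J D (λ u → row (remQuot {j} W (combine k x)) (remQuot {J} D u) * sol u)) ⟩
      sum (λ u → row (remQuot {j} W (combine k x)) (remQuot {J} D u) * sol u)
        ≡⟨ equations (combine k x) ⟩
      0ℤ ∎
      where
      open ≡-Reasoning
      z = pos (toℕ x)
      a : Fin J → Fin D → ℤ
      a ρ t = sol (combine ρ t)

    module Leading (n : ℕ) (n≤jI : n ℕ.≤ j ℕ.* I) (b : Fin J → ℤ) (A : Fin J → ℤ → ℤ)
      (A-poly : ∀ ρ → Poly n (b ρ) (A ρ))
      (Q-suc-vanishes : ∀ k (x : Fin W) → sum (λ ρ → A ρ (pos (toℕ x)) * shifted (suc k) (pos (toℕ x)) ρ) ≡ 0ℤ) where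

      -- Combine the relations at (r + ρ, s) with the weights `A ρ x`, where x = rL + sK. Then
      -- `Q k x` is the factor that multiplies η_k^r ξ_k^s, and it is a polynomial in x in which r
      -- and s no longer occur.
      Q : Fin J → ℤ → ℤ
      Q k x = sum (λ ρ → A ρ x * shifted k x ρ)

      Q-lead : Fin J → ℤ
      Q-lead k = sum (λ ρ → b ρ * (η k ^ toℕ ρ * lead k))

      Q-poly : ∀ k → Poly (n ℕ.+ deg k) (Q-lead k) (Q k)
      Q-poly k = Poly-sum _ _ (λ ρ → Poly-* (A-poly ρ) (Poly-scale (η k ^ toℕ ρ) (Poly-shift (pos (toℕ ρ ℕ.* L)) (P-poly k))))

      degree-bound : ∀ k → suc (n ℕ.+ deg k) ℕ.≤ W
      degree-bound k = ℕ.≤-trans (ℕ.≤-reflexive (sym (ℕ.+-suc n (deg k))))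
        (ℕ.≤-trans (ℕ.+-mono-≤ n≤jI (deg<I k)) (ℕ.≤-reflexive (ℕ.+-comm (j ℕ.* I) I)))

      Q-suc-zero : ∀ k x → Q (suc k) x ≡ 0ℤ
      Q-suc-zero k = too-many-roots (Q-poly (suc k)) (λ i → pos (toℕ i))
        (λ e → Fin.toℕ-injective (+-injective e))
        (λ i → trans (cong (Q (suc k) ∘ pos) (sym (Fin.toℕ-inject≤ i (degree-bound (suc k))))) (Q-suc-vanishes k (inject≤ i (degree-bound (suc k)))))

      -- The combined relation is a sum of η_k^r ξ_k^s `Q k x`. All terms but the one with k = 0
      -- have been eliminated, and its powers are nonzero.
      Q-first-root : ∀ r s → r ℕ.< S → s ℕ.< S → Q zero (pos (r ℕ.* L ℕ.+ s ℕ.* K)) ≡ 0ℤ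
      Q-first-root r s r<S s<S = *-cancel-≡0 {η zero ^ r * ξ zero ^ s}
        (*-≢0 (η≢0 zero ∘ i^n≡0⇒i≡0 (η zero) r) (ξ≢0 zero ∘ i^n≡0⇒i≡0 (ξ zero) s)) (begin
        y zero * Q zero x
          ≡⟨ sym (+-identityʳ _) ⟩
        y zero * Q zero x + 0ℤ
          ≡⟨ cong (y zero * Q zero x +_) (sym (sum-zero _ (λ k → trans (cong (y (suc k) *_) (Q-suc-zero k x)) (*-zeroʳ (y (suc k)))))) ⟩
        sum (λ k → y k * Q k x)
          ≡⟨ sum-cong-≗ (λ k → *-distribˡ-sum (y k) (λ ρ → A ρ x * shifted k x ρ)) ⟩
        sum (λ k → sum (λ ρ → y k * (A ρ x * shifted k x ρ)))
          ≡⟨ ∑-comm (λ k ρ → y k * (A ρ x * shifted k x ρ)) ⟩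
        sum (λ ρ → sum (λ k → y k * (A ρ x * shifted k x ρ)))
          ≡⟨ sum-zero _ inner ⟩
        0ℤ ∎)
        where
        open ≡-Reasoning
        x = pos (r ℕ.* L ℕ.+ s ℕ.* K)
        y : Fin J → ℤ
        y k = η k ^ r * ξ k ^ s
        point : ∀ ρ → x + pos (ρ ℕ.* L) ≡ pos ((r ℕ.+ ρ) ℕ.* L ℕ.+ s ℕ.* K)
        point ρ = trans (sym (pos-+ (r ℕ.* L ℕ.+ s ℕ.* K) (ρ ℕ.* L))) (cong pos (regroup r s ρ L K))
        inner : ∀ ρ → sum (λ k → y k * (A ρ x * shifted k x ρ)) ≡ 0ℤ
        inner ρ = begin
          sum (λ k → y k * (A ρ x * shifted k x ρ))
            ≡⟨ sum-cong-≗ (λ k → trans (rearrange (η k ^ r) (ξ k ^ s) (A ρ x) (η k ^ toℕ ρ) (P k (x + pos (toℕ ρ ℕ.* L))))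
                 (cong₂ (λ u v → A ρ x * (P k u * (v * ξ k ^ s))) (point (toℕ ρ)) (sym (^-distribˡ-+-* (η k) r (toℕ ρ))))) ⟩
          sum (λ k → A ρ x * (P k (pos (r′ ℕ.* L ℕ.+ s ℕ.* K)) * (η k ^ r′ * ξ k ^ s)))
            ≡⟨ sym (*-distribˡ-sum (A ρ x) (λ k → P k (pos (r′ ℕ.* L ℕ.+ s ℕ.* K)) * (η k ^ r′ * ξ k ^ s))) ⟩
          A ρ x * sum (λ k → P k (pos (r′ ℕ.* L ℕ.+ s ℕ.* K)) * (η k ^ r′ * ξ k ^ s))
            ≡⟨ cong (A ρ x *_) (vanishes r′ s (ℕ.+-mono-<-≤ r<S (ℕ.<⇒≤ (toℕ<n ρ))) s<S) ⟩
          A ρ x * 0ℤ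
            ≡⟨ *-zeroʳ (A ρ x) ⟩
          0ℤ ∎
          where r′ = r ℕ.+ toℕ ρ

      Q-first-zero : ∀ x → Q zero x ≡ 0ℤ
      Q-first-zero = too-many-roots (Q-poly zero) point point-inj
        (λ i → Q-first-root _ _ (toℕ<n (proj₁ (grid i))) (toℕ<n (proj₂ (grid i))))
        where
        le : suc (n ℕ.+ deg zero) ℕ.≤ S ℕ.* S
        le = ℕ.≤-trans (degree-bound zero) JI≤SS
        grid : Fin (suc (n ℕ.+ deg zero)) → Fin S × Fin S
        grid i = remQuot {S} S (inject≤ i le)
        point : Fin (suc (n ℕ.+ deg zero)) → ℤ
        point i = pos (toℕ (proj₁ (grid i)) ℕ.* L ℕ.+ toℕ (proj₂ (grid i)) ℕ.* K)
        point-inj : ∀ {i i′} → point i ≡ point i′ → i ≡ i′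
        point-inj {i} {i′} e with distinct _ _ _ _ (toℕ<n (proj₁ (grid i))) (toℕ<n (proj₂ (grid i))) (toℕ<n (proj₁ (grid i′))) (toℕ<n (proj₂ (grid i′))) (+-injective e)
        ... | e₁ , e₂ = Fin.inject≤-injective le le i i′ (begin
          inject≤ i le              ≡⟨ sym (Fin.combine-remQuot {S} S _) ⟩
          uncurry combine (grid i)  ≡⟨ cong₂ combine (Fin.toℕ-injective e₁) (Fin.toℕ-injective e₂) ⟩
          uncurry combine (grid i′) ≡⟨ Fin.combine-remQuot {S} S _ ⟩
          inject≤ i′ le             ∎)
          where open ≡-Reasoning

      -- A shift of the argument does not change a leading coefficient, so the top coefficient of
      -- `Q k` is `lead k` times the polynomial with coefficients `b`, evaluated at `η k`.
      b-vanishes : ∀ k → eval b (η k) ≡ 0ℤ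
      b-vanishes k = *-cancel-≡0 (lead≢0 k) (begin
        lead k * eval b (η k)                         ≡⟨ cong (lead k *_) (eval≡sum b (η k)) ⟩
        lead k * sum (λ ρ → b ρ * η k ^ toℕ ρ)        ≡⟨ *-distribˡ-sum (lead k) (λ ρ → b ρ * η k ^ toℕ ρ) ⟩
        sum (λ ρ → lead k * (b ρ * η k ^ toℕ ρ))      ≡⟨ sum-cong-≗ (λ ρ → x∙yz≈y∙zx (lead k) (b ρ) (η k ^ toℕ ρ)) ⟩
        Q-lead k                                      ≡⟨ lead-of-zero (Q-poly k) (Q-zero k) ⟩
        0ℤ                                            ∎)
        where
        open ≡-Reasoning
        Q-zero : ∀ k x → Q k x ≡ 0ℤ
        Q-zero zero = Q-first-zero
        Q-zero (suc k) = Q-suc-zero k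

      lead-vanishes : ∀ ρ → b ρ ≡ 0ℤ
      lead-vanishes = vandermonde b η η-inj b-vanishes

    no-solution : (sol : Fin (J ℕ.* D) → ℤ) → (∃ λ u → sol u ≢ 0ℤ) → Solves sol → ⊥
    no-solution sol (u , sol≢0) equations with common-degree D (λ ρ t → sol (combine {J} ρ t))
    ... | inj₁ a≡0 = sol≢0 (trans (cong sol (sym (Fin.combine-remQuot {J} D u))) (a≡0 (proj₁ (remQuot {J} D u)) (proj₂ (remQuot {J} D u))))
    ... | inj₂ (n , s≤s n≤jI , b , (ρ₀ , b≢0) , A-poly) = b≢0 (Leading.lead-vanishes n n≤jI b _ A-poly (row-sum sol equations) ρ₀)

    contradictory : ⊥
    contradictory = no-solution (proj₁ solution) (proj₁ (proj₂ solution)) (proj₂ (proj₂ solution))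
      where
      solution = underdetermined (j ℕ.* W) (J ℕ.* D) fewer-equations (λ e u → row (remQuot {j} W e) (remQuot {J} D u))

  -- `Elimination` needs true leading coefficients, hence every term nonzero. A term whose
  -- coefficients all vanish is removed first, by induction on `J`.
  zero-estimate : ∀ J I S L K (η ξ : Fin J → ℤ) →
    (∀ {i k} → η i ≡ η k → i ≡ k) → (∀ k → η k ≢ 0ℤ) → (∀ k → ξ k ≢ 0ℤ) → J ℕ.* I ℕ.≤ S ℕ.* S →
    (∀ r s r′ s′ → r ℕ.< S → s ℕ.< S → r′ ℕ.< S → s′ ℕ.< S →
       r ℕ.* L ℕ.+ s ℕ.* K ≡ r′ ℕ.* L ℕ.+ s′ ℕ.* K → r ≡ r′ × s ≡ s′) →
    (e : Fin J → Fin I → ℤ) →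
    (∀ r s → r ℕ.< S ℕ.+ J → s ℕ.< S →
       sum (λ k → newton (e k) (pos (r ℕ.* L ℕ.+ s ℕ.* K)) * (η k ^ r * ξ k ^ s)) ≡ 0ℤ) →
    ∀ k i → e k i ≡ 0ℤ
  zero-estimate (suc j) I S L K η ξ η-inj η≢0 ξ≢0 JI≤SS distinct e vanishes with any? (λ k → all? (λ i → e k i ≟ 0ℤ))
  ... | yes (k , ek≡0) = λ k′ → others k′
    where
    rest : ∀ k′ i → e (punchIn k k′) i ≡ 0ℤ
    rest = zero-estimate j I S L K (η ∘ punchIn k) (ξ ∘ punchIn k)
      (λ eq → Fin.punchIn-injective k _ _ (η-inj eq)) (η≢0 ∘ punchIn k) (ξ≢0 ∘ punchIn k)
      (ℕ.≤-trans (ℕ.m≤n+m (j ℕ.* I) I) JI≤SS) distinct (e ∘ punchIn k)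
      (λ r s r<S+j s<S → trans (sym (trans (sum-remove {i = k} (term r s))
          (trans (cong (_+ sum (term r s ∘ punchIn k)) (cong (_* (η k ^ r * ξ k ^ s)) (newton-zero (e k) ek≡0 (pos (r ℕ.* L ℕ.+ s ℕ.* K))))) (+-identityˡ _))))
        (vanishes r s (ℕ.≤-trans r<S+j (ℕ.+-monoʳ-≤ S (ℕ.n≤1+n j))) s<S))
      where
      term : ℕ → ℕ → Fin (suc j) → ℤ
      term r s k = newton (e k) (pos (r ℕ.* L ℕ.+ s ℕ.* K)) * (η k ^ r * ξ k ^ s)
    others : ∀ k′ i → e k′ i ≡ 0ℤ
    others k′ with k Fin.≟ k′
    ... | yes refl = ek≡0
    ... | no k≢k′ = λ i → trans (cong (λ k″ → e k″ i) (sym (Fin.punchIn-punchOut k≢k′))) (rest (punchOut k≢k′) i)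
  ... | no none = ⊥-elim (Elimination.contradictory j I S L K η ξ η-inj η≢0 ξ≢0 JI≤SS distinct
      (λ k → newton (e k)) (proj₁ ∘ degree) (λ k → proj₁ (proj₂ (proj₂ (degree k))))
      (λ k → proj₁ (proj₂ (degree k))) (λ k → proj₁ (proj₂ (proj₂ (proj₂ (degree k))))) (λ k → proj₂ (proj₂ (proj₂ (proj₂ (degree k))))) vanishes)
    where
    degree : ∀ k → ∃ λ d → d ℕ.< I × ∃ λ a → a ≢ 0ℤ × Poly d a (newton (e k))
    degree k with newton-degree I (e k)
    ... | inj₁ ek≡0 = contradiction (k , ek≡0) none
    ... | inj₂ x = x

open import Data.Nat.Base
open import Data.Nat.Properties
open import Data.Nat.DivMod
open import Data.Nat.Divisibility using (_∣_; _∣?_; _∣0; ∣-trans; ∣⇒≤; ∣1⇒≡1; m∣m*n; n∣m*n; ∣m⇒∣m*n; ∣m+n∣m⇒∣n)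
open import Data.Nat.GCD using (gcd; gcd[m,n]∣m; gcd[m,n]∣n; gcd[m,n]≢0)
open import Data.Nat.Coprimality as Coprimality using (Coprime; coprime-divisor; coprime-/gcd; coprime-+; 1-coprimeTo)
open import Data.Nat.Tactic.RingSolver using (solve-∀)
open import Data.Integer.Base using (0ℤ; -1ℤ) renaming (+_ to pos; _+_ to _+ℤ_; _*_ to _*ℤ_; _-_ to _-ℤ_; _^_ to _^ℤ_)
import Data.Integer.Properties as ℤ
import Data.Integer.Tactic.RingSolver as ℤ-Solver
open import Data.Bool.Base using (Bool; true; false; _∧_; if_then_else_)
open import Data.Bool.Properties using (∧-comm)
open import Data.Empty using (⊥)
open import Data.Fin.Base as Fin using (Fin; zero; suc; toℕ; fromℕ<; combine; finToFun; funToFin)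
open import Data.Fin.Properties as Fin using (toℕ<n)
open import Data.Product using (Σ; ∃; ∃₂; _×_; _,_; proj₁; proj₂)
open import Data.Sum using (_⊎_; inj₁; inj₂)
open import Data.Unit.Base using (⊤; tt)
open import Function using (_∘_; id)
open import Relation.Nullary using (¬_; Dec; yes; no; contradiction; ¬?; map′; _×-dec_; _⊎-dec_)
open import Relation.Binary.Definitions using (tri<; tri≈; tri>)
open import Relation.Binary.PropositionalEquality hiding (J)
open import Algebra.Properties.Semiring.Sum +-*-semiring using (sum; sum-cong-≗; ∑-distrib-+; ∑-comm; *-distribˡ-sum; *-distribʳ-sum)
open import Algebra.Properties.CommutativeSemigroup *-commutativeSemigroup using (x∙yz≈y∙xz; xy∙z≈y∙xz; xy∙z≈xz∙y; x∙yz≈yx∙z; interchange)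
import Algebra.Properties.Semiring.Sum ℤ.+-*-semiring as ℤ-Sum
open ZeroEstimate using (newton; zero-estimate)

-- Sums and the differentiated binomial theorem

sum-mono : ∀ {n} {f g : Fin n → ℕ} → (∀ i → f i ≤ g i) → sum f ≤ sum g
sum-mono {zero} f≤g = z≤n
sum-mono {suc n} f≤g = +-mono-≤ (f≤g zero) (sum-mono (f≤g ∘ suc))

sum-bounded : ∀ {n} {f : Fin n → ℕ} {B : ℕ} → (∀ i → f i ≤ B) → sum f ≤ n * B
sum-bounded {zero} f≤B = z≤n
sum-bounded {suc n} f≤B = +-mono-≤ (f≤B zero) (sum-bounded (f≤B ∘ suc))

term≤sum : ∀ {n} (f : Fin n → ℕ) (i : Fin n) → f i ≤ sum f
term≤sum f zero = m≤m+n _ _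
term≤sum f (suc i) = m≤n⇒m≤o+n (f zero) (term≤sum (f ∘ suc) i)

sum-++ : ∀ {n} m (f : ℕ → ℕ) → sum {m + n} (f ∘ toℕ) ≡ sum {m} (f ∘ toℕ) + sum {n} (λ i → f (m + toℕ i))
sum-++ zero f = refl
sum-++ (suc m) f = trans (cong (f 0 +_) (sum-++ m (f ∘ suc))) (sym (+-assoc (f 0) _ _))

∣-∣-+ : ∀ a b c d → ∣ a + b - c + d ∣ ≤ ∣ a - c ∣ + ∣ b - d ∣
∣-∣-+ a b c d = begin
  ∣ a + b - c + d ∣                       ≤⟨ ∣-∣-triangle (a + b) (c + b) (c + d) ⟩
  ∣ a + b - c + b ∣ + ∣ c + b - c + d ∣   ≡⟨ cong₂ _+_ (trans (cong₂ ∣_-_∣ (+-comm a b) (+-comm c b)) (∣m+n-m+o∣≡∣n-o∣ b a c)) (∣m+n-m+o∣≡∣n-o∣ c b d) ⟩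
  ∣ a - c ∣ + ∣ b - d ∣                   ∎
  where open ≤-Reasoning

∣-∣-sum : ∀ {n} (f g : Fin n → ℕ) → ∣ sum f - sum g ∣ ≤ sum (λ i → ∣ f i - g i ∣)
∣-∣-sum {zero} f g = z≤n
∣-∣-sum {suc n} f g = ≤-trans (∣-∣-+ (f zero) (sum (f ∘ suc)) (g zero) (sum (g ∘ suc)))
  (+-monoʳ-≤ ∣ f zero - g zero ∣ (∣-∣-sum (f ∘ suc) (g ∘ suc)))

∣-∣-≤ : ∀ {a b c} → a ≤ c → b ≤ c → ∣ a - b ∣ ≤ c
∣-∣-≤ {a} {b} a≤c b≤c = ≤-trans (∣m-n∣≤m⊔n a b) (⊔-lub a≤c b≤c)

equal-quotients : ∀ a b d .{{_ : NonZero d}} → a / d ≡ b / d → ∣ a - b ∣ ≤ d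
equal-quotients a b d eq = begin
  ∣ a - b ∣
    ≡⟨ cong₂ ∣_-_∣ (trans (m≡m%n+[m/n]*n a d) (+-comm (a % d) _)) (trans (m≡m%n+[m/n]*n b d) (+-comm (b % d) _)) ⟩
  ∣ a / d * d + a % d - b / d * d + b % d ∣
    ≡⟨ cong (λ q → ∣ a / d * d + a % d - q * d + b % d ∣) (sym eq) ⟩
  ∣ a / d * d + a % d - a / d * d + b % d ∣
    ≡⟨ ∣m+n-m+o∣≡∣n-o∣ (a / d * d) (a % d) (b % d) ⟩
  ∣ a % d - b % d ∣
    ≤⟨ ∣-∣-≤ (<⇒≤ (m%n<n a d)) (<⇒≤ (m%n<n b d)) ⟩
  d ∎
  where open ≤-Reasoning

^-distribʳ-* : ∀ m n k → (m * n) ^ k ≡ m ^ k * n ^ k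
^-distribʳ-* m n zero = refl
^-distribʳ-* m n (suc k) = trans (cong (m * n *_) (^-distribʳ-* m n k)) (interchange m n (m ^ k) (n ^ k))

falling : ℕ → ℕ → ℕ
falling x zero = 1
falling zero (suc i) = 0
falling (suc x) (suc i) = suc x * falling x i

-- falling x i · tˣ⁻ⁱ, the i-th derivative of tˣ
derivative : ℕ → ℕ → ℕ → ℕ
derivative t x zero = t ^ x
derivative t zero (suc i) = 0
derivative t (suc x) (suc i) = suc x * derivative t x i

-- the coefficient of uⁿ in (u + M)ˣ
coefficient : ℕ → ℕ → ℕ → ℕ
coefficient M zero zero = 1
coefficient M zero (suc n) = 0
coefficient M (suc x) zero = M * coefficient M x zero
coefficient M (suc x) (suc n) = coefficient M x n + M * coefficient M x (suc n)

falling≤^ : ∀ x i → falling x i ≤ x ^ i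
falling≤^ x zero = ≤-refl
falling≤^ zero (suc i) = z≤n
falling≤^ (suc x) (suc i) = *-monoʳ-≤ (suc x) (≤-trans (falling≤^ x i) (^-monoˡ-≤ i (n≤1+n x)))

-- The derivative carries tˣ⁻ⁱ; the factor tⁱ avoids negative exponents. For x < i both sides are 0.
falling-derivative : ∀ t x i → falling x i * t ^ x ≡ t ^ i * derivative t x i
falling-derivative t x zero = refl
falling-derivative t zero (suc i) = sym (*-zeroʳ (t ^ suc i))
falling-derivative t (suc x) (suc i) = begin
  suc x * falling x i * (t * t ^ x)            ≡⟨ gather (suc x) (falling x i) t (t ^ x) ⟩
  t * suc x * (falling x i * t ^ x)            ≡⟨ cong (t * suc x *_) (falling-derivative t x i) ⟩
  t * suc x * (t ^ i * derivative t x i)       ≡⟨ interchange t (suc x) (t ^ i) (derivative t x i) ⟩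
  t * t ^ i * (suc x * derivative t x i)       ∎
  where
  open ≡-Reasoning
  gather : ∀ a b c d → a * b * (c * d) ≡ c * a * (b * d)
  gather = solve-∀

-- This is (n+1)·C(x+1, n+1) = (x+1)·C(x, n), with Mˣ⁻ⁿ on both sides. It lets differentiation pass
-- through the binomial sum.
absorption : ∀ M x n → suc n * coefficient M (suc x) (suc n) ≡ suc x * coefficient M x n
absorption M zero zero = solve₀ M
  where
  solve₀ : ∀ M → 1 * (1 + M * 0) ≡ 1 * 1
  solve₀ = solve-∀
absorption M zero (suc n) = trans (cong (suc (suc n) *_) (*-zeroʳ M)) (*-zeroʳ (suc (suc n)))
absorption M (suc x) zero = begin
  1 * (M * c₀ + M * coefficient M (suc x) 1)         ≡⟨ solve₁ M c₀ (coefficient M (suc x) 1) ⟩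
  M * c₀ + M * (1 * coefficient M (suc x) 1)         ≡⟨ cong (λ y → M * c₀ + M * y) (absorption M x zero) ⟩
  M * c₀ + M * (suc x * c₀)                          ≡⟨ solve₂ M c₀ x ⟩
  suc (suc x) * (M * c₀)                             ∎
  where
  open ≡-Reasoning
  c₀ = coefficient M x 0
  solve₁ : ∀ M c d → 1 * (M * c + M * d) ≡ M * c + M * (1 * d)
  solve₁ = solve-∀
  solve₂ : ∀ M c x → M * c + M * (suc x * c) ≡ suc (suc x) * (M * c)
  solve₂ = solve-∀
absorption M (suc x) (suc n) = begin
  suc (suc n) * (c₁ + M * c₂)                        ≡⟨ solve₁ n c₁ M c₂ ⟩
  c₁ + (suc n * c₁ + M * (suc (suc n) * c₂))         ≡⟨ cong₂ (λ y z → c₁ + (y + M * z)) (absorption M x n) (absorption M x (suc n)) ⟩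
  c₁ + (suc x * c₃ + M * (suc x * c₄))               ≡⟨ solve₂ x c₃ M c₄ ⟩
  suc (suc x) * c₁                                   ∎
  where
  open ≡-Reasoning
  c₁ = coefficient M (suc x) (suc n)
  c₂ = coefficient M (suc x) (suc (suc n))
  c₃ = coefficient M x n
  c₄ = coefficient M x (suc n)
  solve₁ : ∀ n c M d → suc (suc n) * (c + M * d) ≡ c + (suc n * c + M * (suc (suc n) * d))
  solve₁ = solve-∀
  solve₂ : ∀ x c M d → (c + M * d) + (suc x * c + M * (suc x * d)) ≡ suc (suc x) * (c + M * d)
  solve₂ = solve-∀

-- Divided by powers of M this is C(x, n) ≤ C(x + y, n): a bound at the largest argument serves all
-- smaller ones.
coefficient-mono : ∀ M x y n → M ^ y * coefficient M x n ≤ coefficient M (y + x) n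
coefficient-mono M x zero n = ≤-reflexive (*-identityˡ _)
coefficient-mono M x (suc y) n = begin
  M * M ^ y * coefficient M x n     ≡⟨ *-assoc M (M ^ y) _ ⟩
  M * (M ^ y * coefficient M x n)   ≤⟨ *-monoʳ-≤ M (coefficient-mono M x y n) ⟩
  M * coefficient M (y + x) n       ≤⟨ step n ⟩
  coefficient M (suc (y + x)) n     ∎
  where
  open ≤-Reasoning
  step : ∀ n → M * coefficient M (y + x) n ≤ coefficient M (suc (y + x)) n
  step zero = ≤-refl
  step (suc n) = m≤n+m _ _

sum-zero : ∀ {n} (f : Fin n → ℕ) → (∀ i → f i ≡ 0) → sum f ≡ 0
sum-zero {zero} f f≡0 = refl
sum-zero {suc n} f f≡0 = cong₂ _+_ (f≡0 zero) (sum-zero (f ∘ suc) (f≡0 ∘ suc))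

binomial : ∀ u M x b → x < b → sum {b} (λ n → coefficient M x (toℕ n) * u ^ toℕ n) ≡ (u + M) ^ x
binomial u M zero (suc b) x<b = cong suc (sum-zero {b} _ (λ _ → refl))
binomial u M (suc x) (suc b) (s≤s x<b) = begin
  M * c 0 * 1 + sum {b} (λ n → (c (toℕ n) + M * c (suc (toℕ n))) * (u * u ^ toℕ n))
    ≡⟨ cong (M * c 0 * 1 +_) (trans (sum-cong-≗ {b} (λ n → expand (c (toℕ n)) M (c (suc (toℕ n))) u (u ^ toℕ n)))
         (trans (∑-distrib-+ {b} (λ n → u * (c (toℕ n) * u ^ toℕ n)) (λ n → M * (c (suc (toℕ n)) * (u * u ^ toℕ n))))
           (cong₂ _+_ (sym (*-distribˡ-sum {b} u (λ n → c (toℕ n) * u ^ toℕ n))) (sym (*-distribˡ-sum {b} M (λ n → c (suc (toℕ n)) * (u * u ^ toℕ n))))))) ⟩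
  M * c 0 * 1 + (u * sum {b} (λ n → c (toℕ n) * u ^ toℕ n) + M * sum {b} (λ n → c (suc (toℕ n)) * u ^ suc (toℕ n)))
    ≡⟨ collect M (c 0) _ _ ⟩
  u * sum {b} (λ n → c (toℕ n) * u ^ toℕ n) + M * sum {suc b} (λ n → c (toℕ n) * u ^ toℕ n)
    ≡⟨ cong₂ (λ y z → u * y + M * z) (binomial u M x b x<b) (binomial u M x (suc b) (m<n⇒m<1+n x<b)) ⟩
  u * (u + M) ^ x + M * (u + M) ^ x
    ≡⟨ sym (*-distribʳ-+ ((u + M) ^ x) u M) ⟩
  (u + M) * (u + M) ^ x ∎
  where
  open ≡-Reasoning
  c : ℕ → ℕ
  c = coefficient M x
  expand : ∀ a M b u v → (a + M * b) * (u * v) ≡ u * (a * v) + M * (b * (u * v))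
  expand = solve-∀
  collect : ∀ M c y z → M * c * 1 + (y + M * z) ≡ y + M * (c * 1 + z)
  collect = solve-∀

-- Differentiating the binomial theorem i times in u.
derivative-binomial : ∀ u M i x b → x < b → sum {b} (λ n → coefficient M x (toℕ n) * derivative u (toℕ n) i) ≡ derivative (u + M) x i
derivative-binomial u M zero x b x<b = binomial u M x b x<b
derivative-binomial u M (suc i) zero (suc b) x<b = sum-zero {b} _ (λ _ → refl)
derivative-binomial u M (suc i) (suc x) (suc b) (s≤s x<b) = begin
  M * coefficient M x 0 * 0 + sum {b} (λ n → coefficient M (suc x) (suc (toℕ n)) * (suc (toℕ n) * derivative u (toℕ n) i))
    ≡⟨ cong₂ _+_ (*-zeroʳ (M * coefficient M x 0)) (sum-cong-≗ {b} (λ n → trans (x∙yz≈yx∙z (coefficient M (suc x) (suc (toℕ n))) (suc (toℕ n)) (derivative u (toℕ n) i))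
         (trans (cong (_* derivative u (toℕ n) i) (absorption M x (toℕ n))) (*-assoc (suc x) (coefficient M x (toℕ n)) (derivative u (toℕ n) i))))) ⟩
  sum {b} (λ n → suc x * (coefficient M x (toℕ n) * derivative u (toℕ n) i))
    ≡⟨ sym (*-distribˡ-sum {b} (suc x) (λ n → coefficient M x (toℕ n) * derivative u (toℕ n) i)) ⟩
  suc x * sum {b} (λ n → coefficient M x (toℕ n) * derivative u (toℕ n) i)
    ≡⟨ cong (suc x *_) (derivative-binomial u M i x b x<b) ⟩
  suc x * derivative (u + M) x i ∎
  where
  open ≡-Reasoning

-- Doubling u multiplies uⁿ⁻ⁱ by 2ⁿ⁻ⁱ. Terms of high order n thus gain 2ⁿ at the fixed price 2ⁱ.
derivative-double : ∀ u n i → 2 ^ n * derivative u n i ≡ 2 ^ i * derivative (2 * u) n i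
derivative-double u n zero = trans (sym (^-distribʳ-* 2 u n)) (sym (*-identityˡ _))
derivative-double u zero (suc i) = sym (*-zeroʳ (2 ^ suc i))
derivative-double u (suc n) (suc i) = begin
  2 * 2 ^ n * (suc n * derivative u n i)         ≡⟨ regroup (2 ^ n) (suc n) (derivative u n i) ⟩
  2 * suc n * (2 ^ n * derivative u n i)         ≡⟨ cong (2 * suc n *_) (derivative-double u n i) ⟩
  2 * suc n * (2 ^ i * derivative (2 * u) n i)   ≡⟨ sym (regroup (2 ^ i) (suc n) (derivative (2 * u) n i)) ⟩
  2 * 2 ^ i * (suc n * derivative (2 * u) n i)   ∎
  where
  open ≡-Reasoning
  regroup : ∀ a b c → 2 * a * (b * c) ≡ 2 * b * (a * c)
  regroup = solve-∀

-- Applied with t = 2τ - M. Of the x factors, x - i are tM ≤ τ², and the i differentiated ones are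
-- Mτ ≤ τ².
derivative-square : ∀ t M τ → t * M ≤ τ * τ → M ≤ τ → ∀ x i →
  M ^ x * (τ ^ i * derivative t x i) ≤ falling x i * (τ ^ x * τ ^ x)
derivative-square t M τ tM≤ττ M≤τ x zero = begin
  M ^ x * (1 * t ^ x)     ≡⟨ cong (M ^ x *_) (*-identityˡ _) ⟩
  M ^ x * t ^ x           ≡⟨ trans (*-comm (M ^ x) (t ^ x)) (sym (^-distribʳ-* t M x)) ⟩
  (t * M) ^ x             ≤⟨ ^-monoˡ-≤ x tM≤ττ ⟩
  (τ * τ) ^ x             ≡⟨ ^-distribʳ-* τ τ x ⟩
  τ ^ x * τ ^ x           ≡⟨ sym (*-identityˡ _) ⟩
  1 * (τ ^ x * τ ^ x)     ∎
  where open ≤-Reasoning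
derivative-square t M τ tM≤ττ M≤τ zero (suc i) = ≤-reflexive (trans (*-identityˡ _) (*-zeroʳ (τ ^ suc i)))
derivative-square t M τ tM≤ττ M≤τ (suc x) (suc i) = begin
  M * M ^ x * (τ * τ ^ i * (suc x * derivative t x i))          ≡⟨ regroup M (M ^ x) τ (τ ^ i) (suc x) (derivative t x i) ⟩
  suc x * (M * τ) * (M ^ x * (τ ^ i * derivative t x i))        ≤⟨ *-mono-≤ (*-monoʳ-≤ (suc x) (*-monoˡ-≤ τ M≤τ)) (derivative-square t M τ tM≤ττ M≤τ x i) ⟩
  suc x * (τ * τ) * (falling x i * (τ ^ x * τ ^ x))             ≡⟨ expand (suc x) τ (falling x i) (τ ^ x) ⟩
  suc x * falling x i * (τ * τ ^ x * (τ * τ ^ x))               ∎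
  where
  open ≤-Reasoning
  regroup : ∀ M m τ t x d → M * m * (τ * t * (x * d)) ≡ x * (M * τ) * (m * (t * d))
  regroup = solve-∀
  expand : ∀ x τ f t → x * (τ * τ) * (f * (t * t)) ≡ x * f * (τ * t * (τ * t))
  expand = solve-∀

-- The auxiliary function

∑∑ : ∀ {J I} → (Fin J → Fin I → ℕ) → ℕ
∑∑ f = sum (λ k → sum (f k))

∑∑-cong : ∀ {J I} {f g : Fin J → Fin I → ℕ} → (∀ k i → f k i ≡ g k i) → ∑∑ f ≡ ∑∑ g
∑∑-cong f≗g = sum-cong-≗ (λ k → sum-cong-≗ (f≗g k))

∑∑-mono : ∀ {J I} {f g : Fin J → Fin I → ℕ} → (∀ k i → f k i ≤ g k i) → ∑∑ f ≤ ∑∑ g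
∑∑-mono f≤g = sum-mono (λ k → sum-mono (f≤g k))

∑∑-bounded : ∀ {J I} {f : Fin J → Fin I → ℕ} {B} → (∀ k i → f k i ≤ B) → ∑∑ f ≤ J * (I * B)
∑∑-bounded f≤B = sum-bounded (λ k → sum-bounded (f≤B k))

*-distribˡ-∑∑ : ∀ {J I} x (f : Fin J → Fin I → ℕ) → x * ∑∑ f ≡ ∑∑ (λ k i → x * f k i)
*-distribˡ-∑∑ x f = trans (*-distribˡ-sum x (λ k → sum (f k))) (sum-cong-≗ (λ k → *-distribˡ-sum x (f k)))

∑∑-sum-comm : ∀ {J I n} (f : Fin n → Fin J → Fin I → ℕ) → sum (λ n → ∑∑ (f n)) ≡ ∑∑ (λ k i → sum (λ n → f n k i))
∑∑-sum-comm f = trans (∑-comm (λ n k → sum (f n k))) (sum-cong-≗ (λ k → ∑-comm (λ n i → f n k i)))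

∣-∣-∑∑ : ∀ {J I} (f g : Fin J → Fin I → ℕ) → ∣ ∑∑ f - ∑∑ g ∣ ≤ ∑∑ (λ k i → ∣ f k i - g k i ∣)
∣-∣-∑∑ f g = ≤-trans (∣-∣-sum (λ k → sum (f k)) (λ k → sum (g k))) (sum-mono (λ k → ∣-∣-sum (f k) (g k)))

funToFin-cong : ∀ {m n} {f g : Fin m → Fin n} → (∀ i → f i ≡ g i) → funToFin f ≡ funToFin g
funToFin-cong {zero} f≗g = refl
funToFin-cong {suc m} f≗g = cong₂ combine (f≗g zero) (funToFin-cong (f≗g ∘ suc))

finToFun-injective : ∀ {m n} (c c′ : Fin (n ^ m)) → (∀ i → finToFun {n} {m} c i ≡ finToFun c′ i) → c ≡ c′
finToFun-injective {m} {n} c c′ eq = trans (sym (Fin.funToFin-finToFin {m} {n} c)) (trans (funToFin-cong eq) (Fin.funToFin-finToFin {m} {n} c′))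

^-mono-exponent : ∀ {x i I} → 1 ≤ x → i ≤ I → x ^ i ≤ x ^ I
^-mono-exponent {suc x} _ i≤I = ^-monoʳ-≤ (suc x) i≤I

-- `τ k / M` stands for θᵏ with one denominator for all k, `β` bounds its power at the largest
-- argument `xm`, 1/`P` is the precision of the boxes and `H` the number of values of a coefficient.
-- `few-boxes` is the pigeonhole count, `small-tail` the smallness of the orders from `T` on.
module AuxiliaryFunction (I J T xm M β P H : ℕ) .{{M≢0 : NonZero M}} (τ : Fin J → ℕ)
  (1≤xm : 1 ≤ xm) (M≤τ : ∀ k → M ≤ τ k) (τ^xm≤ : ∀ k → τ k ^ xm ≤ β * M ^ xm)
  (few-boxes : suc (P * (J * (I * (H * (xm ^ I * β))))) ^ T < (H ^ I) ^ J)
  (small-tail : P * (J * (I * (H * (2 ^ I * (xm ^ I * (β * β)))))) ≤ 2 ^ T) where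

  Coefficients : Set
  Coefficients = Fin J → Fin I → ℕ

  Bounded : Coefficients → Set
  Bounded a = ∀ k i → a k i ≤ H

  F : Coefficients → ℕ → ℕ
  F a x = ∑∑ (λ k i → a k i * (falling x (toℕ i) * τ k ^ x))

  -- The coefficients of the expansion of `F a` obtained from τˣ = ((τ - M) + M)ˣ: `F a x` is the
  -- sum over n of `coefficient M x n * moment a n`. They do not depend on x.
  moment : Coefficients → ℕ → ℕ
  moment a n = ∑∑ (λ k i → a k i * (τ k ^ toℕ i * derivative (τ k ∸ M) n (toℕ i)))

  M^≢0 : ∀ x → NonZero (M ^ x)
  M^≢0 x = m^n≢0 M x

  sum-moments : ∀ (a : Coefficients) {b} (weight : Fin b → ℕ) (index : Fin b → ℕ) →
    sum (λ n → weight n * moment a (index n)) ≡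
    ∑∑ (λ k i → a k i * (τ k ^ toℕ i * sum (λ n → weight n * derivative (τ k ∸ M) (index n) (toℕ i))))
  sum-moments a {b} weight index = begin
    sum (λ n → weight n * moment a (index n))
      ≡⟨ sum-cong-≗ (λ n → *-distribˡ-∑∑ (weight n) (λ k i → a k i * (τ k ^ toℕ i * derivative (τ k ∸ M) (index n) (toℕ i)))) ⟩
    sum (λ n → ∑∑ (λ k i → weight n * (a k i * (τ k ^ toℕ i * derivative (τ k ∸ M) (index n) (toℕ i)))))
      ≡⟨ ∑∑-sum-comm (λ n k i → weight n * (a k i * (τ k ^ toℕ i * derivative (τ k ∸ M) (index n) (toℕ i)))) ⟩
    ∑∑ (λ k i → sum (λ n → weight n * (a k i * (τ k ^ toℕ i * derivative (τ k ∸ M) (index n) (toℕ i)))))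
      ≡⟨ ∑∑-cong (λ k i → trans (sum-cong-≗ (λ n → regroup (weight n) (a k i) (τ k ^ toℕ i) (derivative (τ k ∸ M) (index n) (toℕ i))))
           (trans (sym (*-distribˡ-sum (a k i * τ k ^ toℕ i) (λ n → weight n * derivative (τ k ∸ M) (index n) (toℕ i)))) (*-assoc (a k i) (τ k ^ toℕ i) _))) ⟩
    ∑∑ (λ k i → a k i * (τ k ^ toℕ i * sum (λ n → weight n * derivative (τ k ∸ M) (index n) (toℕ i)))) ∎
    where
    open ≡-Reasoning
    regroup : ∀ w a t d → w * (a * (t * d)) ≡ a * t * (w * d)
    regroup = solve-∀

  low high : Coefficients → ℕ → ℕ
  low a x = sum {T} (λ n → coefficient M x (toℕ n) * moment a (toℕ n))
  -- Orders above x contribute 0, so the range T, ..., T + x reaches far enough whatever `T` is.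
  high a x = sum {suc x} (λ n → coefficient M x (T + toℕ n) * moment a (T + toℕ n))

  F≡low+high : ∀ (a : Coefficients) x → F a x ≡ low a x + high a x
  F≡low+high a x = begin
    F a x
      ≡⟨ ∑∑-cong (λ k i → cong (a k i *_) (trans (falling-derivative (τ k) x (toℕ i)) (cong (τ k ^ toℕ i *_)
           (trans (cong (λ t → derivative t x (toℕ i)) (sym (m∸n+n≡m (M≤τ k))))
             (sym (derivative-binomial (τ k ∸ M) M (toℕ i) x (T + suc x) (m≤n+m (suc x) T))))))) ⟩
    ∑∑ (λ k i → a k i * (τ k ^ toℕ i * sum {T + suc x} (λ n → coefficient M x (toℕ n) * derivative (τ k ∸ M) (toℕ n) (toℕ i))))
      ≡⟨ sym (sum-moments a {T + suc x} (λ n → coefficient M x (toℕ n)) toℕ) ⟩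
    sum {T + suc x} (λ n → coefficient M x (toℕ n) * moment a (toℕ n))
      ≡⟨ sum-++ T (λ n → coefficient M x n * moment a n) ⟩
    low a x + high a x ∎
    where open ≡-Reasoning

  τ^≤ : ∀ k x → x ≤ xm → τ k ^ x ≤ β * M ^ x
  τ^≤ k x x≤xm = *-cancelʳ-≤ (τ k ^ x) (β * M ^ x) (M ^ (xm ∸ x)) {{M^≢0 (xm ∸ x)}} (begin
    τ k ^ x * M ^ (xm ∸ x)          ≤⟨ *-monoʳ-≤ (τ k ^ x) (^-monoˡ-≤ (xm ∸ x) (M≤τ k)) ⟩
    τ k ^ x * τ k ^ (xm ∸ x)        ≡⟨ sym (^-distribˡ-+-* (τ k) x (xm ∸ x)) ⟩
    τ k ^ (x + (xm ∸ x))            ≡⟨ cong (τ k ^_) (m+[n∸m]≡n x≤xm) ⟩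
    τ k ^ xm                        ≤⟨ τ^xm≤ k ⟩
    β * M ^ xm                      ≡⟨ cong (λ e → β * M ^ e) (sym (m+[n∸m]≡n x≤xm)) ⟩
    β * M ^ (x + (xm ∸ x))          ≡⟨ cong (β *_) (^-distribˡ-+-* M x (xm ∸ x)) ⟩
    β * (M ^ x * M ^ (xm ∸ x))      ≡⟨ sym (*-assoc β _ _) ⟩
    β * M ^ x * M ^ (xm ∸ x)        ∎)
    where open ≤-Reasoning

  falling≤ : ∀ x → x ≤ xm → (i : Fin I) → falling x (toℕ i) ≤ xm ^ I
  falling≤ x x≤xm i = ≤-trans (falling≤^ x (toℕ i)) (≤-trans (^-monoˡ-≤ (toℕ i) x≤xm) (^-mono-exponent 1≤xm (<⇒≤ (toℕ<n i))))

  F-bound : ∀ a → Bounded a → F a xm ≤ J * (I * (H * (xm ^ I * β))) * M ^ xm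
  F-bound a a≤H = ≤-trans (∑∑-bounded (λ k i → *-mono-≤ (a≤H k i) (*-mono-≤ (falling≤ xm ≤-refl i) (τ^xm≤ k))))
    (≤-reflexive (regroup J I H (xm ^ I) β (M ^ xm)))
    where
    regroup : ∀ J I H x β m → J * (I * (H * (x * (β * m)))) ≡ J * (I * (H * (x * β))) * m
    regroup = solve-∀

  -- Replacing u = τ − M by 2u costs only the factor (2τ − M)ˣ ≤ (τ²/M)ˣ but gains 2ᵀ on every term with n ≥ T.
  high-term : ∀ k i x → 2 ^ T * (M ^ x * (τ k ^ i * sum {suc x} (λ n → coefficient M x (T + toℕ n) * derivative (τ k ∸ M) (T + toℕ n) i)))
    ≤ 2 ^ i * (falling x i * (τ k ^ x * τ k ^ x))
  high-term k i x = begin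
    2 ^ T * (M ^ x * (τ k ^ i * sum {suc x} (λ n → c (T + toℕ n) * derivative u (T + toℕ n) i)))
      ≡⟨ trans (pull (2 ^ T) (M ^ x) (τ k ^ i) _) (cong (λ y → M ^ x * (τ k ^ i * y)) (*-distribˡ-sum {suc x} (2 ^ T) (λ n → c (T + toℕ n) * derivative u (T + toℕ n) i))) ⟩
    M ^ x * (τ k ^ i * sum {suc x} (λ n → 2 ^ T * (c (T + toℕ n) * derivative u (T + toℕ n) i)))
      ≤⟨ *-monoʳ-≤ (M ^ x) (*-monoʳ-≤ (τ k ^ i) (sum-mono {suc x} (λ n → doubled (toℕ n)))) ⟩
    M ^ x * (τ k ^ i * sum {suc x} (λ n → 2 ^ i * (c (T + toℕ n) * derivative (2 * u) (T + toℕ n) i)))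
      ≡⟨ cong (λ y → M ^ x * (τ k ^ i * y)) (sym (*-distribˡ-sum {suc x} (2 ^ i) (λ n → c (T + toℕ n) * derivative (2 * u) (T + toℕ n) i))) ⟩
    M ^ x * (τ k ^ i * (2 ^ i * sum {suc x} (λ n → c (T + toℕ n) * derivative (2 * u) (T + toℕ n) i)))
      ≤⟨ *-monoʳ-≤ (M ^ x) (*-monoʳ-≤ (τ k ^ i) (*-monoʳ-≤ (2 ^ i) whole)) ⟩
    M ^ x * (τ k ^ i * (2 ^ i * derivative (2 * u + M) x i))
      ≡⟨ push (M ^ x) (τ k ^ i) (2 ^ i) _ ⟩
    2 ^ i * (M ^ x * (τ k ^ i * derivative (2 * u + M) x i))
      ≤⟨ *-monoʳ-≤ (2 ^ i) (derivative-square (2 * u + M) M (τ k) square (M≤τ k) x i) ⟩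
    2 ^ i * (falling x i * (τ k ^ x * τ k ^ x)) ∎
    where
    open ≤-Reasoning
    u = τ k ∸ M
    c = coefficient M x
    pull : ∀ a b c d → a * (b * (c * d)) ≡ b * (c * (a * d))
    pull = solve-∀
    push : ∀ a b c d → a * (b * (c * d)) ≡ c * (a * (b * d))
    push = solve-∀
    doubled : ∀ n → 2 ^ T * (c (T + n) * derivative u (T + n) i) ≤ 2 ^ i * (c (T + n) * derivative (2 * u) (T + n) i)
    doubled n = begin
      2 ^ T * (c (T + n) * derivative u (T + n) i)           ≤⟨ *-monoˡ-≤ _ (^-monoʳ-≤ 2 (m≤m+n T n)) ⟩
      2 ^ (T + n) * (c (T + n) * derivative u (T + n) i)     ≡⟨ x∙yz≈y∙xz (2 ^ (T + n)) (c (T + n)) _ ⟩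
      c (T + n) * (2 ^ (T + n) * derivative u (T + n) i)     ≡⟨ cong (c (T + n) *_) (derivative-double u (T + n) i) ⟩
      c (T + n) * (2 ^ i * derivative (2 * u) (T + n) i)     ≡⟨ x∙yz≈y∙xz (c (T + n)) (2 ^ i) _ ⟩
      2 ^ i * (c (T + n) * derivative (2 * u) (T + n) i)     ∎
    whole : sum {suc x} (λ n → c (T + toℕ n) * derivative (2 * u) (T + toℕ n) i) ≤ derivative (2 * u + M) x i
    whole = begin
      sum {suc x} (λ n → c (T + toℕ n) * derivative (2 * u) (T + toℕ n) i)
        ≤⟨ m≤n+m _ (sum {T} (λ n → c (toℕ n) * derivative (2 * u) (toℕ n) i)) ⟩
      sum {T} (λ n → c (toℕ n) * derivative (2 * u) (toℕ n) i) + sum {suc x} (λ n → c (T + toℕ n) * derivative (2 * u) (T + toℕ n) i)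
        ≡⟨ sym (sum-++ T (λ n → c n * derivative (2 * u) n i)) ⟩
      sum {T + suc x} (λ n → c (toℕ n) * derivative (2 * u) (toℕ n) i)
        ≡⟨ derivative-binomial (2 * u) M i x (T + suc x) (m≤n+m (suc x) T) ⟩
      derivative (2 * u + M) x i ∎
    square : (2 * u + M) * M ≤ τ k * τ k
    square = ≤-trans (m≤m+n _ (u * u)) (≤-reflexive (trans (complete u M) (cong₂ _*_ (m∸n+n≡m (M≤τ k)) (m∸n+n≡m (M≤τ k)))))
      where
      complete : ∀ u M → (2 * u + M) * M + u * u ≡ (u + M) * (u + M)
      complete = solve-∀

  high-small : ∀ a → Bounded a → ∀ x → x ≤ xm → P * high a x ≤ M ^ x
  high-small a a≤H x x≤xm = *-cancelˡ-≤ (2 ^ T * M ^ x) {{m*n≢0 (2 ^ T) (M ^ x) {{m^n≢0 2 T}} {{M^≢0 x}}}} (begin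
    2 ^ T * M ^ x * (P * high a x)
      ≡⟨ regroup₁ (2 ^ T) (M ^ x) P (high a x) ⟩
    P * (2 ^ T * (M ^ x * high a x))
      ≤⟨ *-monoʳ-≤ P scaled ⟩
    P * (J * (I * (H * (2 ^ I * (xm ^ I * (β * M ^ x * (β * M ^ x)))))))
      ≡⟨ regroup₂ P J I H (2 ^ I) (xm ^ I) β (M ^ x) ⟩
    P * (J * (I * (H * (2 ^ I * (xm ^ I * (β * β)))))) * (M ^ x * M ^ x)
      ≤⟨ *-monoˡ-≤ (M ^ x * M ^ x) small-tail ⟩
    2 ^ T * (M ^ x * M ^ x)
      ≡⟨ sym (*-assoc (2 ^ T) _ _) ⟩
    2 ^ T * M ^ x * M ^ x ∎)
    where
    open ≤-Reasoning
    regroup₁ : ∀ t m p h → t * m * (p * h) ≡ p * (t * (m * h))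
    regroup₁ = solve-∀
    regroup₂ : ∀ P J I H t x β m → P * (J * (I * (H * (t * (x * (β * m * (β * m))))))) ≡ P * (J * (I * (H * (t * (x * (β * β)))))) * (m * m)
    regroup₂ = solve-∀
    tailSum : Fin J → Fin I → ℕ
    tailSum k i = sum {suc x} (λ n → coefficient M x (T + toℕ n) * derivative (τ k ∸ M) (T + toℕ n) (toℕ i))
    swap₃ : ∀ t m a y z → t * (m * (a * (y * z))) ≡ a * (t * (m * (y * z)))
    swap₃ = solve-∀
    scaled : 2 ^ T * (M ^ x * high a x) ≤ J * (I * (H * (2 ^ I * (xm ^ I * (β * M ^ x * (β * M ^ x))))))
    scaled = begin
      2 ^ T * (M ^ x * high a x)
        ≡⟨ cong (λ y → 2 ^ T * (M ^ x * y)) (sum-moments a {suc x} (λ n → coefficient M x (T + toℕ n)) (λ n → T + toℕ n)) ⟩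
      2 ^ T * (M ^ x * ∑∑ (λ k i → a k i * (τ k ^ toℕ i * tailSum k i)))
        ≡⟨ trans (cong (2 ^ T *_) (*-distribˡ-∑∑ (M ^ x) (λ k i → a k i * (τ k ^ toℕ i * tailSum k i))))
             (*-distribˡ-∑∑ (2 ^ T) (λ k i → M ^ x * (a k i * (τ k ^ toℕ i * tailSum k i)))) ⟩
      ∑∑ (λ k i → 2 ^ T * (M ^ x * (a k i * (τ k ^ toℕ i * tailSum k i))))
        ≤⟨ ∑∑-bounded (λ k i → ≤-trans (≤-reflexive (swap₃ (2 ^ T) (M ^ x) (a k i) (τ k ^ toℕ i) (tailSum k i)))
             (*-mono-≤ (a≤H k i) (≤-trans (high-term k (toℕ i) x)
               (*-mono-≤ (^-monoʳ-≤ 2 (<⇒≤ (toℕ<n i))) (*-mono-≤ (falling≤ x x≤xm i) (*-mono-≤ (τ^≤ k x x≤xm) (τ^≤ k x x≤xm))))))) ⟩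
      J * (I * (H * (2 ^ I * (xm ^ I * (β * M ^ x * (β * M ^ x)))))) ∎

  boxCount : ℕ
  boxCount = suc (P * (J * (I * (H * (xm ^ I * β)))))

  box : Coefficients → ℕ → ℕ
  box a n = _/_ (P * (coefficient M xm n * moment a n)) (M ^ xm) {{M^≢0 xm}}

  box-bound : ∀ a → Bounded a → (n : Fin T) → box a (toℕ n) < boxCount
  box-bound a a≤H n = s≤s (*-cancelʳ-≤ _ _ (M ^ xm) {{M^≢0 xm}} (begin
    box a (toℕ n) * M ^ xm                                    ≤⟨ m/n*n≤m _ (M ^ xm) {{M^≢0 xm}} ⟩
    P * (coefficient M xm (toℕ n) * moment a (toℕ n))         ≤⟨ *-monoʳ-≤ P (≤-trans (term≤sum (λ n → coefficient M xm (toℕ n) * moment a (toℕ n)) n)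
                                                                   (≤-trans (m≤m+n (low a xm) (high a xm)) (≤-reflexive (sym (F≡low+high a xm))))) ⟩
    P * F a xm                                                ≤⟨ *-monoʳ-≤ P (F-bound a a≤H) ⟩
    P * (J * (I * (H * (xm ^ I * β))) * M ^ xm)               ≡⟨ sym (*-assoc P _ (M ^ xm)) ⟩
    P * (J * (I * (H * (xm ^ I * β)))) * M ^ xm               ∎))
    where open ≤-Reasoning

  -- The boxes record the terms at `xm` only. As `moment` is free of x and `coefficient M x n`
  -- divided by Mˣ increases with x, equal boxes give closeness at every x up to `xm`.
  low-close : ∀ a a′ → (∀ (n : Fin T) → box a (toℕ n) ≡ box a′ (toℕ n)) → ∀ x → x ≤ xm → P * ∣ low a x - low a′ x ∣ ≤ T * M ^ x
  low-close a a′ same x x≤xm = begin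
    P * ∣ low a x - low a′ x ∣
      ≤⟨ *-monoʳ-≤ P (∣-∣-sum {T} (λ n → c (toℕ n) * moment a (toℕ n)) (λ n → c (toℕ n) * moment a′ (toℕ n))) ⟩
    P * sum {T} (λ n → ∣ c (toℕ n) * moment a (toℕ n) - c (toℕ n) * moment a′ (toℕ n) ∣)
      ≡⟨ *-distribˡ-sum {T} P (λ n → ∣ c (toℕ n) * moment a (toℕ n) - c (toℕ n) * moment a′ (toℕ n) ∣) ⟩
    sum {T} (λ n → P * ∣ c (toℕ n) * moment a (toℕ n) - c (toℕ n) * moment a′ (toℕ n) ∣)
      ≤⟨ sum-bounded close ⟩
    T * M ^ x ∎
    where
    open ≤-Reasoning
    c = coefficient M x
    y = xm ∸ x
    regroup : ∀ m p c d → m * (p * (c * d)) ≡ p * (m * c * d)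
    regroup = solve-∀
    close : ∀ (n : Fin T) → P * ∣ c (toℕ n) * moment a (toℕ n) - c (toℕ n) * moment a′ (toℕ n) ∣ ≤ M ^ x
    close n = *-cancelˡ-≤ (M ^ y) {{M^≢0 y}} (begin
      M ^ y * (P * ∣ c n′ * moment a n′ - c n′ * moment a′ n′ ∣)
        ≡⟨ cong (λ z → M ^ y * (P * z)) (sym (*-distribˡ-∣-∣ (c n′) (moment a n′) (moment a′ n′))) ⟩
      M ^ y * (P * (c n′ * δ))
        ≡⟨ regroup (M ^ y) P (c n′) δ ⟩
      P * (M ^ y * c n′ * δ)
        ≤⟨ *-monoʳ-≤ P (*-monoˡ-≤ δ (≤-trans (coefficient-mono M x y n′) (≤-reflexive (cong (λ z → coefficient M z n′) (m∸n+n≡m x≤xm))))) ⟩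
      P * (coefficient M xm n′ * δ)
        ≡⟨ trans (cong (P *_) (*-distribˡ-∣-∣ (coefficient M xm n′) (moment a n′) (moment a′ n′))) (*-distribˡ-∣-∣ P (coefficient M xm n′ * moment a n′) (coefficient M xm n′ * moment a′ n′)) ⟩
      ∣ P * (coefficient M xm n′ * moment a n′) - P * (coefficient M xm n′ * moment a′ n′) ∣
        ≤⟨ equal-quotients (P * (coefficient M xm n′ * moment a n′)) (P * (coefficient M xm n′ * moment a′ n′)) (M ^ xm) {{M^≢0 xm}} (same n) ⟩
      M ^ xm
        ≡⟨ cong (M ^_) (sym (m∸n+n≡m x≤xm)) ⟩
      M ^ (y + x)
        ≡⟨ ^-distribˡ-+-* M y x ⟩
      M ^ y * M ^ x ∎)
      where
      n′ = toℕ n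
      δ = ∣ moment a n′ - moment a′ n′ ∣

  decode : Fin ((H ^ I) ^ J) → Coefficients
  decode c k i = toℕ (finToFun {H} {I} (finToFun {H ^ I} {J} c k) i)

  decode-bounded : ∀ c → Bounded (decode c)
  decode-bounded c k i = <⇒≤ (toℕ<n (finToFun {H} {I} (finToFun {H ^ I} {J} c k) i))

  decode-injective : ∀ c c′ → (∀ k i → decode c k i ≡ decode c′ k i) → c ≡ c′
  decode-injective c c′ eq = finToFun-injective {J} {H ^ I} c c′ (λ k → finToFun-injective {I} {H} _ _ (λ i → Fin.toℕ-injective (eq k i)))

  boxes : Fin ((H ^ I) ^ J) → Fin T → Fin boxCount
  boxes c n = fromℕ< (box-bound (decode c) (decode-bounded c) n)

  same-boxes : ∀ c c′ → funToFin (boxes c) ≡ funToFin (boxes c′) → ∀ n → box (decode c) (toℕ n) ≡ box (decode c′) (toℕ n)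
  same-boxes c c′ collide n = begin
    box (decode c) (toℕ n)                        ≡⟨ Fin.toℕ-fromℕ< (box-bound (decode c) (decode-bounded c) n) ⟨
    toℕ (boxes c n)                               ≡⟨ cong toℕ (Fin.finToFun-funToFin (boxes c) n) ⟨
    toℕ (finToFun (funToFin (boxes c)) n)         ≡⟨ cong (λ e → toℕ (finToFun {boxCount} {T} e n)) collide ⟩
    toℕ (finToFun (funToFin (boxes c′)) n)        ≡⟨ cong toℕ (Fin.finToFun-funToFin (boxes c′) n) ⟩
    toℕ (boxes c′ n)                              ≡⟨ Fin.toℕ-fromℕ< (box-bound (decode c′) (decode-bounded c′) n) ⟩
    box (decode c′) (toℕ n)                       ∎
    where open ≡-Reasoning

  F-close : ∀ a a′ → Bounded a → Bounded a′ → (∀ (n : Fin T) → box a (toℕ n) ≡ box a′ (toℕ n)) →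
    ∀ x → x ≤ xm → P * ∣ F a x - F a′ x ∣ ≤ suc T * M ^ x
  F-close a a′ a≤H a′≤H same x x≤xm = begin
    P * ∣ F a x - F a′ x ∣
      ≡⟨ cong (P *_) (cong₂ ∣_-_∣ (F≡low+high a x) (F≡low+high a′ x)) ⟩
    P * ∣ low a x + high a x - low a′ x + high a′ x ∣
      ≤⟨ *-monoʳ-≤ P (∣-∣-+ (low a x) (high a x) (low a′ x) (high a′ x)) ⟩
    P * (∣ low a x - low a′ x ∣ + ∣ high a x - high a′ x ∣)
      ≡⟨ *-distribˡ-+ P ∣ low a x - low a′ x ∣ ∣ high a x - high a′ x ∣ ⟩
    P * ∣ low a x - low a′ x ∣ + P * ∣ high a x - high a′ x ∣
      ≤⟨ +-mono-≤ (low-close a a′ same x x≤xm)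
           (≤-trans (≤-reflexive (*-distribˡ-∣-∣ P (high a x) (high a′ x)))
             (∣-∣-≤ (high-small a a≤H x x≤xm) (high-small a′ a′≤H x x≤xm))) ⟩
    T * M ^ x + M ^ x
      ≡⟨ +-comm (T * M ^ x) (M ^ x) ⟩
    suc T * M ^ x ∎
    where open ≤-Reasoning

  -- The integers c_ki, possibly negative, are the differences of `a k i` and `a′ k i`. Keeping the
  -- pair leaves all estimates in ℕ.
  close-pair : ∃₂ λ a a′ → Bounded a × Bounded a′ × ¬ (∀ k i → a k i ≡ a′ k i) ×
    (∀ x → x ≤ xm → P * ∣ F a x - F a′ x ∣ ≤ suc T * M ^ x)
  close-pair = from-collision (Fin.pigeonhole few-boxes (λ c → funToFin (boxes c)))
    where
    from-collision : (∃₂ λ c c′ → c Fin.< c′ × funToFin (boxes c) ≡ funToFin (boxes c′)) → _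
    from-collision (c , c′ , c<c′ , collide) = decode c , decode c′ , decode-bounded c , decode-bounded c′ ,
      (λ eq → Fin.<⇒≢ c<c′ (decode-injective c c′ eq)) ,
      F-close (decode c) (decode c′) (decode-bounded c) (decode-bounded c′) (same-boxes c c′ collide)

-- Numbers equal up to powers of 1 + 1/Z

^-comm : ∀ a m n → (a ^ m) ^ n ≡ (a ^ n) ^ m
^-comm a m n = trans (^-*-assoc a m n) (trans (cong (a ^_) (*-comm m n)) (sym (^-*-assoc a n m)))

0<^ : ∀ {a} n → 0 < a → 0 < a ^ n
0<^ {suc a} n _ = m^n>0 (suc a) n

-- a/b lies between (1 + 1/Z)⁻ᴱ and (1 + 1/Z)ᴱ
record Near (Z E a b : ℕ) : Set where
  constructor near
  field
    fst≤ : Z ^ E * a ≤ suc Z ^ E * b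
    snd≤ : Z ^ E * b ≤ suc Z ^ E * a

Near-sym : ∀ {Z E a b} → Near Z E a b → Near Z E b a
Near-sym (near p q) = near q p

private
  mul : ∀ {Z E E′ a a′ b b′} → Z ^ E * a ≤ suc Z ^ E * b → Z ^ E′ * a′ ≤ suc Z ^ E′ * b′ →
    Z ^ (E + E′) * (a * a′) ≤ suc Z ^ (E + E′) * (b * b′)
  mul {Z} {E} {E′} {a} {a′} {b} {b′} p q = begin
    Z ^ (E + E′) * (a * a′)              ≡⟨ split Z a a′ ⟩
    Z ^ E * a * (Z ^ E′ * a′)            ≤⟨ *-mono-≤ p q ⟩
    suc Z ^ E * b * (suc Z ^ E′ * b′)    ≡⟨ split (suc Z) b b′ ⟨
    suc Z ^ (E + E′) * (b * b′)          ∎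
    where
    open ≤-Reasoning
    split : ∀ Z a b → Z ^ (E + E′) * (a * b) ≡ Z ^ E * a * (Z ^ E′ * b)
    split Z a b = trans (cong (_* (a * b)) (^-distribˡ-+-* Z E E′)) (interchange (Z ^ E) (Z ^ E′) a b)

Near-* : ∀ {Z E E′ a a′ b b′} → Near Z E a b → Near Z E′ a′ b′ → Near Z (E + E′) (a * a′) (b * b′)
Near-* {Z} {E} {E′} (near p q) (near p′ q′) = near (mul {Z} {E} {E′} p p′) (mul {Z} {E} {E′} q q′)

Near-refl : ∀ {Z} a → Near Z 0 a a
Near-refl a = near ≤-refl ≤-refl

Near-^ : ∀ {Z E a b} k → Near Z E a b → Near Z (k * E) (a ^ k) (b ^ k)
Near-^ zero p = Near-refl 1
Near-^ (suc k) p = Near-* p (Near-^ k p)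

Near-weaken : ∀ {Z E E′ a b} → E ≤ E′ → Near Z E a b → Near Z E′ a b
Near-weaken {Z} {E} {E′} {a} {b} E≤E′ p = subst₂ (λ u v → Near Z E′ u v) (*-identityʳ a) (*-identityʳ b)
  (subst (λ e → Near Z e (a * 1) (b * 1)) (m+[n∸m]≡n E≤E′) (Near-* p unit))
  where
  unit : Near Z (E′ ∸ E) 1 1
  unit = near (*-monoˡ-≤ 1 (^-monoˡ-≤ (E′ ∸ E) (n≤1+n Z))) (*-monoˡ-≤ 1 (^-monoˡ-≤ (E′ ∸ E) (n≤1+n Z)))

-- (1 + 1/Z)ᴱ ≤ 1 + 2E/Z: in the induction the product term 2E/Z² is absorbed because 2E ≤ Z.
bernoulli-upper : ∀ Z E → 2 * E ≤ Z → suc Z ^ E * Z ≤ Z ^ E * (Z + 2 * E)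
bernoulli-upper Z zero _ = ≤-reflexive (cong (1 *_) (sym (+-identityʳ Z)))
bernoulli-upper Z (suc E) 2E+2≤Z = begin
  suc Z * suc Z ^ E * Z                        ≡⟨ *-assoc (suc Z) (suc Z ^ E) Z ⟩
  suc Z * (suc Z ^ E * Z)                      ≤⟨ *-monoʳ-≤ (suc Z) (bernoulli-upper Z E 2E≤Z) ⟩
  suc Z * (Z ^ E * (Z + 2 * E))                ≡⟨ expand Z (Z ^ E) E ⟩
  Z ^ E * (Z * Z + 2 * E * Z + Z + 2 * E)      ≤⟨ *-monoʳ-≤ (Z ^ E) (+-monoʳ-≤ (Z * Z + 2 * E * Z + Z) 2E≤Z) ⟩
  Z ^ E * (Z * Z + 2 * E * Z + Z + Z)          ≡⟨ collect Z (Z ^ E) E ⟩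
  Z * Z ^ E * (Z + 2 * suc E)                  ∎
  where
  open ≤-Reasoning
  2E≤Z : 2 * E ≤ Z
  2E≤Z = ≤-trans (*-monoʳ-≤ 2 (n≤1+n E)) 2E+2≤Z
  expand : ∀ Z e E → suc Z * (e * (Z + 2 * E)) ≡ e * (Z * Z + 2 * E * Z + Z + 2 * E)
  expand = solve-∀
  collect : ∀ Z e E → e * (Z * Z + 2 * E * Z + Z + Z) ≡ Z * e * (Z + 2 * suc E)
  collect = solve-∀

private
  one-sided : ∀ {Z E a b} → 0 < Z → 2 * E ≤ Z → Z ^ E * a ≤ suc Z ^ E * b → Z * a ≤ Z * b + 2 * E * b
  one-sided {Z@(suc _)} {E} {a} {b} _ 2E≤Z p = *-cancelˡ-≤ (Z ^ E) {{m^n≢0 Z E}} (begin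
    Z ^ E * (Z * a)            ≡⟨ x∙yz≈y∙xz (Z ^ E) Z a ⟩
    Z * (Z ^ E * a)            ≤⟨ *-monoʳ-≤ Z p ⟩
    Z * (suc Z ^ E * b)        ≡⟨ x∙yz≈yx∙z Z (suc Z ^ E) b ⟩
    suc Z ^ E * Z * b          ≤⟨ *-monoˡ-≤ b (bernoulli-upper Z E 2E≤Z) ⟩
    Z ^ E * (Z + 2 * E) * b    ≡⟨ distribute (Z ^ E) Z E b ⟩
    Z ^ E * (Z * b + 2 * E * b) ∎)
    where
    open ≤-Reasoning
    distribute : ∀ e Z E b → e * (Z + 2 * E) * b ≡ e * (Z * b + 2 * E * b)
    distribute = solve-∀

Near⇒close : ∀ {Z E a b} → 0 < Z → 2 * E ≤ Z → Near Z E a b → Z * ∣ a - b ∣ ≤ 2 * E * a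
Near⇒close {Z} {E} {a} {b} 0<Z 2E≤Z (near p q) with ≤-total a b
... | inj₁ a≤b = begin
  Z * ∣ a - b ∣     ≡⟨ trans (cong (Z *_) (m≤n⇒∣m-n∣≡n∸m a≤b)) (*-distribˡ-∸ Z b a) ⟩
  Z * b ∸ Z * a     ≤⟨ m≤n+o⇒m∸n≤o (Z * b) (Z * a) (one-sided {Z} {E} 0<Z 2E≤Z q) ⟩
  2 * E * a         ∎
  where open ≤-Reasoning
... | inj₂ b≤a = begin
  Z * ∣ a - b ∣     ≡⟨ trans (cong (Z *_) (m≤n⇒∣n-m∣≡n∸m b≤a)) (*-distribˡ-∸ Z a b) ⟩
  Z * a ∸ Z * b     ≤⟨ m≤n+o⇒m∸n≤o (Z * a) (Z * b) (one-sided {Z} {E} 0<Z 2E≤Z p) ⟩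
  2 * E * b         ≤⟨ *-monoʳ-≤ (2 * E) b≤a ⟩
  2 * E * a         ∎
  where open ≤-Reasoning

-- Distinct integers differ by at least 1, whereas the distance here is at most 2Ea/Z < 1.
Near⇒≡ : ∀ {Z E a b} → 0 < Z → 2 * E ≤ Z → 2 * E * a < Z → Near Z E a b → a ≡ b
Near⇒≡ {Z} {E} {a} {b} 0<Z 2E≤Z 2Ea<Z p with ∣ a - b ∣ in eq | Near⇒close 0<Z 2E≤Z p
... | zero | _ = ∣m-n∣≡0⇒m≡n eq
... | suc δ | q = contradiction (≤-trans (≤-trans (m≤m*n Z (suc δ)) q) (<⇒≤pred 2Ea<Z)) (pred≮ Z 0<Z)
  where
  pred≮ : ∀ Z → 0 < Z → ¬ Z ≤ pred Z
  pred≮ (suc Z) _ = 1+n≰n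

^≤2^ : ∀ h {a} n → a ≤ 2 ^ h → a ^ n ≤ 2 ^ (h * n)
^≤2^ h n a≤2^h = ≤-trans (^-monoˡ-≤ n a≤2^h) (≤-reflexive (^-*-assoc 2 h n))

-- φ and φ′ are approximated by Yf/m and Yf′/m. The two errors add up to less than 1/2 since 8EΦ <
-- Z, and the approximations are at most 1/2 apart since 2CY ≤ P. So the integers φ and φ′ are less
-- than 1 apart.
separated : ∀ P Z E m C Y {φ φ′ f f′ Φ} →
  Z * ∣ φ * m - Y * f ∣ ≤ 2 * E * (φ * m) → Z * ∣ φ′ * m - Y * f′ ∣ ≤ 2 * E * (φ′ * m) →
  P * ∣ f - f′ ∣ ≤ C * m → 2 * C * Y ≤ P → φ ≤ Φ → φ′ ≤ Φ → 8 * E * Φ < Z → 0 < P → 0 < m → φ ≡ φ′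
separated P Z E m C Y {φ} {φ′} {f} {f′} {Φ} cl cl′ clF 2CY≤P φ≤Φ φ′≤Φ 8EΦ<Z 0<P 0<m with ∣ φ - φ′ ∣ in eq
... | zero = ∣m-n∣≡0⇒m≡n eq
... | suc δ = contradiction total (<⇒≱ too-small)
  where
  open ≤-Reasoning
  m≤diff : m ≤ ∣ φ * m - φ′ * m ∣
  m≤diff = begin
    m                          ≤⟨ m≤n*m m (suc δ) ⟩
    suc δ * m                  ≡⟨ cong (_* m) (sym eq) ⟩
    ∣ φ - φ′ ∣ * m             ≡⟨ *-distribʳ-∣-∣ m φ φ′ ⟩
    ∣ φ * m - φ′ * m ∣         ∎
  diff≤ : ∣ φ * m - φ′ * m ∣ ≤ ∣ φ * m - Y * f ∣ + (Y * ∣ f - f′ ∣ + ∣ φ′ * m - Y * f′ ∣)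
  diff≤ = ≤-trans (∣-∣-triangle (φ * m) (Y * f) (φ′ * m)) (+-monoʳ-≤ _ (≤-trans (∣-∣-triangle (Y * f) (Y * f′) (φ′ * m))
    (+-mono-≤ (≤-reflexive (sym (*-distribˡ-∣-∣ Y f f′))) (≤-reflexive (∣-∣-comm (Y * f′) (φ′ * m))))))
  solve₁ : ∀ P Z u Y v w → P * (Z * (u + (Y * v + w))) ≡ P * (Z * u + Z * w) + Z * Y * (P * v)
  solve₁ = solve-∀
  solve₂ : ∀ P E Φ m Z Y C → 2 * (P * (2 * E * (Φ * m) + 2 * E * (Φ * m)) + Z * Y * (C * m)) ≡ P * (8 * E * Φ) * m + Z * (2 * C * Y) * m
  solve₂ = solve-∀
  solve₃ : ∀ P Z m → P * Z * m + Z * P * m ≡ 2 * (P * (Z * m))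
  solve₃ = solve-∀
  instance
    P≢0 : NonZero P
    P≢0 = >-nonZero 0<P
    m≢0 : NonZero m
    m≢0 = >-nonZero 0<m
  total : 2 * (P * (Z * m)) ≤ P * (8 * E * Φ) * m + Z * (2 * C * Y) * m
  total = begin
    2 * (P * (Z * m))
      ≤⟨ *-monoʳ-≤ 2 (*-monoʳ-≤ P (*-monoʳ-≤ Z (≤-trans m≤diff diff≤))) ⟩
    2 * (P * (Z * (∣ φ * m - Y * f ∣ + (Y * ∣ f - f′ ∣ + ∣ φ′ * m - Y * f′ ∣))))
      ≡⟨ cong (2 *_) (solve₁ P Z ∣ φ * m - Y * f ∣ Y ∣ f - f′ ∣ ∣ φ′ * m - Y * f′ ∣) ⟩
    2 * (P * (Z * ∣ φ * m - Y * f ∣ + Z * ∣ φ′ * m - Y * f′ ∣) + Z * Y * (P * ∣ f - f′ ∣))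
      ≤⟨ *-monoʳ-≤ 2 (+-mono-≤ (*-monoʳ-≤ P (+-mono-≤ (≤-trans cl (*-monoʳ-≤ (2 * E) (*-monoˡ-≤ m φ≤Φ))) (≤-trans cl′ (*-monoʳ-≤ (2 * E) (*-monoˡ-≤ m φ′≤Φ)))))
           (*-monoʳ-≤ (Z * Y) clF)) ⟩
    2 * (P * (2 * E * (Φ * m) + 2 * E * (Φ * m)) + Z * Y * (C * m))
      ≡⟨ solve₂ P E Φ m Z Y C ⟩
    P * (8 * E * Φ) * m + Z * (2 * C * Y) * m ∎
  too-small : P * (8 * E * Φ) * m + Z * (2 * C * Y) * m < 2 * (P * (Z * m))
  too-small = begin-strict
    P * (8 * E * Φ) * m + Z * (2 * C * Y) * m   <⟨ +-mono-<-≤ (*-monoˡ-< m (*-monoʳ-< P 8EΦ<Z)) (*-monoˡ-≤ m (*-monoʳ-≤ Z 2CY≤P)) ⟩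
    P * Z * m + Z * P * m                       ≡⟨ solve₃ P Z m ⟩
    2 * (P * (Z * m))                           ∎

pos-^ : ∀ a n → pos a ^ℤ n ≡ pos (a ^ n)
pos-^ a zero = refl
pos-^ a (suc n) = trans (cong (pos a *ℤ_) (pos-^ a n)) (sym (ℤ.pos-* a (a ^ n)))

newton-difference : ∀ {n} (c c′ : Fin n → ℕ) x → newton (λ i → pos (c i) -ℤ pos (c′ i)) (pos x) ≡
  pos (sum (λ i → c i * falling x (toℕ i))) -ℤ pos (sum (λ i → c′ i * falling x (toℕ i)))
newton-difference {zero} c c′ x = refl
newton-difference {suc n} c c′ zero = begin
  (pos (c zero) -ℤ pos (c′ zero)) +ℤ 0ℤ *ℤ rest     ≡⟨ trans (cong ((pos (c zero) -ℤ pos (c′ zero)) +ℤ_) (ℤ.*-zeroˡ rest)) (ℤ.+-identityʳ _) ⟩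
  pos (c zero) -ℤ pos (c′ zero)                     ≡⟨ cong₂ (λ u v → pos u -ℤ pos v) (only-head c) (only-head c′) ⟩
  pos (sum (λ i → c i * falling 0 (toℕ i))) -ℤ pos (sum (λ i → c′ i * falling 0 (toℕ i))) ∎
  where
  open ≡-Reasoning
  rest = newton (λ i → pos (c (suc i)) -ℤ pos (c′ (suc i))) -1ℤ
  only-head : ∀ (c : Fin (suc n) → ℕ) → c zero ≡ sum (λ i → c i * falling 0 (toℕ i))
  only-head c = sym (trans (cong₂ _+_ (*-identityʳ (c zero)) (sum-zero (λ i → c (suc i) * 0) (λ i → *-zeroʳ (c (suc i))))) (+-identityʳ _))
newton-difference {suc n} c c′ (suc x) = begin
  (pos (c zero) -ℤ pos (c′ zero)) +ℤ pos (suc x) *ℤ newton (λ i → pos (c (suc i)) -ℤ pos (c′ (suc i))) (pos x)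
    ≡⟨ cong (λ u → (pos (c zero) -ℤ pos (c′ zero)) +ℤ pos (suc x) *ℤ u) (newton-difference (c ∘ suc) (c′ ∘ suc) x) ⟩
  (pos (c zero) -ℤ pos (c′ zero)) +ℤ pos (suc x) *ℤ (pos (tail c) -ℤ pos (tail c′))
    ≡⟨ regroup (pos (c zero)) (pos (c′ zero)) (pos (suc x)) (pos (tail c)) (pos (tail c′)) ⟩
  (pos (c zero) +ℤ pos (suc x) *ℤ pos (tail c)) -ℤ (pos (c′ zero) +ℤ pos (suc x) *ℤ pos (tail c′))
    ≡⟨ cong₂ _-ℤ_ (total c) (total c′) ⟩
  pos (sum (λ i → c i * falling (suc x) (toℕ i))) -ℤ pos (sum (λ i → c′ i * falling (suc x) (toℕ i))) ∎
  where
  open ≡-Reasoning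
  tail : (Fin (suc n) → ℕ) → ℕ
  tail c = sum (λ i → c (suc i) * falling x (toℕ i))
  regroup : ∀ a b x u v → (a -ℤ b) +ℤ x *ℤ (u -ℤ v) ≡ (a +ℤ x *ℤ u) -ℤ (b +ℤ x *ℤ v)
  regroup = ℤ-Solver.solve-∀
  total : ∀ (c : Fin (suc n) → ℕ) → pos (c zero) +ℤ pos (suc x) *ℤ pos (tail c) ≡ pos (sum (λ i → c i * falling (suc x) (toℕ i)))
  total c = trans (cong (pos (c zero) +ℤ_) (sym (ℤ.pos-* (suc x) (tail c)))) (cong pos
    (cong₂ _+_ (sym (*-identityʳ (c zero))) (trans (*-distribˡ-sum (suc x) (λ i → c (suc i) * falling x (toℕ i))) (sum-cong-≗ (λ i → x∙yz≈y∙xz (suc x) (c (suc i)) (falling x (toℕ i)))))))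

pos-sum-difference : ∀ {n} (f g : Fin n → ℕ) → ℤ-Sum.sum (λ k → pos (f k) -ℤ pos (g k)) ≡ pos (sum f) -ℤ pos (sum g)
pos-sum-difference {zero} f g = refl
pos-sum-difference {suc n} f g = trans (cong ((pos (f zero) -ℤ pos (g zero)) +ℤ_) (pos-sum-difference (f ∘ suc) (g ∘ suc)))
  (regroup (pos (f zero)) (pos (g zero)) (pos (sum (f ∘ suc))) (pos (sum (g ∘ suc))))
  where
  regroup : ∀ a b u v → (a -ℤ b) +ℤ (u -ℤ v) ≡ (a +ℤ u) -ℤ (b +ℤ v)
  regroup = ℤ-Solver.solve-∀

-- Subtracting the two sides gives a vanishing sum with the integer coefficients `a k i` - `a′ k i`.
zero-estimate-ℕ : ∀ J I S L K (η ξ : Fin J → ℕ) →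
  (∀ {i k} → η i ≡ η k → i ≡ k) → (∀ k → 0 < η k) → (∀ k → 0 < ξ k) → J * I ≤ S * S →
  (∀ r s r′ s′ → r < S → s < S → r′ < S → s′ < S → r * L + s * K ≡ r′ * L + s′ * K → r ≡ r′ × s ≡ s′) →
  (a a′ : Fin J → Fin I → ℕ) →
  (∀ r s → r < S + J → s < S →
     ∑∑ (λ k i → a k i * (falling (r * L + s * K) (toℕ i) * (η k ^ r * ξ k ^ s))) ≡
     ∑∑ (λ k i → a′ k i * (falling (r * L + s * K) (toℕ i) * (η k ^ r * ξ k ^ s)))) →
  ∀ k i → a k i ≡ a′ k i
zero-estimate-ℕ J I S L K η ξ η-inj 0<η 0<ξ JI≤SS distinct a a′ same k i =
  ℤ.+-injective (ℤ.i-j≡0⇒i≡j _ _ (zero-estimate J I S L K (pos ∘ η) (pos ∘ ξ) (η-inj ∘ ℤ.+-injective)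
    (λ k → pos≢0 (0<η k)) (λ k → pos≢0 (0<ξ k)) JI≤SS distinct (λ k i → pos (a k i) -ℤ pos (a′ k i)) vanishes k i))
  where
  pos≢0 : ∀ {n} → 0 < n → pos n ≢ 0ℤ
  pos≢0 0<n eq = >⇒≢ 0<n (ℤ.+-injective eq)
  vanishes : ∀ r s → r < S + J → s < S →
    ℤ-Sum.sum (λ k → newton (λ i → pos (a k i) -ℤ pos (a′ k i)) (pos (r * L + s * K)) *ℤ (pos (η k) ^ℤ r *ℤ pos (ξ k) ^ℤ s)) ≡ 0ℤ
  vanishes r s r< s< = begin
    ℤ-Sum.sum (λ k → newton (λ i → pos (a k i) -ℤ pos (a′ k i)) (pos x) *ℤ (pos (η k) ^ℤ r *ℤ pos (ξ k) ^ℤ s))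
      ≡⟨ ℤ-Sum.sum-cong-≗ term ⟩
    ℤ-Sum.sum (λ k → pos (sum (λ i → a k i * (falling x (toℕ i) * y k))) -ℤ pos (sum (λ i → a′ k i * (falling x (toℕ i) * y k))))
      ≡⟨ pos-sum-difference (λ k → sum (λ i → a k i * (falling x (toℕ i) * y k))) (λ k → sum (λ i → a′ k i * (falling x (toℕ i) * y k))) ⟩
    pos (∑∑ (λ k i → a k i * (falling x (toℕ i) * y k))) -ℤ pos (∑∑ (λ k i → a′ k i * (falling x (toℕ i) * y k)))
      ≡⟨ ℤ.i≡j⇒i-j≡0 (cong pos (same r s r< s<)) ⟩
    0ℤ ∎
    where
    open ≡-Reasoning
    x = r * L + s * K
    y : Fin J → ℕ
    y k = η k ^ r * ξ k ^ s
    inner : ∀ k (a : Fin J → Fin I → ℕ) → sum (λ i → a k i * falling x (toℕ i)) * y k ≡ sum (λ i → a k i * (falling x (toℕ i) * y k))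
    inner k a = trans (*-distribʳ-sum (y k) (λ i → a k i * falling x (toℕ i))) (sum-cong-≗ (λ i → *-assoc (a k i) (falling x (toℕ i)) (y k)))
    distribute : ∀ u v w → (u -ℤ v) *ℤ w ≡ u *ℤ w -ℤ v *ℤ w
    distribute = ℤ-Solver.solve-∀
    term : ∀ k → newton (λ i → pos (a k i) -ℤ pos (a′ k i)) (pos x) *ℤ (pos (η k) ^ℤ r *ℤ pos (ξ k) ^ℤ s) ≡
      pos (sum (λ i → a k i * (falling x (toℕ i) * y k))) -ℤ pos (sum (λ i → a′ k i * (falling x (toℕ i) * y k)))
    term k = begin
      newton (λ i → pos (a k i) -ℤ pos (a′ k i)) (pos x) *ℤ (pos (η k) ^ℤ r *ℤ pos (ξ k) ^ℤ s)
        ≡⟨ cong₂ _*ℤ_ (newton-difference (a k) (a′ k) x) (trans (cong₂ _*ℤ_ (pos-^ (η k) r) (pos-^ (ξ k) s)) (sym (ℤ.pos-* (η k ^ r) (ξ k ^ s)))) ⟩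
      (pos (Σa a) -ℤ pos (Σa a′)) *ℤ pos (y k)
        ≡⟨ distribute (pos (Σa a)) (pos (Σa a′)) (pos (y k)) ⟩
      pos (Σa a) *ℤ pos (y k) -ℤ pos (Σa a′) *ℤ pos (y k)
        ≡⟨ cong₂ _-ℤ_ (trans (sym (ℤ.pos-* (Σa a) (y k))) (cong pos (inner k a))) (trans (sym (ℤ.pos-* (Σa a′) (y k))) (cong pos (inner k a′))) ⟩
      pos (sum (λ i → a k i * (falling x (toℕ i) * y k))) -ℤ pos (sum (λ i → a′ k i * (falling x (toℕ i) * y k))) ∎
      where
      Σa : (Fin J → Fin I → ℕ) → ℕ
      Σa a = sum (λ i → a k i * falling x (toℕ i))

-- Passing from θ to the rational numbers A/B and G/D

private
  transpose₂ : ∀ a b k e r → (a ^ k * b ^ e) ^ r ≡ (a ^ r) ^ k * (b ^ r) ^ e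
  transpose₂ a b k e r = trans (^-distribʳ-* (a ^ k) (b ^ e) r) (cong₂ _*_ (^-comm a k r) (^-comm b e r))

  ^-distribʳ-*₃ : ∀ a b c k → (a * b * c) ^ k ≡ a ^ k * b ^ k * c ^ k
  ^-distribʳ-*₃ a b c k = trans (^-distribʳ-* (a * b) c k) (cong (_* c ^ k) (^-distribʳ-* a b k))

  transpose₃ : ∀ A B G D m k e r s x →
    (A ^ k * B ^ e) ^ r * (G ^ k * D ^ e) ^ s * (m ^ (k + e)) ^ x ≡ (A ^ r * G ^ s * m ^ x) ^ k * (B ^ r * D ^ s * m ^ x) ^ e
  transpose₃ A B G D m k e r s x = begin
    (A ^ k * B ^ e) ^ r * (G ^ k * D ^ e) ^ s * (m ^ (k + e)) ^ x
      ≡⟨ cong₂ _*_ (cong₂ _*_ (transpose₂ A B k e r) (transpose₂ G D k e s)) (trans (cong (_^ x) (^-distribˡ-+-* m k e)) (transpose₂ m m k e x)) ⟩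
    (A ^ r) ^ k * (B ^ r) ^ e * ((G ^ s) ^ k * (D ^ s) ^ e) * ((m ^ x) ^ k * (m ^ x) ^ e)
      ≡⟨ regroup ((A ^ r) ^ k) ((B ^ r) ^ e) ((G ^ s) ^ k) ((D ^ s) ^ e) ((m ^ x) ^ k) ((m ^ x) ^ e) ⟩
    (A ^ r) ^ k * (G ^ s) ^ k * (m ^ x) ^ k * ((B ^ r) ^ e * (D ^ s) ^ e * (m ^ x) ^ e)
      ≡⟨ cong₂ _*_ (^-distribʳ-*₃ (A ^ r) (G ^ s) (m ^ x) k) (^-distribʳ-*₃ (B ^ r) (D ^ s) (m ^ x) e) ⟨
    (A ^ r * G ^ s * m ^ x) ^ k * (B ^ r * D ^ s * m ^ x) ^ e ∎
    where
    open ≡-Reasoning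
    regroup : ∀ a b c d e f → a * b * (c * d) * (e * f) ≡ a * c * e * (b * d * f)
    regroup = solve-∀

  split-power : ∀ y t m k e x → y ^ (k + e) * (t ^ k * m ^ e) ^ x ≡ (y * t ^ x) ^ k * (y * m ^ x) ^ e
  split-power y t m k e x = begin
    y ^ (k + e) * (t ^ k * m ^ e) ^ x
      ≡⟨ cong₂ _*_ (^-distribˡ-+-* y k e) (transpose₂ t m k e x) ⟩
    y ^ k * y ^ e * ((t ^ x) ^ k * (m ^ x) ^ e)
      ≡⟨ interchange (y ^ k) (y ^ e) ((t ^ x) ^ k) ((m ^ x) ^ e) ⟩
    y ^ k * (t ^ x) ^ k * (y ^ e * (m ^ x) ^ e)
      ≡⟨ cong₂ _*_ (^-distribʳ-* y (t ^ x) k) (^-distribʳ-* y (m ^ x) e) ⟨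
    (y * t ^ x) ^ k * (y * m ^ x) ^ e ∎
    where
    open ≡-Reasoning

  power-linear : ∀ a r L s K → a ^ (r * L + s * K) ≡ (a ^ L) ^ r * (a ^ K) ^ s
  power-linear a r L s K = trans (^-distribˡ-+-* a (r * L) (s * K))
    (cong₂ _*_ (trans (cong (a ^_) (*-comm r L)) (sym (^-*-assoc a L r))) (trans (cong (a ^_) (*-comm s K)) (sym (^-*-assoc a K s))))

  factor-powers : ∀ A G m r L s K → (A * m ^ L) ^ r * (G * m ^ K) ^ s ≡ A ^ r * G ^ s * m ^ (r * L + s * K)
  factor-powers A G m r L s K = begin
    (A * m ^ L) ^ r * (G * m ^ K) ^ s                      ≡⟨ cong₂ _*_ (^-distribʳ-* A (m ^ L) r) (^-distribʳ-* G (m ^ K) s) ⟩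
    A ^ r * (m ^ L) ^ r * (G ^ s * (m ^ K) ^ s)            ≡⟨ interchange (A ^ r) ((m ^ L) ^ r) (G ^ s) ((m ^ K) ^ s) ⟩
    A ^ r * G ^ s * ((m ^ L) ^ r * (m ^ K) ^ s)            ≡⟨ cong (A ^ r * G ^ s *_) (sym (power-linear m r L s K)) ⟩
    A ^ r * G ^ s * m ^ (r * L + s * K)                    ∎
    where
    open ≡-Reasoning

  pull-factor : ∀ y a f τ → y * (a * (f * τ)) ≡ a * f * (y * τ)
  pull-factor = solve-∀
  pull-Z : ∀ z a f δ → z * (a * f * δ) ≡ a * f * (z * δ)
  pull-Z = solve-∀
  regroup-ΦM : ∀ a f z m → a * (f * z) * m ≡ a * f * (z * m)
  regroup-ΦM = solve-∀
  two-copies : ∀ Z y → Z * y + Z * y ≡ Z * (2 * y)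
  two-copies = solve-∀
  pull-2E : ∀ e a f v → a * f * (2 * e * v) ≡ 2 * e * (a * f * v)
  pull-2E = solve-∀

Near₁⇒≤2* : ∀ {Z a b} → 0 < Z → Near Z 1 a b → b ≤ 2 * a
Near₁⇒≤2* {Z} {a} {b} 0<Z (near _ q) = *-cancelˡ-≤ Z {{>-nonZero 0<Z}} (begin
  Z * b              ≡⟨ cong (_* b) (*-identityʳ Z) ⟨
  Z ^ 1 * b          ≤⟨ q ⟩
  suc Z ^ 1 * a      ≡⟨ cong (_* a) (*-identityʳ (suc Z)) ⟩
  a + Z * a          ≤⟨ +-monoˡ-≤ (Z * a) (m≤n*m a Z {{>-nonZero 0<Z}}) ⟩
  Z * a + Z * a      ≡⟨ two-copies Z a ⟩
  Z * (2 * a)        ∎)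
  where open ≤-Reasoning

-- Here α = A/B, γ = G/D and θ = t/M₀, with θᴸ ≈ α and θᴷ ≈ γ up to 1 + 1/Z. `J` counts the
-- exponents k and `I` the falling powers of x. The points rL + sK have r < S + J and s < S; the `J`
-- additional values of r leave room for the shifts in the zero estimate.
module Interpolation
  (A B G D h : ℕ) (0<B : 0 < B) (B<A : B < A) (0<D : 0 < D) (0<G : 0 < G)
  (A≤ : A ≤ 2 ^ h) (B≤ : B ≤ 2 ^ h) (G≤ : G ≤ 2 ^ h) (D≤ : D ≤ 2 ^ h)
  (independent : ∀ r s → 0 < r → 0 < s → A ^ r * D ^ s ≢ B ^ r * G ^ s)
  (L K S J I T P H Z t M₀ : ℕ) (0<L : 0 < L) (0<K : 0 < K) (0<S : 0 < S) (0<P : 0 < P)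
  (0<M₀ : 0 < M₀) (M₀≤t : M₀ ≤ t)
  (near₁ : Near Z 1 (A * M₀ ^ L) (B * t ^ L)) (near₂ : Near Z 1 (G * M₀ ^ K) (D * t ^ K)) where

  w xm E β Ymax Φmax : ℕ
  w = S + J + S
  xm = (S + J) * L + S * K
  E = J * w
  β = 2 ^ (suc h * w * J)
  Ymax = 2 ^ (h * w * J)
  Φmax = J * (I * (H * (xm ^ I * Ymax)))

  module _
    (few-boxes : suc (P * (J * (I * (H * (xm ^ I * β))))) ^ T < (H ^ I) ^ J)
    (small-tail : P * (J * (I * (H * (2 ^ I * (xm ^ I * (β * β)))))) ≤ 2 ^ T)
    (P-large : 2 * suc T * Ymax ≤ P)
    (Z-large : 8 * E * Φmax < Z) (2E≤Z : 2 * E ≤ Z) (2w≤Z : 2 * w ≤ Z) (Z-separates : 2 * w * 2 ^ (h * w) < Z)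
    (JI≤SS : J * I ≤ S * S) where

    0<Z : 0 < Z
    0<Z = ≤-<-trans z≤n Z-large

    0<A : 0 < A
    0<A = <-trans 0<B B<A

    M : ℕ
    M = M₀ ^ J

    0<M : 0 < M
    0<M = 0<^ J 0<M₀

    -- θᵏ, αᵏ, γᵏ multiplied by M₀ᴶ, Bᴶ, Dᴶ, so that the denominators are the same for all k.
    τ η ξ : Fin J → ℕ
    τ k = t ^ toℕ k * M₀ ^ (J ∸ toℕ k)
    η k = A ^ toℕ k * B ^ (J ∸ toℕ k)
    ξ k = G ^ toℕ k * D ^ (J ∸ toℕ k)

    k+e : ∀ (k : Fin J) → toℕ k + (J ∸ toℕ k) ≡ J
    k+e k = m+[n∸m]≡n (<⇒≤ (toℕ<n k))

    M≤τ : ∀ k → M ≤ τ k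
    M≤τ k = begin
      M₀ ^ J                                 ≡⟨ cong (M₀ ^_) (k+e k) ⟨
      M₀ ^ (toℕ k + (J ∸ toℕ k))             ≡⟨ ^-distribˡ-+-* M₀ (toℕ k) (J ∸ toℕ k) ⟩
      M₀ ^ toℕ k * M₀ ^ (J ∸ toℕ k)          ≤⟨ *-monoˡ-≤ _ (^-monoˡ-≤ (toℕ k) M₀≤t) ⟩
      τ k                                    ∎
      where open ≤-Reasoning

    τ≤t^J : ∀ k → τ k ≤ t ^ J
    τ≤t^J k = begin
      t ^ toℕ k * M₀ ^ (J ∸ toℕ k)           ≤⟨ *-monoʳ-≤ (t ^ toℕ k) (^-monoˡ-≤ (J ∸ toℕ k) M₀≤t) ⟩
      t ^ toℕ k * t ^ (J ∸ toℕ k)            ≡⟨ ^-distribˡ-+-* t (toℕ k) (J ∸ toℕ k) ⟨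
      t ^ (toℕ k + (J ∸ toℕ k))              ≡⟨ cong (t ^_) (k+e k) ⟩
      t ^ J                                  ∎
      where open ≤-Reasoning

    -- θᴸ and θᴷ are bounded independently of L and K because they approximate α and γ. Hence θ^`xm`
    -- is controlled by `w`, not by the size of `xm`.
    growth : ∀ e {a b} → 0 < b → a ≤ 2 ^ h → Near Z 1 (a * M₀ ^ e) (b * t ^ e) → t ^ e ≤ 2 ^ suc h * M₀ ^ e
    growth e {a} {b} 0<b a≤ nr = begin
      t ^ e                    ≤⟨ m≤n*m (t ^ e) b {{>-nonZero 0<b}} ⟩
      b * t ^ e                ≤⟨ Near₁⇒≤2* 0<Z nr ⟩
      2 * (a * M₀ ^ e)         ≤⟨ *-monoʳ-≤ 2 (*-monoˡ-≤ (M₀ ^ e) a≤) ⟩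
      2 * (2 ^ h * M₀ ^ e)     ≡⟨ *-assoc 2 (2 ^ h) (M₀ ^ e) ⟨
      2 ^ suc h * M₀ ^ e       ∎
      where open ≤-Reasoning

    t^xm≤ : t ^ xm ≤ 2 ^ (suc h * w) * M₀ ^ xm
    t^xm≤ = begin
      t ^ xm
        ≡⟨ power-linear t (S + J) L S K ⟩
      (t ^ L) ^ (S + J) * (t ^ K) ^ S
        ≤⟨ *-mono-≤ (^-monoˡ-≤ (S + J) (growth L 0<B A≤ near₁)) (^-monoˡ-≤ S (growth K 0<D G≤ near₂)) ⟩
      (2 ^ suc h * M₀ ^ L) ^ (S + J) * (2 ^ suc h * M₀ ^ K) ^ S
        ≡⟨ factor-powers (2 ^ suc h) (2 ^ suc h) M₀ (S + J) L S K ⟩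
      (2 ^ suc h) ^ (S + J) * (2 ^ suc h) ^ S * M₀ ^ xm
        ≡⟨ cong (_* M₀ ^ xm) (trans (sym (^-distribˡ-+-* (2 ^ suc h) (S + J) S)) (^-*-assoc 2 (suc h) w)) ⟩
      2 ^ (suc h * w) * M₀ ^ xm ∎
      where open ≤-Reasoning

    τ^xm≤ : ∀ k → τ k ^ xm ≤ β * M ^ xm
    τ^xm≤ k = begin
      τ k ^ xm                                   ≤⟨ ^-monoˡ-≤ xm (τ≤t^J k) ⟩
      (t ^ J) ^ xm                               ≡⟨ ^-comm t J xm ⟩
      (t ^ xm) ^ J                               ≤⟨ ^-monoˡ-≤ J t^xm≤ ⟩
      (2 ^ (suc h * w) * M₀ ^ xm) ^ J            ≡⟨ ^-distribʳ-* (2 ^ (suc h * w)) (M₀ ^ xm) J ⟩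
      (2 ^ (suc h * w)) ^ J * (M₀ ^ xm) ^ J      ≡⟨ cong₂ _*_ (^-*-assoc 2 (suc h * w) J) (^-comm M₀ xm J) ⟩
      β * M ^ xm                                 ∎
      where open ≤-Reasoning

    1≤xm : 1 ≤ xm
    1≤xm = ≤-trans (*-mono-≤ 0<S 0<K) (m≤n+m (S * K) ((S + J) * L))

    open AuxiliaryFunction I J T xm M β P H {{>-nonZero 0<M}} τ 1≤xm M≤τ τ^xm≤ few-boxes small-tail

    Φ : Coefficients → ℕ → ℕ → ℕ
    Φ a r s = ∑∑ (λ k i → a k i * (falling (r * L + s * K) (toℕ i) * (η k ^ r * ξ k ^ s)))

    product≤ : ∀ {a b} (k : Fin J) → a ≤ 2 ^ h → b ≤ 2 ^ h → a ^ toℕ k * b ^ (J ∸ toℕ k) ≤ 2 ^ (h * J)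
    product≤ {a} {b} k a≤ b≤ = begin
      a ^ toℕ k * b ^ (J ∸ toℕ k)                     ≤⟨ *-mono-≤ (^-monoˡ-≤ (toℕ k) a≤) (^-monoˡ-≤ (J ∸ toℕ k) b≤) ⟩
      (2 ^ h) ^ toℕ k * (2 ^ h) ^ (J ∸ toℕ k)         ≡⟨ ^-distribˡ-+-* (2 ^ h) (toℕ k) (J ∸ toℕ k) ⟨
      (2 ^ h) ^ (toℕ k + (J ∸ toℕ k))                 ≡⟨ trans (cong ((2 ^ h) ^_) (k+e k)) (^-*-assoc 2 h J) ⟩
      2 ^ (h * J)                                     ∎
      where open ≤-Reasoning

    two-powers≤ : ∀ c {a b} r s → r + s ≤ w → a ≤ 2 ^ c → b ≤ 2 ^ c → a ^ r * b ^ s ≤ 2 ^ (c * w)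
    two-powers≤ c {a} {b} r s r+s≤w a≤ b≤ = begin
      a ^ r * b ^ s                 ≤⟨ *-mono-≤ (^-monoˡ-≤ r a≤) (^-monoˡ-≤ s b≤) ⟩
      (2 ^ c) ^ r * (2 ^ c) ^ s     ≡⟨ ^-distribˡ-+-* (2 ^ c) r s ⟨
      (2 ^ c) ^ (r + s)             ≡⟨ ^-*-assoc 2 c (r + s) ⟩
      2 ^ (c * (r + s))             ≤⟨ ^-monoʳ-≤ 2 (*-monoʳ-≤ c r+s≤w) ⟩
      2 ^ (c * w)                   ∎
      where open ≤-Reasoning

    hJw : h * J * w ≡ h * w * J
    hJw = trans (*-assoc h J w) (trans (cong (h *_) (*-comm J w)) (sym (*-assoc h w J)))

    module _ (r s : ℕ) (r≤ : r ≤ S + J) (s≤ : s ≤ S) where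
      r+s≤w : r + s ≤ w
      r+s≤w = +-mono-≤ r≤ s≤

      x y : ℕ
      x = r * L + s * K
      y = B ^ r * D ^ s

      x≤xm : x ≤ xm
      x≤xm = +-mono-≤ (*-monoˡ-≤ L r≤) (*-monoˡ-≤ K s≤)

      y^J≤Ymax : y ^ J ≤ Ymax
      y^J≤Ymax = ≤-trans (^-monoˡ-≤ J (two-powers≤ h r s r+s≤w B≤ D≤)) (≤-reflexive (^-*-assoc 2 (h * w) J))

      -- Only the k factors that come from α and γ are inexact; the remaining J - k are
      -- denominators, equal on both sides.
      term-near : ∀ k → Near Z E (η k ^ r * ξ k ^ s * M ^ x) (y ^ J * τ k ^ x)
      term-near k = subst₂ (Near Z E) (sym left) (sym right)
        (Near-weaken {E = toℕ k * (r * 1 + s * 1) + 0} E′≤E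
          (Near-* (Near-^ (toℕ k) (Near-* (Near-^ r near₁) (Near-^ s near₂))) (Near-refl ((y * M₀ ^ x) ^ (J ∸ toℕ k)))))
        where
        E′≤E : toℕ k * (r * 1 + s * 1) + 0 ≤ E
        E′≤E = begin
          toℕ k * (r * 1 + s * 1) + 0   ≡⟨ trans (+-identityʳ _) (cong (toℕ k *_) (cong₂ _+_ (*-identityʳ r) (*-identityʳ s))) ⟩
          toℕ k * (r + s)               ≤⟨ *-mono-≤ (<⇒≤ (toℕ<n k)) r+s≤w ⟩
          E                             ∎
          where open ≤-Reasoning
        left : η k ^ r * ξ k ^ s * M ^ x ≡ ((A * M₀ ^ L) ^ r * (G * M₀ ^ K) ^ s) ^ toℕ k * (y * M₀ ^ x) ^ (J ∸ toℕ k)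
        left = begin
          η k ^ r * ξ k ^ s * M ^ x
            ≡⟨ cong (λ j → η k ^ r * ξ k ^ s * (M₀ ^ j) ^ x) (sym (k+e k)) ⟩
          η k ^ r * ξ k ^ s * (M₀ ^ (toℕ k + (J ∸ toℕ k))) ^ x
            ≡⟨ transpose₃ A B G D M₀ (toℕ k) (J ∸ toℕ k) r s x ⟩
          (A ^ r * G ^ s * M₀ ^ x) ^ toℕ k * (y * M₀ ^ x) ^ (J ∸ toℕ k)
            ≡⟨ cong (λ p → p ^ toℕ k * (y * M₀ ^ x) ^ (J ∸ toℕ k)) (sym (factor-powers A G M₀ r L s K)) ⟩
          ((A * M₀ ^ L) ^ r * (G * M₀ ^ K) ^ s) ^ toℕ k * (y * M₀ ^ x) ^ (J ∸ toℕ k) ∎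
          where open ≡-Reasoning
        right : y ^ J * τ k ^ x ≡ ((B * t ^ L) ^ r * (D * t ^ K) ^ s) ^ toℕ k * (y * M₀ ^ x) ^ (J ∸ toℕ k)
        right = begin
          y ^ J * τ k ^ x
            ≡⟨ cong (λ j → y ^ j * τ k ^ x) (sym (k+e k)) ⟩
          y ^ (toℕ k + (J ∸ toℕ k)) * τ k ^ x
            ≡⟨ split-power y t M₀ (toℕ k) (J ∸ toℕ k) x ⟩
          (y * t ^ x) ^ toℕ k * (y * M₀ ^ x) ^ (J ∸ toℕ k)
            ≡⟨ cong (λ p → p ^ toℕ k * (y * M₀ ^ x) ^ (J ∸ toℕ k)) (sym (factor-powers B D t r L s K)) ⟩
          ((B * t ^ L) ^ r * (D * t ^ K) ^ s) ^ toℕ k * (y * M₀ ^ x) ^ (J ∸ toℕ k) ∎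
          where open ≡-Reasoning

      Φ-close-F : ∀ a → Z * ∣ Φ a r s * M ^ x - y ^ J * F a x ∣ ≤ 2 * E * (Φ a r s * M ^ x)
      Φ-close-F a = begin
        Z * ∣ Φ a r s * M ^ x - y ^ J * F a x ∣
          ≡⟨ cong (Z *_) (cong₂ ∣_-_∣ ΦM≡ yF≡) ⟩
        Z * ∣ ∑∑ (λ k i → a k i * f i * u k) - ∑∑ (λ k i → a k i * f i * v k) ∣
          ≤⟨ *-monoʳ-≤ Z (∣-∣-∑∑ (λ k i → a k i * f i * u k) (λ k i → a k i * f i * v k)) ⟩
        Z * ∑∑ (λ k i → ∣ a k i * f i * u k - a k i * f i * v k ∣)
          ≡⟨ *-distribˡ-∑∑ Z (λ k i → ∣ a k i * f i * u k - a k i * f i * v k ∣) ⟩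
        ∑∑ (λ k i → Z * ∣ a k i * f i * u k - a k i * f i * v k ∣)
          ≤⟨ ∑∑-mono (λ k i → term k i) ⟩
        ∑∑ (λ k i → 2 * E * (a k i * f i * u k))
          ≡⟨ *-distribˡ-∑∑ (2 * E) (λ k i → a k i * f i * u k) ⟨
        2 * E * ∑∑ (λ k i → a k i * f i * u k)
          ≡⟨ cong (2 * E *_) ΦM≡ ⟨
        2 * E * (Φ a r s * M ^ x) ∎
        where
        open ≤-Reasoning
        f : Fin I → ℕ
        f i = falling x (toℕ i)
        u v : Fin J → ℕ
        u k = η k ^ r * ξ k ^ s * M ^ x
        v k = y ^ J * τ k ^ x
        ΦM≡ : Φ a r s * M ^ x ≡ ∑∑ (λ k i → a k i * f i * u k)
        ΦM≡ = trans (*-comm (Φ a r s) (M ^ x)) (trans (*-distribˡ-∑∑ (M ^ x) (λ k i → a k i * (f i * (η k ^ r * ξ k ^ s))))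
          (∑∑-cong (λ k i → trans (*-comm (M ^ x) _) (regroup-ΦM (a k i) (f i) (η k ^ r * ξ k ^ s) (M ^ x)))))
        yF≡ : y ^ J * F a x ≡ ∑∑ (λ k i → a k i * f i * v k)
        yF≡ = trans (*-distribˡ-∑∑ (y ^ J) (λ k i → a k i * (f i * τ k ^ x))) (∑∑-cong (λ k i → pull-factor (y ^ J) (a k i) (f i) (τ k ^ x)))
        term : ∀ k i → Z * ∣ a k i * f i * u k - a k i * f i * v k ∣ ≤ 2 * E * (a k i * f i * u k)
        term k i = begin
          Z * ∣ a k i * f i * u k - a k i * f i * v k ∣   ≡⟨ cong (Z *_) (sym (*-distribˡ-∣-∣ (a k i * f i) (u k) (v k))) ⟩
          Z * (a k i * f i * ∣ u k - v k ∣)               ≡⟨ pull-Z Z (a k i) (f i) ∣ u k - v k ∣ ⟩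
          a k i * f i * (Z * ∣ u k - v k ∣)               ≤⟨ *-monoʳ-≤ (a k i * f i) (Near⇒close 0<Z 2E≤Z (term-near k)) ⟩
          a k i * f i * (2 * E * u k)                     ≡⟨ pull-2E E (a k i) (f i) (u k) ⟩
          2 * E * (a k i * f i * u k)                     ∎

      Φ≤Φmax : ∀ a → Bounded a → Φ a r s ≤ Φmax
      Φ≤Φmax a a≤H = ∑∑-bounded (λ k i → *-mono-≤ (a≤H k i) (*-mono-≤ (falling≤ x x≤xm i)
        (≤-trans (two-powers≤ (h * J) r s r+s≤w (product≤ k A≤ B≤) (product≤ k G≤ D≤)) (≤-reflexive (cong (2 ^_) hJw)))))

      -- `Φ a r s` is the value at rL + sK after replacing θᴸ and θᴷ by α and γ and clearing the
      -- denominator yᴶ. It is an integer, so closeness becomes equality.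
      Φ-equal : ∀ a a′ → Bounded a → Bounded a′ → P * ∣ F a x - F a′ x ∣ ≤ suc T * M ^ x → Φ a r s ≡ Φ a′ r s
      Φ-equal a a′ a≤H a′≤H close = separated P Z E (M ^ x) (suc T) (y ^ J)
        (Φ-close-F a) (Φ-close-F a′) close (≤-trans (*-monoʳ-≤ (2 * suc T) y^J≤Ymax) P-large)
        (Φ≤Φmax a a≤H) (Φ≤Φmax a′ a′≤H) Z-large 0<P (0<^ x 0<M)

    η-< : ∀ i k → toℕ i < toℕ k → η i < η k
    η-< i k i<k = begin-strict
      A ^ toℕ i * B ^ (J ∸ toℕ i)
        ≡⟨ cong (λ e → A ^ toℕ i * B ^ e) gap ⟩
      A ^ toℕ i * B ^ (δ + (J ∸ toℕ k))
        ≡⟨ cong (A ^ toℕ i *_) (^-distribˡ-+-* B δ (J ∸ toℕ k)) ⟩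
      A ^ toℕ i * (B ^ δ * B ^ (J ∸ toℕ k))
        <⟨ *-monoʳ-< (A ^ toℕ i) {{>-nonZero (0<^ (toℕ i) 0<A)}} (*-monoˡ-< (B ^ (J ∸ toℕ k)) {{>-nonZero (0<^ (J ∸ toℕ k) 0<B)}} (^-monoˡ-< δ {{>-nonZero (m<n⇒0<n∸m i<k)}} B<A)) ⟩
      A ^ toℕ i * (A ^ δ * B ^ (J ∸ toℕ k))
        ≡⟨ *-assoc (A ^ toℕ i) (A ^ δ) (B ^ (J ∸ toℕ k)) ⟨
      A ^ toℕ i * A ^ δ * B ^ (J ∸ toℕ k)
        ≡⟨ cong (_* B ^ (J ∸ toℕ k)) (trans (sym (^-distribˡ-+-* A (toℕ i) δ)) (cong (A ^_) (m+[n∸m]≡n (<⇒≤ i<k)))) ⟩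
      A ^ toℕ k * B ^ (J ∸ toℕ k) ∎
      where
      open ≤-Reasoning
      δ = toℕ k ∸ toℕ i
      gap : J ∸ toℕ i ≡ δ + (J ∸ toℕ k)
      gap = trans (cong (_∸ toℕ i) (sym (k+e k))) (trans (+-∸-comm (J ∸ toℕ k) (<⇒≤ i<k)) refl)

    η-injective : ∀ {i k} → η i ≡ η k → i ≡ k
    η-injective {i} {k} eq with <-cmp (toℕ i) (toℕ k)
    ... | tri< i<k _ _ = contradiction eq (<⇒≢ (η-< i k i<k))
    ... | tri≈ _ i≡k _ = Fin.toℕ-injective i≡k
    ... | tri> _ _ k<i = contradiction (sym eq) (<⇒≢ (η-< k i k<i))

    -- rL = sK would give αʳ ≈ θ^(rL) = θ^(sK) ≈ γˢ. Fractions of such small height are that close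
    -- only when equal, which independence excludes.
    no-coincidence : ∀ r s → 0 < r → r ≤ S → s ≤ S → r * L ≢ s * K
    no-coincidence r zero 0<r _ _ rL≡sK = contradiction rL≡sK (>⇒≢ (*-mono-≤ 0<r 0<L))
    no-coincidence r s@(suc _) 0<r r≤S s≤S rL≡sK = independent r s 0<r (s≤s z≤n)
      (Near⇒≡ {E = w} 0<Z 2w≤Z
        (≤-<-trans (*-monoʳ-≤ (2 * w) (two-powers≤ h r s exponents≤w A≤ D≤)) Z-separates)
        (Near-weaken {E = r * 1 + s * 1} (≤-trans (≤-reflexive (cong₂ _+_ (*-identityʳ r) (*-identityʳ s))) exponents≤w) cancelled))
      where
      exponents≤w : r + s ≤ w
      exponents≤w = +-mono-≤ (≤-trans r≤S (m≤m+n S J)) s≤S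
      q : ℕ
      q = (M₀ ^ L) ^ r * (t ^ K) ^ s
      0<t : 0 < t
      0<t = <-≤-trans 0<M₀ M₀≤t
      0<q : 0 < q
      0<q = *-mono-≤ (0<^ r (0<^ L 0<M₀)) (0<^ s (0<^ K 0<t))
      swapped : Near Z (r * 1 + s * 1) ((A * M₀ ^ L) ^ r * (D * t ^ K) ^ s) ((B * t ^ L) ^ r * (G * M₀ ^ K) ^ s)
      swapped = Near-* (Near-^ r near₁) (Near-^ s (Near-sym near₂))
      regroup : ∀ a b c d → a * b * (c * d) ≡ b * d * (a * c)
      regroup = solve-∀
      left : (A * M₀ ^ L) ^ r * (D * t ^ K) ^ s ≡ q * (A ^ r * D ^ s)
      left = trans (cong₂ _*_ (^-distribʳ-* A (M₀ ^ L) r) (^-distribʳ-* D (t ^ K) s)) (regroup (A ^ r) ((M₀ ^ L) ^ r) (D ^ s) ((t ^ K) ^ s))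
      exchange : ∀ a → (a ^ L) ^ r ≡ (a ^ K) ^ s
      exchange a = trans (^-*-assoc a L r) (trans (cong (a ^_) (trans (*-comm L r) (trans rL≡sK (*-comm s K)))) (sym (^-*-assoc a K s)))
      right : (B * t ^ L) ^ r * (G * M₀ ^ K) ^ s ≡ q * (B ^ r * G ^ s)
      right = begin
        (B * t ^ L) ^ r * (G * M₀ ^ K) ^ s                   ≡⟨ cong₂ _*_ (^-distribʳ-* B (t ^ L) r) (^-distribʳ-* G (M₀ ^ K) s) ⟩
        B ^ r * (t ^ L) ^ r * (G ^ s * (M₀ ^ K) ^ s)         ≡⟨ regroup (B ^ r) ((t ^ L) ^ r) (G ^ s) ((M₀ ^ K) ^ s) ⟩
        (t ^ L) ^ r * (M₀ ^ K) ^ s * (B ^ r * G ^ s)         ≡⟨ cong (_* (B ^ r * G ^ s)) (trans (cong₂ _*_ (exchange t) (sym (exchange M₀))) (*-comm ((t ^ K) ^ s) ((M₀ ^ L) ^ r))) ⟩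
        q * (B ^ r * G ^ s)                                  ∎
        where open ≡-Reasoning
      cancel : ∀ {e u v} → Near Z e (q * u) (q * v) → Near Z e u v
      cancel {e} {u} {v} (near a b) = near (one a) (one b)
        where
        one : ∀ {u v} → Z ^ e * (q * u) ≤ suc Z ^ e * (q * v) → Z ^ e * u ≤ suc Z ^ e * v
        one {u} {v} p = *-cancelˡ-≤ q {{>-nonZero 0<q}} (subst₂ _≤_ (x∙yz≈y∙xz (Z ^ e) q u) (x∙yz≈y∙xz (suc Z ^ e) q v) p)
      cancelled : Near Z (r * 1 + s * 1) (A ^ r * D ^ s) (B ^ r * G ^ s)
      cancelled = cancel {r * 1 + s * 1} (subst₂ (Near Z (r * 1 + s * 1)) left right swapped)

    distinct-< : ∀ r s r′ s′ → r < S → s′ < S → r′ < r → r * L + s * K ≢ r′ * L + s′ * K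
    distinct-< r s r′ s′ r<S s′<S r′<r eq = no-coincidence (r ∸ r′) (s′ ∸ s) (m<n⇒0<n∸m r′<r)
      (≤-trans (m∸n≤m r r′) (<⇒≤ r<S)) (≤-trans (m∸n≤m s′ s) (<⇒≤ s′<S))
      (trans (*-distribʳ-∸ L r r′) (trans difference (sym (*-distribʳ-∸ K s′ s))))
      where
      difference : r * L ∸ r′ * L ≡ s′ * K ∸ s * K
      difference = begin
        r * L ∸ r′ * L                        ≡⟨ [m+n]∸[m+o]≡n∸o (s * K) (r * L) (r′ * L) ⟨
        s * K + r * L ∸ (s * K + r′ * L)      ≡⟨ cong₂ _∸_ (trans (+-comm (s * K) (r * L)) eq) (+-comm (s * K) (r′ * L)) ⟩
        r′ * L + s′ * K ∸ (r′ * L + s * K)    ≡⟨ [m+n]∸[m+o]≡n∸o (r′ * L) (s′ * K) (s * K) ⟩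
        s′ * K ∸ s * K                        ∎
        where open ≡-Reasoning

    distinct : ∀ r s r′ s′ → r < S → s < S → r′ < S → s′ < S → r * L + s * K ≡ r′ * L + s′ * K → r ≡ r′ × s ≡ s′
    distinct r s r′ s′ r<S s<S r′<S s′<S eq with <-cmp r r′
    ... | tri< r<r′ _ _ = contradiction (sym eq) (distinct-< r′ s′ r s r′<S s<S r<r′)
    ... | tri> _ _ r′<r = contradiction eq (distinct-< r s r′ s′ r<S s′<S r′<r)
    ... | tri≈ _ refl _ = refl , *-cancelʳ-≡ s s′ K {{>-nonZero 0<K}} (+-cancelˡ-≡ (r * L) _ _ eq)

    contradictory : ⊥
    contradictory = from close-pair
      where
      from : (∃₂ λ a a′ → Bounded a × Bounded a′ × ¬ (∀ k i → a k i ≡ a′ k i) ×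
               (∀ x → x ≤ xm → P * ∣ F a x - F a′ x ∣ ≤ suc T * M ^ x)) → ⊥
      from (a , a′ , a≤H , a′≤H , a≢a′ , close) = a≢a′ (zero-estimate-ℕ J I S L K η ξ η-injective
        (λ k → *-mono-≤ (0<^ (toℕ k) 0<A) (0<^ (J ∸ toℕ k) 0<B))
        (λ k → *-mono-≤ (0<^ (toℕ k) 0<G) (0<^ (J ∸ toℕ k) 0<D)) JI≤SS distinct a a′
        (λ r s r<S+J s<S → Φ-equal r s (<⇒≤ r<S+J) (<⇒≤ s<S) a a′ a≤H a′≤H
          (close (r * L + s * K) (x≤xm r s (<⇒≤ r<S+J) (<⇒≤ s<S)))))

-- Linear forms in two logarithms

^-cancelˡ-≤ : ∀ {a b} n → 0 < n → a ^ n ≤ b ^ n → a ≤ b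
^-cancelˡ-≤ {a} {b} n 0<n a^n≤b^n with a ≤? b
... | yes a≤b = a≤b
... | no a≰b = contradiction a^n≤b^n (<⇒≱ (^-monoˡ-< n {{>-nonZero 0<n}} (≰⇒> a≰b)))

2^-cancel-≤ : ∀ {m n} → 2 ^ m ≤ 2 ^ n → m ≤ n
2^-cancel-≤ {m} {n} p with m ≤? n
... | yes m≤n = m≤n
... | no m≰n = contradiction p (<⇒≱ (^-monoʳ-< 2 (s≤s (s≤s z≤n)) (≰⇒> m≰n)))

crossing : (P : ℕ → Set) → (∀ n → Dec (P n)) → ∀ m n → P m → ¬ P (m + n) → ∃ λ t → m ≤ t × P t × ¬ P (suc t)
crossing P P? m zero Pm ¬Pm = contradiction (subst P (sym (+-identityʳ m)) Pm) ¬Pm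
crossing P P? m (suc n) Pm ¬Pn with P? (suc m)
... | no ¬Psm = m , ≤-refl , Pm , ¬Psm
... | yes Psm with crossing P P? (suc m) n Psm (subst (¬_ ∘ P) (+-suc m n) ¬Pn)
... | t , m<t , Pt , ¬Pst = t , <⇒≤ m<t , Pt , ¬Pst

-- `t` is the integer part of M(A/B)^(1/L), found by a search in ℕ.
root : ∀ A B L M → 0 < B → B < A → 0 < L → 0 < M →
  ∃ λ t → M ≤ t × B * t ^ L ≤ A * M ^ L × A * M ^ L < B * suc t ^ L
root A B L M 0<B B<A 0<L 0<M with crossing (λ t → B * t ^ L ≤ A * M ^ L) (λ t → B * t ^ L ≤? A * M ^ L) M (suc (A * M))
    (*-monoˡ-≤ (M ^ L) (<⇒≤ B<A)) (<⇒≱ large)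
  where
  large : A * M ^ L < B * (M + suc (A * M)) ^ L
  large = begin-strict
    A * M ^ L                     ≤⟨ *-monoˡ-≤ (M ^ L) (≤-trans (≤-reflexive (sym (^-identityʳ A))) (^-monoʳ-≤ A {{>-nonZero (<-trans 0<B B<A)}} 0<L)) ⟩
    A ^ L * M ^ L                 ≡⟨ ^-distribʳ-* A M L ⟨
    (A * M) ^ L                   <⟨ ^-monoˡ-< L {{>-nonZero 0<L}} (m≤n+m (suc (A * M)) M) ⟩
    (M + suc (A * M)) ^ L         ≤⟨ m≤n*m _ B {{>-nonZero 0<B}} ⟩
    B * (M + suc (A * M)) ^ L     ∎
    where open ≤-Reasoning
... | t , M≤t , below , ¬above = t , M≤t , below , ≰⇒> ¬above

-- (1 + 1/t)ⁿ ≤ 1 + 1/Z once t ≥ 2nZ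
power-slack : ∀ t n Z → 0 < t → 0 < Z → 2 * n * Z ≤ t → Z * suc t ^ n ≤ suc Z * t ^ n
power-slack t n Z 0<t 0<Z 2nZ≤t = *-cancelʳ-≤ _ _ t {{>-nonZero 0<t}} (begin
  Z * suc t ^ n * t               ≡⟨ *-assoc Z (suc t ^ n) t ⟩
  Z * (suc t ^ n * t)             ≤⟨ *-monoʳ-≤ Z (bernoulli-upper t n (≤-trans (m≤m*n (2 * n) Z {{>-nonZero 0<Z}}) 2nZ≤t)) ⟩
  Z * (t ^ n * (t + 2 * n))       ≡⟨ regroup Z (t ^ n) t n ⟩
  t ^ n * (Z * t + 2 * n * Z)     ≤⟨ *-monoʳ-≤ (t ^ n) (+-monoʳ-≤ (Z * t) 2nZ≤t) ⟩
  t ^ n * (Z * t + t)             ≡⟨ collect (t ^ n) Z t ⟩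
  suc Z * t ^ n * t               ∎)
  where
  open ≤-Reasoning
  regroup : ∀ Z e t n → Z * (e * (t + 2 * n)) ≡ e * (Z * t + 2 * n * Z)
  regroup = solve-∀
  collect : ∀ e Z t → e * (Z * t + t) ≡ suc Z * e * t
  collect = solve-∀

ratio-slack : ∀ X Z → 2 * Z ≤ X → Z * (X + 2) ≤ suc Z * X
ratio-slack X Z 2Z≤X = begin
  Z * (X + 2)     ≡⟨ expand Z X ⟩
  Z * X + 2 * Z   ≤⟨ +-monoʳ-≤ (Z * X) 2Z≤X ⟩
  Z * X + X       ≡⟨ +-comm (Z * X) X ⟩
  suc Z * X       ∎
  where
  open ≤-Reasoning
  expand : ∀ Z X → Z * (X + 2) ≡ Z * X + 2 * Z
  expand = solve-∀

-- αᴷ and γᴸ agree up to (1 + 2/X)ᴸ. Taking L-th roots removes the exponent, so θ = α^(1/L)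
-- satisfies θᴷ ≈ γ up to 1 + 2/X, apart from the rounding of θ.
module Theta (A B G D : ℕ) (0<B : 0 < B) (B<A : B < A)
  (L K X Z : ℕ) (0<L : 0 < L) (0<Z : 0 < Z) (6Z≤X : 6 * Z ≤ X)
  (upper : X ^ L * (A ^ K * D ^ L) ≤ (X + 2) ^ L * (B ^ K * G ^ L))
  (lower : X ^ L * (B ^ K * G ^ L) ≤ (X + 2) ^ L * (A ^ K * D ^ L)) where

  Z₃ M₀ : ℕ
  -- A factor 1 + 1/(3Z) is lost at most twice, by the rounding of `t` and by 2/X, and its square is
  -- at most 1 + 1/Z.
  Z₃ = 3 * Z
  -- So large that passing from `t` to `suc t` changes the powers of exponent up to L + K by at most
  -- the factor 1 + 1/(3Z).
  M₀ = 2 * (L + K) * Z₃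

  0<Z₃ : 0 < Z₃
  0<Z₃ = *-mono-≤ {1} {3} (s≤s z≤n) 0<Z

  0<X : 0 < X
  0<X = ≤-trans (*-mono-≤ {1} {6} (s≤s z≤n) 0<Z) 6Z≤X

  0<M₀ : 0 < M₀
  0<M₀ = *-mono-≤ (*-mono-≤ {1} {2} (s≤s z≤n) (≤-trans 0<L (m≤m+n L K))) 0<Z₃

  private
    θ = root A B L M₀ 0<B B<A 0<L 0<M₀

  t : ℕ
  t = proj₁ θ

  M₀≤t : M₀ ≤ t
  M₀≤t = proj₁ (proj₂ θ)

  below : B * t ^ L ≤ A * M₀ ^ L
  below = proj₁ (proj₂ (proj₂ θ))

  above : A * M₀ ^ L ≤ B * suc t ^ L
  above = <⇒≤ (proj₂ (proj₂ (proj₂ θ)))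

  0<t : 0 < t
  0<t = ≤-trans 0<M₀ M₀≤t

  slack : ∀ n → n ≤ L + K → Z₃ * suc t ^ n ≤ suc Z₃ * t ^ n
  slack n n≤ = power-slack t n Z₃ 0<t 0<Z₃ (≤-trans (*-monoˡ-≤ Z₃ (*-monoʳ-≤ 2 n≤)) M₀≤t)

  Z≤Z₃ : ∀ {u v} → Z₃ * u ≤ suc Z₃ * v → Z * u ≤ suc Z * v
  Z≤Z₃ {u} {v} p = *-cancelˡ-≤ 3 (begin
    3 * (Z * u)          ≡⟨ *-assoc 3 Z u ⟨
    Z₃ * u               ≤⟨ p ⟩
    suc Z₃ * v           ≤⟨ m≤m+n (suc Z₃ * v) (2 * v) ⟩
    suc Z₃ * v + 2 * v   ≡⟨ collect Z v ⟩
    3 * (suc Z * v)      ∎)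
    where
    open ≤-Reasoning
    collect : ∀ Z v → suc (3 * Z) * v + 2 * v ≡ 3 * (suc Z * v)
    collect = solve-∀

  to-Near₁ : ∀ {a b} → Z * a ≤ suc Z * b → Z * b ≤ suc Z * a → Near Z 1 a b
  to-Near₁ {a} {b} p q = near (subst₂ (λ u v → u * a ≤ v * b) (sym (*-identityʳ Z)) (sym (*-identityʳ (suc Z))) p)
                              (subst₂ (λ u v → u * b ≤ v * a) (sym (*-identityʳ Z)) (sym (*-identityʳ (suc Z))) q)

  near₁ : Near Z 1 (A * M₀ ^ L) (B * t ^ L)
  near₁ = to-Near₁ (Z≤Z₃ (begin
    Z₃ * (A * M₀ ^ L)        ≤⟨ *-monoʳ-≤ Z₃ above ⟩
    Z₃ * (B * suc t ^ L)     ≡⟨ x∙yz≈y∙xz Z₃ B (suc t ^ L) ⟩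
    B * (Z₃ * suc t ^ L)     ≤⟨ *-monoʳ-≤ B (slack L (m≤m+n L K)) ⟩
    B * (suc Z₃ * t ^ L)     ≡⟨ x∙yz≈y∙xz B (suc Z₃) (t ^ L) ⟩
    suc Z₃ * (B * t ^ L)     ∎))
    (*-mono-≤ (n≤1+n Z) below)
    where
    open ≤-Reasoning

  private
    extract : ∀ u v w x → (u * (v * w ^ K)) ^ L * x ^ K ≡ u ^ L * v ^ L * (x * w ^ L) ^ K
    extract u v w x = begin
      (u * (v * w ^ K)) ^ L * x ^ K               ≡⟨ cong (_* x ^ K) (trans (^-distribʳ-* u (v * w ^ K) L) (cong (u ^ L *_) (trans (^-distribʳ-* v (w ^ K) L) (cong (v ^ L *_) (^-comm w K L))))) ⟩
      u ^ L * (v ^ L * (w ^ L) ^ K) * x ^ K       ≡⟨ regroup (u ^ L) (v ^ L) ((w ^ L) ^ K) (x ^ K) ⟩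
      u ^ L * v ^ L * (x ^ K * (w ^ L) ^ K)       ≡⟨ cong (u ^ L * v ^ L *_) (sym (^-distribʳ-* x (w ^ L) K)) ⟩
      u ^ L * v ^ L * (x * w ^ L) ^ K             ∎
      where
      open ≡-Reasoning
      regroup : ∀ a b c d → a * (b * c) * d ≡ a * b * (d * c)
      regroup = solve-∀

    -- The factor `y ^ K` is carried along to build `(y * u ^ L) ^ K`, which is traded for
    -- `(x * v ^ L) ^ K`. Then the comparison of αᴷ with γᴸ applies, and the L-th root is taken
    -- last.
    transfer : ∀ x y c e p q u v → 0 < y → (y * u ^ L) ^ K ≤ (x * v ^ L) ^ K → p ^ L * (x ^ K * c ^ L) ≤ q ^ L * (y ^ K * e ^ L) →
      p * (c * u ^ K) ≤ q * (e * v ^ K)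
    transfer x y c e p q u v 0<y uv pq = ^-cancelˡ-≤ L 0<L (*-cancelʳ-≤ _ _ (y ^ K) {{>-nonZero (0<^ K 0<y)}} (begin
      (p * (c * u ^ K)) ^ L * y ^ K            ≡⟨ extract p c u y ⟩
      p ^ L * c ^ L * (y * u ^ L) ^ K          ≤⟨ *-monoʳ-≤ (p ^ L * c ^ L) uv ⟩
      p ^ L * c ^ L * (x * v ^ L) ^ K          ≡⟨ cong (p ^ L * c ^ L *_) (^-distribʳ-* x (v ^ L) K) ⟩
      p ^ L * c ^ L * (x ^ K * (v ^ L) ^ K)    ≡⟨ regroup (p ^ L) (c ^ L) (x ^ K) ((v ^ L) ^ K) ⟩
      p ^ L * (x ^ K * c ^ L) * (v ^ L) ^ K    ≤⟨ *-monoˡ-≤ ((v ^ L) ^ K) pq ⟩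
      q ^ L * (y ^ K * e ^ L) * (v ^ L) ^ K    ≡⟨ regroup (q ^ L) (e ^ L) (y ^ K) ((v ^ L) ^ K) ⟨
      q ^ L * e ^ L * (y ^ K * (v ^ L) ^ K)    ≡⟨ cong (q ^ L * e ^ L *_) (^-distribʳ-* y (v ^ L) K) ⟨
      q ^ L * e ^ L * (y * v ^ L) ^ K          ≡⟨ extract q e v y ⟨
      (q * (e * v ^ K)) ^ L * y ^ K            ∎))
      where
      open ≤-Reasoning
      regroup : ∀ a b c d → a * b * (c * d) ≡ a * (c * b) * d
      regroup = solve-∀

    Dt≤ : X * (D * t ^ K) ≤ (X + 2) * (G * M₀ ^ K)
    Dt≤ = transfer A B D G X (X + 2) t M₀ 0<B (^-monoˡ-≤ K below) upper

    GM≤ : X * (G * M₀ ^ K) ≤ (X + 2) * (D * suc t ^ K)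
    GM≤ = transfer B A G D X (X + 2) M₀ (suc t) (<-trans 0<B B<A) (^-monoˡ-≤ K above) lower

    relax : ∀ {u v} → X * u ≤ (X + 2) * v → Z₃ * u ≤ suc Z₃ * v
    relax {u} {v} p = *-cancelˡ-≤ X {{>-nonZero 0<X}} (begin
      X * (Z₃ * u)          ≡⟨ x∙yz≈y∙xz X Z₃ u ⟩
      Z₃ * (X * u)          ≤⟨ *-monoʳ-≤ Z₃ p ⟩
      Z₃ * ((X + 2) * v)    ≡⟨ *-assoc Z₃ (X + 2) v ⟨
      Z₃ * (X + 2) * v      ≤⟨ *-monoˡ-≤ v (ratio-slack X Z₃ (≤-trans (≤-reflexive (sym (*-assoc 2 3 Z))) 6Z≤X)) ⟩
      suc Z₃ * X * v        ≡⟨ xy∙z≈y∙xz (suc Z₃) X v ⟩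
      X * (suc Z₃ * v)      ∎)
      where
      open ≤-Reasoning

    square-slack : ∀ Z → suc (3 * Z) * suc (3 * Z) * Z ≤ suc Z * (3 * Z * (3 * Z))
    square-slack zero = z≤n
    square-slack (suc Z) = ≤-trans (m≤m+n _ (suc Z * (3 * Z + 2))) (≤-reflexive (identity Z))
      where
      identity : ∀ Z → suc (3 * suc Z) * suc (3 * suc Z) * suc Z + suc Z * (3 * Z + 2) ≡ suc (suc Z) * (3 * suc Z * (3 * suc Z))
      identity = solve-∀

    twice : ∀ {u v w} → Z₃ * u ≤ suc Z₃ * v → Z₃ * v ≤ suc Z₃ * w → Z * u ≤ suc Z * w
    twice {u} {v} {w} p q = *-cancelˡ-≤ (Z₃ * Z₃) {{>-nonZero (*-mono-≤ 0<Z₃ 0<Z₃)}} (begin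
      Z₃ * Z₃ * (Z * u)             ≡⟨ regroup₁ Z₃ Z u ⟩
      Z * (Z₃ * (Z₃ * u))           ≤⟨ *-monoʳ-≤ Z (*-monoʳ-≤ Z₃ p) ⟩
      Z * (Z₃ * (suc Z₃ * v))       ≡⟨ cong (Z *_) (x∙yz≈y∙xz Z₃ (suc Z₃) v) ⟩
      Z * (suc Z₃ * (Z₃ * v))       ≤⟨ *-monoʳ-≤ Z (*-monoʳ-≤ (suc Z₃) q) ⟩
      Z * (suc Z₃ * (suc Z₃ * w))   ≡⟨ regroup₂ Z (suc Z₃) w ⟩
      suc Z₃ * suc Z₃ * Z * w       ≤⟨ *-monoˡ-≤ w (square-slack Z) ⟩
      suc Z * (Z₃ * Z₃) * w         ≡⟨ xy∙z≈y∙xz (suc Z) (Z₃ * Z₃) w ⟩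
      Z₃ * Z₃ * (suc Z * w)         ∎)
      where
      open ≤-Reasoning
      regroup₁ : ∀ a b c → a * a * (b * c) ≡ b * (a * (a * c))
      regroup₁ = solve-∀
      regroup₂ : ∀ a b c → a * (b * (b * c)) ≡ b * b * a * c
      regroup₂ = solve-∀

  near₂ : Near Z 1 (G * M₀ ^ K) (D * t ^ K)
  near₂ = to-Near₁ (twice (relax GM≤) (begin
    Z₃ * (D * suc t ^ K)     ≡⟨ x∙yz≈y∙xz Z₃ D (suc t ^ K) ⟩
    D * (Z₃ * suc t ^ K)     ≤⟨ *-monoʳ-≤ D (slack K (m≤n+m K L)) ⟩
    D * (suc Z₃ * t ^ K)     ≡⟨ x∙yz≈y∙xz D (suc Z₃) (t ^ K) ⟩
    suc Z₃ * (D * t ^ K)     ∎))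
    (Z≤Z₃ (relax Dt≤))
    where
    open ≤-Reasoning

-- Choice of the parameters

n<2^n : ∀ n → n < 2 ^ n
n<2^n zero = s≤s z≤n
n<2^n (suc n) = begin-strict
  suc n              <⟨ s≤s (n<2^n n) ⟩
  suc (2 ^ n)        ≤⟨ +-monoˡ-≤ (2 ^ n) (m^n>0 2 n) ⟩
  2 ^ n + 2 ^ n      ≡⟨ cong (2 ^ n +_) (sym (+-identityʳ (2 ^ n))) ⟩
  2 ^ suc n          ∎
  where open ≤-Reasoning

halve : ∀ n → ∃ λ m → n ≤ 2 * suc m × 2 * m ≤ n
halve zero = 0 , z≤n , z≤n
halve (suc zero) = 0 , s≤s z≤n , z≤n
halve (suc (suc n)) with halve n
... | m , p , q = suc m , ≤-trans (s≤s (s≤s p)) (≤-reflexive (eq₁ m)) , ≤-trans (≤-reflexive (eq₂ m)) (s≤s (s≤s q))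
  where
  eq₁ : ∀ m → 2 + 2 * suc m ≡ 2 * suc (suc m)
  eq₁ = solve-∀
  eq₂ : ∀ m → 2 * suc m ≡ 2 + 2 * m
  eq₂ = solve-∀

-- Abstract, because unfolding n₀ would produce huge unary numerals.
abstract
  exponential-dominates : ∀ k c → ∃ λ n₀ → ∀ n → n₀ ≤ n → c * n ^ k ≤ 2 ^ n
  exponential-dominates zero c = c , λ n c≤n → ≤-trans (≤-reflexive (*-identityʳ c)) (≤-trans c≤n (<⇒≤ (n<2^n n)))
  exponential-dominates (suc k) c with exponential-dominates k (c * 2 ^ suc k * 2 ^ k)
  ... | n₀ , dominates = 2 * suc (suc n₀) , bound
    where
    bound : ∀ n → 2 * suc (suc n₀) ≤ n → c * n ^ suc k ≤ 2 ^ n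
    bound n n₀≤n with halve n
    ... | m , n≤2m+2 , 2m≤n = begin
      c * n ^ suc k                                  ≤⟨ *-monoʳ-≤ c (^-monoˡ-≤ (suc k) n≤2m+2) ⟩
      c * (2 * suc m) ^ suc k                        ≡⟨ cong (c *_) (^-distribʳ-* 2 (suc m) (suc k)) ⟩
      c * (2 ^ suc k * (suc m * suc m ^ k))          ≡⟨ regroup c (2 ^ suc k) (suc m) (suc m ^ k) ⟩
      c * 2 ^ suc k * suc m ^ k * suc m              ≤⟨ *-monoˡ-≤ (suc m) (*-monoʳ-≤ (c * 2 ^ suc k) (^-monoˡ-≤ k (≤-trans (+-monoˡ-≤ m 1≤m) (≤-reflexive (cong (m +_) (sym (+-identityʳ m))))))) ⟩
      c * 2 ^ suc k * (2 * m) ^ k * suc m            ≡⟨ cong (λ u → c * 2 ^ suc k * u * suc m) (^-distribʳ-* 2 m k) ⟩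
      c * 2 ^ suc k * (2 ^ k * m ^ k) * suc m        ≡⟨ cong (_* suc m) (sym (*-assoc (c * 2 ^ suc k) (2 ^ k) (m ^ k))) ⟩
      -- With m about n/2, one factor 2ᵐ pays for the lower power and the other for the remaining
      -- `suc m`.
      c * 2 ^ suc k * 2 ^ k * m ^ k * suc m          ≤⟨ *-mono-≤ (dominates m (≤-trans (n≤1+n n₀) sn₀≤m)) (n<2^n m) ⟩
      2 ^ m * 2 ^ m                                  ≡⟨ trans (sym (^-distribˡ-+-* 2 m m)) (cong (λ e → 2 ^ (m + e)) (sym (+-identityʳ m))) ⟩
      2 ^ (2 * m)                                    ≤⟨ ^-monoʳ-≤ 2 2m≤n ⟩
      2 ^ n                                          ∎
      where
      open ≤-Reasoning
      regroup : ∀ a b c d → a * (b * (c * d)) ≡ a * b * d * c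
      regroup = solve-∀
      sn₀≤m : suc n₀ ≤ m
      sn₀≤m = ≤-pred (*-cancelˡ-≤ 2 (≤-trans n₀≤n n≤2m+2))
      1≤m : 1 ≤ m
      1≤m = ≤-trans (s≤s z≤n) sn₀≤m

-- A record, so that the exponent can be inferred.
record _≤2^_ (a e : ℕ) : Set where
  constructor within
  field unwrap : a ≤ 2 ^ e
open _≤2^_

private
  infixr 7 _⊗_
  _⊗_ : ∀ {a b m n} → a ≤2^ m → b ≤2^ n → (a * b) ≤2^ (m + n)
  _⊗_ {m = m} {n} (within p) (within q) = within (≤-trans (*-mono-≤ p q) (≤-reflexive (sym (^-distribˡ-+-* 2 m n))))

  exactly : ∀ e → (2 ^ e) ≤2^ e
  exactly e = within ≤-refl

  2^-mono : ∀ {m n} → m ≤ n → 2 ^ m ≤ 2 ^ n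
  2^-mono = ^-monoʳ-≤ 2

-- Here 2^ℓ ≤ L < 2^(ℓ+1).  All sizes are 2^O(ℓ⁶), while the tail gains 2^(ℓ⁷) and X^Q ≥ 2ᴸ ≥ 2^(2^ℓ).
module Parameters (h κ Q ℓ : ℕ)
  (ℓ-large : (64 + 2 * (2 + κ) + (24 * h + 22) * Q) * ℓ ^ 7 ≤ 2 ^ ℓ) (40h+35≤ℓ : 40 * h + 35 ≤ ℓ) where

  ℓ² ℓ⁴ ℓ⁶ J S I T p P η H Z : ℕ
  ℓ² = ℓ * ℓ
  ℓ⁴ = ℓ² * ℓ²
  ℓ⁶ = ℓ⁴ * ℓ²
  J = 2 * ℓ²
  S = ℓ⁴
  I = ℓ⁴ * ℓ
  T = ℓ⁶ * ℓ
  -- As wJ ≤ 8ℓ⁶, the denominator `Ymax` takes 8hℓ⁶ of the exponent; the last ℓ⁶ pays for 2(T + 1).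
  p = (8 * h + 1) * ℓ⁶
  P = 2 ^ p
  -- There are J·I = 2T coefficients but only T coordinates of boxes, so a box count below H²
  -- suffices. Its exponent is at most η + (16h + 14)ℓ⁶, margin included.
  η = (16 * h + 14) * ℓ⁶
  H = 2 ^ η
  -- The heights require 2^((24h + 18)ℓ⁶); one more ℓ⁶ makes the inequality strict.
  Z = 2 ^ ((24 * h + 19) * ℓ⁶)

  35≤ℓ : 35 ≤ ℓ
  35≤ℓ = ≤-trans (m≤n+m 35 (40 * h)) 40h+35≤ℓ

  2≤ℓ : 2 ≤ ℓ
  2≤ℓ = ≤-trans (s≤s (s≤s z≤n)) 35≤ℓ

  1≤ℓ : 1 ≤ ℓ
  1≤ℓ = ≤-trans (s≤s z≤n) 35≤ℓ

  1≤ℓ² : 1 ≤ ℓ²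
  1≤ℓ² = *-mono-≤ 1≤ℓ 1≤ℓ

  1≤ℓ⁴ : 1 ≤ ℓ⁴
  1≤ℓ⁴ = *-mono-≤ 1≤ℓ² 1≤ℓ²

  1≤ℓ⁶ : 1 ≤ ℓ⁶
  1≤ℓ⁶ = *-mono-≤ 1≤ℓ⁴ 1≤ℓ²

  ℓ≤ℓ² : ℓ ≤ ℓ²
  ℓ≤ℓ² = m≤m*n ℓ ℓ {{>-nonZero 1≤ℓ}}

  ℓ²≤ℓ⁴ : ℓ² ≤ ℓ⁴
  ℓ²≤ℓ⁴ = m≤m*n ℓ² ℓ² {{>-nonZero 1≤ℓ²}}

  ℓ⁴≤ℓ⁶ : ℓ⁴ ≤ ℓ⁶
  ℓ⁴≤ℓ⁶ = m≤m*n ℓ⁴ ℓ² {{>-nonZero 1≤ℓ²}}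

  ℓ≤ℓ⁶ : ℓ ≤ ℓ⁶
  ℓ≤ℓ⁶ = ≤-trans ℓ≤ℓ² (≤-trans ℓ²≤ℓ⁴ ℓ⁴≤ℓ⁶)

  ℓ⁶≤T : ℓ⁶ ≤ T
  ℓ⁶≤T = m≤m*n ℓ⁶ ℓ {{>-nonZero 1≤ℓ}}

  1≤T : 1 ≤ T
  1≤T = ≤-trans 1≤ℓ⁶ ℓ⁶≤T

  CT≤2^ℓ : (64 + 2 * (2 + κ) + (24 * h + 22) * Q) * T ≤ 2 ^ ℓ
  CT≤2^ℓ = ≤-trans (≤-reflexive (cong ((64 + 2 * (2 + κ) + (24 * h + 22) * Q) *_) (seventh ℓ))) ℓ-large
    where
    seventh : ∀ ℓ → ℓ * ℓ * (ℓ * ℓ) * (ℓ * ℓ) * ℓ ≡ ℓ * (ℓ * (ℓ * (ℓ * (ℓ * (ℓ * (ℓ * 1))))))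
    seventh = solve-∀

  64T≤2^ℓ : 64 * T ≤ 2 ^ ℓ
  64T≤2^ℓ = ≤-trans (*-monoˡ-≤ T (≤-trans (m≤m+n 64 (2 * (2 + κ))) (m≤m+n (64 + 2 * (2 + κ)) ((24 * h + 22) * Q)))) CT≤2^ℓ

  JI≡2T : J * I ≡ 2 * T
  JI≡2T = identity ℓ
    where
    identity : ∀ ℓ → 2 * (ℓ * ℓ) * (ℓ * ℓ * (ℓ * ℓ) * ℓ) ≡ 2 * (ℓ * ℓ * (ℓ * ℓ) * (ℓ * ℓ) * ℓ)
    identity = solve-∀

  JI≤2^ℓ : (J * I) ≤2^ ℓ
  JI≤2^ℓ = within (≤-trans (≤-reflexive JI≡2T) (≤-trans (*-monoˡ-≤ T {2} {64} (s≤s (s≤s z≤n))) 64T≤2^ℓ))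

  JI≤SS : J * I ≤ S * S
  JI≤SS = begin
    J * I          ≡⟨ JI≡2T ⟩
    2 * T          ≤⟨ *-monoˡ-≤ T 2≤ℓ ⟩
    ℓ * T          ≡⟨ identity ℓ ⟩
    S * S          ∎
    where
    open ≤-Reasoning
    identity : ∀ ℓ → ℓ * (ℓ * ℓ * (ℓ * ℓ) * (ℓ * ℓ) * ℓ) ≡ ℓ * ℓ * (ℓ * ℓ) * (ℓ * ℓ * (ℓ * ℓ))
    identity = solve-∀

  w : ℕ
  w = S + J + S

  J≤2S : J ≤ 2 * S
  J≤2S = *-monoʳ-≤ 2 ℓ²≤ℓ⁴

  J≤S : J ≤ S
  J≤S = *-monoˡ-≤ ℓ² (≤-trans (m≤m*n 2 2) (*-mono-≤ 2≤ℓ 2≤ℓ))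

  w≤ : w ≤ 4 * ℓ⁴
  w≤ = begin
    S + J + S       ≤⟨ +-monoˡ-≤ S (+-monoʳ-≤ S J≤2S) ⟩
    S + 2 * S + S   ≡⟨ identity S ⟩
    4 * S           ∎
    where
    open ≤-Reasoning
    identity : ∀ S → S + 2 * S + S ≡ 4 * S
    identity = solve-∀

  wJ≤ : w * J ≤ 8 * ℓ⁶
  wJ≤ = ≤-trans (*-monoˡ-≤ J w≤) (≤-reflexive (identity ℓ⁴ ℓ²))
    where
    identity : ∀ a b → 4 * a * (2 * b) ≡ 8 * (a * b)
    identity = solve-∀

  exponent≤ : ∀ c → c * w * J ≤ c * 8 * ℓ⁶
  exponent≤ c = begin
    c * w * J       ≡⟨ *-assoc c w J ⟩
    c * (w * J)     ≤⟨ *-monoʳ-≤ c wJ≤ ⟩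
    c * (8 * ℓ⁶)    ≡⟨ *-assoc c 8 ℓ⁶ ⟨
    c * 8 * ℓ⁶      ∎
    where open ≤-Reasoning

  β≤ : (2 ^ (suc h * w * J)) ≤2^ (suc h * 8 * ℓ⁶)
  β≤ = within (2^-mono (exponent≤ (suc h)))

  Ymax≤ : (2 ^ (h * w * J)) ≤2^ (h * 8 * ℓ⁶)
  Ymax≤ = within (2^-mono (exponent≤ h))

  module _ (L K : ℕ) (L<2^ : L < 2 ^ suc ℓ) (K≤κL : K ≤ κ * L) where

    xm : ℕ
    xm = (S + J) * L + S * K

    xm≤ : xm ≤ 2 ^ (ℓ + ℓ)
    xm≤ = begin
      (S + J) * L + S * K                    ≤⟨ +-mono-≤ (*-monoˡ-≤ L (+-monoʳ-≤ S J≤S)) (*-monoʳ-≤ S K≤κL) ⟩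
      (S + S) * L + S * (κ * L)              ≡⟨ collect S L κ ⟩
      (2 + κ) * S * L                        ≤⟨ *-monoʳ-≤ ((2 + κ) * S) (<⇒≤ L<2^) ⟩
      (2 + κ) * S * (2 * 2 ^ ℓ)              ≡⟨ regroup (2 + κ) S (2 ^ ℓ) ⟩
      2 * (2 + κ) * S * 2 ^ ℓ                ≤⟨ *-monoˡ-≤ (2 ^ ℓ) (≤-trans (*-mono-≤ (≤-trans (m≤n+m (2 * (2 + κ)) 64) (m≤m+n (64 + 2 * (2 + κ)) ((24 * h + 22) * Q))) (≤-trans ℓ⁴≤ℓ⁶ ℓ⁶≤T)) CT≤2^ℓ) ⟩
      2 ^ ℓ * 2 ^ ℓ                          ≡⟨ ^-distribˡ-+-* 2 ℓ ℓ ⟨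
      2 ^ (ℓ + ℓ)                            ∎
      where
      open ≤-Reasoning
      collect : ∀ S L κ → (S + S) * L + S * (κ * L) ≡ (2 + κ) * S * L
      collect = solve-∀
      regroup : ∀ k S y → k * S * (2 * y) ≡ 2 * k * S * y
      regroup = solve-∀

    xm^I≤ : (xm ^ I) ≤2^ (2 * ℓ⁶)
    xm^I≤ = within (≤-trans (^≤2^ (ℓ + ℓ) I xm≤) (≤-reflexive (cong (2 ^_) (identity ℓ))))
      where
      identity : ∀ ℓ → (ℓ + ℓ) * (ℓ * ℓ * (ℓ * ℓ) * ℓ) ≡ 2 * (ℓ * ℓ * (ℓ * ℓ) * (ℓ * ℓ))
      identity = solve-∀

    few-boxes : suc (P * (J * (I * (H * (xm ^ I * 2 ^ (suc h * w * J)))))) ^ T < (H ^ I) ^ J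
    few-boxes = begin-strict
      suc (P * (J * (I * (H * (xm ^ I * 2 ^ (suc h * w * J)))))) ^ T
        ≤⟨ ^-monoˡ-≤ T (≤-trans (s≤s bound) (n<2^n′ e)) ⟩
      (2 ^ suc e) ^ T
        ≡⟨ ^-*-assoc 2 (suc e) T ⟩
      2 ^ (suc e * T)
        <⟨ ^-monoʳ-< 2 (s≤s (s≤s z≤n)) (*-monoˡ-< T {{>-nonZero 1≤T}} se<2η) ⟩
      2 ^ ((η + η) * T)
        ≡⟨ cong (2 ^_) (trans (double η T) (trans (cong (η *_) (sym JI≡2T)) (flip η J I))) ⟩
      2 ^ (η * I * J)
        ≡⟨ trans (cong (_^ J) (^-*-assoc 2 η I)) (^-*-assoc 2 (η * I) J) ⟨
      (H ^ I) ^ J ∎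
      where
      open ≤-Reasoning
      e : ℕ
      e = p + (ℓ + (η + (2 * ℓ⁶ + suc h * 8 * ℓ⁶)))
      n<2^n′ : ∀ e → suc (2 ^ e) ≤ 2 ^ suc e
      n<2^n′ e = ≤-trans (+-monoˡ-≤ (2 ^ e) (m^n>0 2 e)) (≤-reflexive (cong (2 ^ e +_) (sym (+-identityʳ (2 ^ e)))))
      bound : P * (J * (I * (H * (xm ^ I * 2 ^ (suc h * w * J))))) ≤ 2 ^ e
      bound = ≤-trans (≤-reflexive (cong (P *_) (sym (*-assoc J I _)))) (unwrap (exactly p ⊗ JI≤2^ℓ ⊗ exactly η ⊗ xm^I≤ ⊗ β≤))
      double : ∀ η T → (η + η) * T ≡ η * (2 * T)
      double = solve-∀
      flip : ∀ η J I → η * (J * I) ≡ η * I * J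
      flip = solve-∀
      se<2η : suc e < η + η
      se<2η = begin
        suc (suc e)                                                 ≤⟨ s≤s (s≤s (+-monoʳ-≤ p (+-monoˡ-≤ _ ℓ≤ℓ⁶))) ⟩
        2 + (p + (ℓ⁶ + (η + (2 * ℓ⁶ + suc h * 8 * ℓ⁶))))            ≤⟨ +-monoˡ-≤ _ (*-monoʳ-≤ 2 1≤ℓ⁶) ⟩
        2 * ℓ⁶ + (p + (ℓ⁶ + (η + (2 * ℓ⁶ + suc h * 8 * ℓ⁶))))       ≡⟨ collect h ℓ⁶ ⟩
        η + η                                                       ∎
        where
        collect : ∀ h s → 2 * s + ((8 * h + 1) * s + (s + ((16 * h + 14) * s + (2 * s + suc h * 8 * s)))) ≡ (16 * h + 14) * s + (16 * h + 14) * s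
        collect = solve-∀

    small-tail : P * (J * (I * (H * (2 ^ I * (xm ^ I * (2 ^ (suc h * w * J) * 2 ^ (suc h * w * J))))))) ≤ 2 ^ T
    small-tail = begin
      P * (J * (I * (H * (2 ^ I * (xm ^ I * (2 ^ (suc h * w * J) * 2 ^ (suc h * w * J)))))))
        ≡⟨ cong (P *_) (*-assoc J I _) ⟨
      P * (J * I * (H * (2 ^ I * (xm ^ I * (2 ^ (suc h * w * J) * 2 ^ (suc h * w * J))))))
        ≤⟨ unwrap (exactly p ⊗ JI≤2^ℓ ⊗ exactly η ⊗ exactly I ⊗ xm^I≤ ⊗ β≤ ⊗ β≤) ⟩
      2 ^ (p + (ℓ + (η + (I + (2 * ℓ⁶ + (suc h * 8 * ℓ⁶ + suc h * 8 * ℓ⁶))))))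
        ≤⟨ 2^-mono exponents ⟩
      2 ^ T ∎
      where
      open ≤-Reasoning
      exponents : p + (ℓ + (η + (I + (2 * ℓ⁶ + (suc h * 8 * ℓ⁶ + suc h * 8 * ℓ⁶))))) ≤ T
      exponents = begin
        p + (ℓ + (η + (I + (2 * ℓ⁶ + (suc h * 8 * ℓ⁶ + suc h * 8 * ℓ⁶)))))
          ≤⟨ +-monoʳ-≤ p (+-mono-≤ ℓ≤ℓ⁶ (+-monoʳ-≤ η (+-monoˡ-≤ _ (*-monoʳ-≤ ℓ⁴ ℓ≤ℓ²)))) ⟩
        p + (ℓ⁶ + (η + (ℓ⁶ + (2 * ℓ⁶ + (suc h * 8 * ℓ⁶ + suc h * 8 * ℓ⁶)))))
          ≡⟨ collect h ℓ⁶ ⟩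
        -- Adding up all exponents in the tail is the origin of the constant in `40h+35≤ℓ`.
        ℓ⁶ * (40 * h + 35)
          ≤⟨ *-monoʳ-≤ ℓ⁶ 40h+35≤ℓ ⟩
        T ∎
        where
        collect : ∀ h s → (8 * h + 1) * s + (s + ((16 * h + 14) * s + (s + (2 * s + (suc h * 8 * s + suc h * 8 * s))))) ≡ s * (40 * h + 35)
        collect = solve-∀

    P-large : 2 * suc T * 2 ^ (h * w * J) ≤ P
    P-large = begin
      2 * suc T * 2 ^ (h * w * J)       ≤⟨ unwrap (within {e = ℓ} 2sT≤ ⊗ Ymax≤) ⟩
      2 ^ (ℓ + h * 8 * ℓ⁶)              ≤⟨ 2^-mono (≤-trans (+-monoˡ-≤ _ ℓ≤ℓ⁶) (≤-reflexive (collect h ℓ⁶))) ⟩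
      P                                 ∎
      where
      open ≤-Reasoning
      collect : ∀ h s → s + h * 8 * s ≡ (8 * h + 1) * s
      collect = solve-∀
      2sT≤ : 2 * suc T ≤ 2 ^ ℓ
      2sT≤ = ≤-trans (*-monoʳ-≤ 2 (≤-trans (+-monoˡ-≤ T 1≤T) (≤-reflexive (cong (T +_) (sym (+-identityʳ T))))))
        (≤-trans (≤-reflexive (sym (*-assoc 2 2 T))) (≤-trans (*-monoˡ-≤ T {4} {64} (s≤s (s≤s (s≤s (s≤s z≤n))))) 64T≤2^ℓ))

    Jw≤ : J * w ≤ 8 * ℓ⁶
    Jw≤ = ≤-trans (≤-reflexive (*-comm J w)) wJ≤

    8E≤ : 8 * (J * w) ≤ 2 ^ ℓ
    8E≤ = ≤-trans (*-monoʳ-≤ 8 Jw≤) (≤-trans (≤-reflexive (sym (*-assoc 8 8 ℓ⁶))) (≤-trans (*-monoʳ-≤ 64 ℓ⁶≤T) 64T≤2^ℓ))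

    Z-large : 8 * (J * w) * (J * (I * (H * (xm ^ I * 2 ^ (h * w * J))))) < Z
    Z-large = begin-strict
      8 * (J * w) * (J * (I * (H * (xm ^ I * 2 ^ (h * w * J)))))
        ≡⟨ cong (8 * (J * w) *_) (*-assoc J I _) ⟨
      8 * (J * w) * (J * I * (H * (xm ^ I * 2 ^ (h * w * J))))
        ≤⟨ unwrap (within {e = ℓ} 8E≤ ⊗ JI≤2^ℓ ⊗ exactly η ⊗ xm^I≤ ⊗ Ymax≤) ⟩
      2 ^ (ℓ + (ℓ + (η + (2 * ℓ⁶ + h * 8 * ℓ⁶))))
        ≤⟨ 2^-mono (≤-trans (+-mono-≤ ℓ≤ℓ⁶ (+-monoˡ-≤ _ ℓ≤ℓ⁶)) (≤-reflexive (collect h ℓ⁶))) ⟩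
      2 ^ ((24 * h + 18) * ℓ⁶)
        <⟨ ^-monoʳ-< 2 (s≤s (s≤s z≤n)) (*-monoˡ-< ℓ⁶ {{>-nonZero 1≤ℓ⁶}} (+-monoʳ-< (24 * h) (n<1+n 18))) ⟩
      Z ∎
      where
      open ≤-Reasoning
      collect : ∀ h s → s + (s + ((16 * h + 14) * s + (2 * s + h * 8 * s))) ≡ (24 * h + 18) * s
      collect = solve-∀

    2^ℓ<Z : 2 ^ ℓ < Z
    2^ℓ<Z = ^-monoʳ-< 2 (s≤s (s≤s z≤n)) (begin-strict
      ℓ                       ≤⟨ ℓ≤ℓ⁶ ⟩
      ℓ⁶                      <⟨ m<m+n ℓ⁶ 1≤ℓ⁶ ⟩
      ℓ⁶ + ℓ⁶                 ≡⟨ cong (ℓ⁶ +_) (+-identityʳ ℓ⁶) ⟨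
      2 * ℓ⁶                  ≤⟨ *-monoˡ-≤ ℓ⁶ (≤-trans (s≤s (s≤s z≤n)) (m≤n+m 19 (24 * h))) ⟩
      (24 * h + 19) * ℓ⁶      ∎)
      where open ≤-Reasoning

    2E≤Z : 2 * (J * w) ≤ Z
    2E≤Z = ≤-trans (*-monoˡ-≤ (J * w) {2} {8} (s≤s (s≤s z≤n))) (≤-trans 8E≤ (<⇒≤ 2^ℓ<Z))

    2w≤ : 2 * w ≤ 2 ^ ℓ
    2w≤ = ≤-trans (*-monoʳ-≤ 2 w≤) (≤-trans (≤-reflexive (sym (*-assoc 2 4 ℓ⁴)))
      (≤-trans (*-mono-≤ {8} {64} (s≤s (s≤s (s≤s (s≤s (s≤s (s≤s (s≤s (s≤s z≤n)))))))) (≤-trans ℓ⁴≤ℓ⁶ ℓ⁶≤T)) 64T≤2^ℓ))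

    2w≤Z : 2 * w ≤ Z
    2w≤Z = ≤-trans 2w≤ (<⇒≤ 2^ℓ<Z)

    Z-separates : 2 * w * 2 ^ (h * w) < Z
    Z-separates = begin-strict
      2 * w * 2 ^ (h * w)                ≤⟨ unwrap (within {e = ℓ} 2w≤ ⊗ exactly (h * w)) ⟩
      2 ^ (ℓ + h * w)                    ≤⟨ 2^-mono (+-mono-≤ ℓ≤ℓ⁶ (*-monoʳ-≤ h (≤-trans w≤ (*-monoʳ-≤ 4 ℓ⁴≤ℓ⁶)))) ⟩
      2 ^ (ℓ⁶ + h * (4 * ℓ⁶))            ≡⟨ cong (2 ^_) (collect h ℓ⁶) ⟩
      2 ^ ((4 * h + 1) * ℓ⁶)             <⟨ ^-monoʳ-< 2 (s≤s (s≤s z≤n)) (*-monoˡ-< ℓ⁶ {{>-nonZero 1≤ℓ⁶}} (+-mono-≤-< (*-monoˡ-≤ h {4} {24} (s≤s (s≤s (s≤s (s≤s z≤n))))) (s≤s (s≤s z≤n)))) ⟩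
      Z                                  ∎
      where
      open ≤-Reasoning
      collect : ∀ h s → s + h * (4 * s) ≡ (4 * h + 1) * s
      collect = solve-∀

  -- If X were below 6Z, then X^Q would be 2^O(ℓ⁶), with a constant depending on h and Q, and could
  -- not reach 2ᴸ ≥ 2^(2^ℓ).
  6Z≤ : ∀ {X L} → 2 ^ ℓ ≤ L → 2 ^ L ≤ X ^ Q → 6 * Z ≤ X
  6Z≤ {X} {L} 2^ℓ≤L 2^L≤X^Q with 6 * Z ≤? X
  ... | yes 6Z≤X = 6Z≤X
  ... | no 6Z≰X = contradiction (2^-cancel-≤ (begin
    2 ^ L                               ≤⟨ 2^L≤X^Q ⟩
    X ^ Q                               ≤⟨ ^≤2^ ((24 * h + 22) * ℓ⁶) Q X≤ ⟩
    2 ^ ((24 * h + 22) * ℓ⁶ * Q)        ∎)) (<⇒≱ (<-≤-trans exponent< 2^ℓ≤L))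
    where
    open ≤-Reasoning
    collect : ∀ h s → 3 * s + (24 * h + 19) * s ≡ (24 * h + 22) * s
    collect = solve-∀
    X≤ : X ≤ 2 ^ ((24 * h + 22) * ℓ⁶)
    X≤ = begin
      X                                      ≤⟨ <⇒≤ (≰⇒> 6Z≰X) ⟩
      6 * Z                                  ≤⟨ unwrap (within {6} {3} (s≤s (s≤s (s≤s (s≤s (s≤s (s≤s z≤n)))))) ⊗ exactly ((24 * h + 19) * ℓ⁶)) ⟩
      2 ^ (3 + (24 * h + 19) * ℓ⁶)           ≤⟨ 2^-mono (+-monoˡ-≤ _ (*-monoʳ-≤ 3 1≤ℓ⁶)) ⟩
      2 ^ (3 * ℓ⁶ + (24 * h + 19) * ℓ⁶)      ≡⟨ cong (2 ^_) (collect h ℓ⁶) ⟩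
      2 ^ ((24 * h + 22) * ℓ⁶)               ∎
    exponent< : (24 * h + 22) * ℓ⁶ * Q < 2 ^ ℓ
    exponent< = begin-strict
      (24 * h + 22) * ℓ⁶ * Q                              ≡⟨ xy∙z≈xz∙y (24 * h + 22) ℓ⁶ Q ⟩
      (24 * h + 22) * Q * ℓ⁶                              ≤⟨ *-monoʳ-≤ ((24 * h + 22) * Q) ℓ⁶≤T ⟩
      (24 * h + 22) * Q * T                               <⟨ *-monoˡ-< T {{>-nonZero 1≤T}} (m<n+m ((24 * h + 22) * Q) {64 + 2 * (2 + κ)} (s≤s z≤n)) ⟩
      (64 + 2 * (2 + κ) + (24 * h + 22) * Q) * T          ≤⟨ CT≤2^ℓ ⟩
      2 ^ ℓ                                               ∎

-- The numerical hypotheses of `Interpolation` and the 6Z ≤ X of `Theta`, with the abbreviations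
-- written out. The contradiction is thus derived without knowing how the parameters were chosen.
record Choice (h L K X : ℕ) : Set where
  field
    S J I T P H Z : ℕ
    0<S : 0 < S
    0<P : 0 < P
    0<Z : 0 < Z
    few-boxes : suc (P * (J * (I * (H * (((S + J) * L + S * K) ^ I * 2 ^ (suc h * (S + J + S) * J)))))) ^ T < (H ^ I) ^ J
    small-tail : P * (J * (I * (H * (2 ^ I * (((S + J) * L + S * K) ^ I * (2 ^ (suc h * (S + J + S) * J) * 2 ^ (suc h * (S + J + S) * J))))))) ≤ 2 ^ T
    P-large : 2 * suc T * 2 ^ (h * (S + J + S) * J) ≤ P
    Z-large : 8 * (J * (S + J + S)) * (J * (I * (H * (((S + J) * L + S * K) ^ I * 2 ^ (h * (S + J + S) * J))))) < Z
    2E≤Z : 2 * (J * (S + J + S)) ≤ Z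
    2w≤Z : 2 * (S + J + S) ≤ Z
    Z-separates : 2 * (S + J + S) * 2 ^ (h * (S + J + S)) < Z
    JI≤SS : J * I ≤ S * S
    6Z≤X : 6 * Z ≤ X

module _ (h κ Q ℓ : ℕ) (ℓ-large : (64 + 2 * (2 + κ) + (24 * h + 22) * Q) * ℓ ^ 7 ≤ 2 ^ ℓ) (h≤ℓ : 40 * h + 35 ≤ ℓ)
  (L K X : ℕ) (2^ℓ≤L : 2 ^ ℓ ≤ L) (L<2^ : L < 2 ^ suc ℓ) (K≤κL : K ≤ κ * L) (2^L≤X^Q : 2 ^ L ≤ X ^ Q) where
  private module P = Parameters h κ Q ℓ ℓ-large h≤ℓ

  choose : Choice h L K X
  choose = record
    { S = P.S ; J = P.J ; I = P.I ; T = P.T ; P = P.P ; H = P.H ; Z = P.Z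
    ; 0<S = P.1≤ℓ⁴ ; 0<P = m^n>0 2 P.p ; 0<Z = m^n>0 2 ((24 * h + 19) * P.ℓ⁶)
    ; few-boxes = P.few-boxes L K L<2^ K≤κL ; small-tail = P.small-tail L K L<2^ K≤κL
    ; P-large = P.P-large L K L<2^ K≤κL ; Z-large = P.Z-large L K L<2^ K≤κL
    ; 2E≤Z = P.2E≤Z L K L<2^ K≤κL ; 2w≤Z = P.2w≤Z L K L<2^ K≤κL ; Z-separates = P.Z-separates L K L<2^ K≤κL
    ; JI≤SS = P.JI≤SS ; 6Z≤X = P.6Z≤ 2^ℓ≤L 2^L≤X^Q }

choice : ∀ h κ Q → ∃ λ ℓ₀ → ∀ ℓ L K X → ℓ₀ ≤ ℓ → 2 ^ ℓ ≤ L → L < 2 ^ suc ℓ → K ≤ κ * L → 2 ^ L ≤ X ^ Q → Choice h L K X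
choice h κ Q = proj₁ dominance + (40 * h + 35) , λ ℓ L K X ℓ₀≤ℓ → choose h κ Q ℓ
  (proj₂ dominance ℓ (≤-trans (m≤m+n (proj₁ dominance) (40 * h + 35)) ℓ₀≤ℓ))
  (≤-trans (m≤n+m (40 * h + 35) (proj₁ dominance)) ℓ₀≤ℓ) L K X
  where dominance = exponential-dominates 7 (64 + 2 * (2 + κ) + (24 * h + 22) * Q)

-- (1 + 1/b)ᵇ ≥ 2
doubling : ∀ {a b} n → 0 < b → b < a → 2 ^ n * b ^ (b * n) ≤ a ^ (b * n)
doubling {a} {b@(suc _)} n _ b<a = begin
  2 ^ n * b ^ (b * n)       ≡⟨ cong (2 ^ n *_) (^-*-assoc b b n) ⟨
  2 ^ n * (b ^ b) ^ n       ≡⟨ ^-distribʳ-* 2 (b ^ b) n ⟨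
  (2 * b ^ b) ^ n           ≤⟨ ^-monoˡ-≤ n (≤-trans (base b) (^-monoˡ-≤ b b<a)) ⟩
  (a ^ b) ^ n               ≡⟨ ^-*-assoc a b n ⟩
  a ^ (b * n)               ∎
  where
  open ≤-Reasoning
  bernoulli-lower : ∀ b n → b ^ n * (b + n) ≤ suc b ^ n * b
  bernoulli-lower b zero = ≤-reflexive (cong (1 *_) (+-identityʳ b))
  bernoulli-lower b (suc n) = begin
    b * b ^ n * (b + suc n)                  ≤⟨ m≤m+n _ (b ^ n * n) ⟩
    b * b ^ n * (b + suc n) + b ^ n * n      ≡⟨ collect b (b ^ n) n ⟩
    suc b * (b ^ n * (b + n))                ≤⟨ *-monoʳ-≤ (suc b) (bernoulli-lower b n) ⟩
    suc b * (suc b ^ n * b)                  ≡⟨ *-assoc (suc b) (suc b ^ n) b ⟨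
    suc b * suc b ^ n * b                    ∎
    where
    collect : ∀ b e n → b * e * (b + suc n) + e * n ≡ suc b * (e * (b + n))
    collect = solve-∀
  base : ∀ b .{{_ : NonZero b}} → 2 * b ^ b ≤ suc b ^ b
  base b = *-cancelʳ-≤ _ _ b (≤-trans (≤-reflexive (regroup (b ^ b) b)) (bernoulli-lower b b))
    where
    regroup : ∀ e b → 2 * e * b ≡ e * (b + b)
    regroup = solve-∀

binary-size : ∀ n → 0 < n → ∃ λ ℓ → 2 ^ ℓ ≤ n × n < 2 ^ suc ℓ
binary-size (suc zero) _ = 0 , s≤s z≤n , s≤s (s≤s z≤n)
binary-size (suc n@(suc _)) _ with binary-size n (s≤s z≤n)
... | ℓ , 2^ℓ≤n , n<2^ with suc n <? 2 ^ suc ℓ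
... | yes sn<2^ = ℓ , m≤n⇒m≤1+n 2^ℓ≤n , sn<2^
... | no sn≮2^ = suc ℓ , ≮⇒≥ sn≮2^ , <-≤-trans (s≤s n<2^) (≤-trans (s≤s (m≤n*m (2 ^ suc ℓ) 1)) (double (2 ^ suc ℓ) (m^n>0 2 (suc ℓ))))
  where
  double : ∀ y → 0 < y → suc (1 * y) ≤ 2 * y
  double y 0<y = +-mono-≤ 0<y (≤-refl {1 * y})

module LinearForms
  (A B G D h : ℕ) (0<B : 0 < B) (B<A : B < A) (0<D : 0 < D) (D<G : D < G)
  (A≤ : A ≤ 2 ^ h) (B≤ : B ≤ 2 ^ h) (G≤ : G ≤ 2 ^ h) (D≤ : D ≤ 2 ^ h)
  (independent : ∀ r s → 0 < r → 0 < s → A ^ r * D ^ s ≢ B ^ r * G ^ s) where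

  -- (A/B)ᴷ and (G/D)ᴸ differ by a factor between (1 + 2/X)⁻ᴸ and (1 + 2/X)ᴸ
  record Approximates (K L X : ℕ) : Set where
    constructor approximates
    field
      upper : X ^ L * (A ^ K * D ^ L) ≤ (X + 2) ^ L * (B ^ K * G ^ L)
      lower : X ^ L * (B ^ K * G ^ L) ≤ (X + 2) ^ L * (A ^ K * D ^ L)

  module _ (K L X : ℕ) (0<L : 0 < L) (0<K : 0 < K) (approx : Approximates K L X) where
    open Approximates approx

    no-choice : ¬ Choice h L K X
    no-choice chosen = Interpolation.contradictory A B G D h 0<B B<A 0<D (<-trans 0<D D<G) A≤ B≤ G≤ D≤ independent
      L K S J I T P H Z t M₀ 0<L 0<K 0<S 0<P 0<M₀ M₀≤t near₁ near₂
      few-boxes small-tail P-large Z-large 2E≤Z 2w≤Z Z-separates JI≤SS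
      where
      open Choice chosen
      open Theta A B G D 0<B B<A L K X Z 0<L 0<Z 6Z≤X upper lower using (t; M₀; 0<M₀; M₀≤t; near₁; near₂)

    -- A ≥ B + 1 gives αᴮ ≥ 2, hence 2ᴷ ≤ α^(BK). On the other side αᴷ ≤ (3γ)ᴸ, because X + 2 ≤ 3X.
    K≤ : 0 < X → K ≤ (2 + h) * B * L
    K≤ 0<X = 2^-cancel-≤ (*-cancelʳ-≤ _ _ (B ^ (B * K)) {{>-nonZero (0<^ (B * K) 0<B)}} (begin
      2 ^ K * B ^ (B * K)                      ≤⟨ doubling K 0<B B<A ⟩
      A ^ (B * K)                              ≡⟨ trans (cong (A ^_) (*-comm B K)) (sym (^-*-assoc A K B)) ⟩
      (A ^ K) ^ B                              ≤⟨ ^-monoˡ-≤ B A^K≤ ⟩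
      (2 ^ ((2 + h) * L) * B ^ K) ^ B          ≡⟨ ^-distribʳ-* (2 ^ ((2 + h) * L)) (B ^ K) B ⟩
      (2 ^ ((2 + h) * L)) ^ B * (B ^ K) ^ B    ≡⟨ cong₂ _*_ (trans (^-*-assoc 2 ((2 + h) * L) B) (cong (2 ^_) (xy∙z≈xz∙y (2 + h) L B)))
                                                    (trans (^-*-assoc B K B) (cong (B ^_) (*-comm K B))) ⟩
      2 ^ ((2 + h) * B * L) * B ^ (B * K)      ∎))
      where
      open ≤-Reasoning
      regroup : ∀ t x b g → t * x * (b * g) ≡ x * (t * g * b)
      regroup = solve-∀
      X+2≤3X : X + 2 ≤ 3 * X
      X+2≤3X = ≤-trans (+-monoʳ-≤ X (*-monoʳ-≤ 2 0<X)) (≤-reflexive refl)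
      A^K≤ : A ^ K ≤ 2 ^ ((2 + h) * L) * B ^ K
      A^K≤ = *-cancelˡ-≤ (X ^ L) {{>-nonZero (0<^ L 0<X)}} (begin
        X ^ L * A ^ K                              ≤⟨ *-monoʳ-≤ (X ^ L) (m≤m*n (A ^ K) (D ^ L) {{>-nonZero (0<^ L 0<D)}}) ⟩
        X ^ L * (A ^ K * D ^ L)                    ≤⟨ upper ⟩
        (X + 2) ^ L * (B ^ K * G ^ L)              ≤⟨ *-monoˡ-≤ _ (^-monoˡ-≤ L X+2≤3X) ⟩
        (3 * X) ^ L * (B ^ K * G ^ L)              ≡⟨ cong (_* (B ^ K * G ^ L)) (^-distribʳ-* 3 X L) ⟩
        3 ^ L * X ^ L * (B ^ K * G ^ L)            ≡⟨ regroup (3 ^ L) (X ^ L) (B ^ K) (G ^ L) ⟩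
        X ^ L * (3 ^ L * G ^ L * B ^ K)            ≡⟨ cong (λ u → X ^ L * (u * B ^ K)) (^-distribʳ-* 3 G L) ⟨
        X ^ L * ((3 * G) ^ L * B ^ K)              ≤⟨ *-monoʳ-≤ (X ^ L) (*-monoˡ-≤ (B ^ K) (^≤2^ (2 + h) L
                                                        (≤-trans (*-mono-≤ {3} {4} (s≤s (s≤s (s≤s z≤n))) G≤) (≤-reflexive (*-assoc 2 2 (2 ^ h)))))) ⟩
        X ^ L * (2 ^ ((2 + h) * L) * B ^ K)        ∎)

    -- For X ≥ 4D the error leaves γ/(1 + 2/X) ≥ 1 + 1/(4D), and the 4D-th power of this is at least
    -- 2. So 2ᴸ is bounded by a power of αᴷ.
    L≤ : 4 * D ≤ X → L ≤ h * (4 * D) * K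
    L≤ 4D≤X = 2^-cancel-≤ (*-cancelʳ-≤ _ _ (4D ^ (4D * L)) {{>-nonZero (0<^ (4D * L) 0<4D)}} (begin
      2 ^ L * 4D ^ (4D * L)                  ≤⟨ doubling L 0<4D (n<1+n 4D) ⟩
      suc 4D ^ (4D * L)                      ≡⟨ trans (cong (suc 4D ^_) (*-comm 4D L)) (sym (^-*-assoc (suc 4D) L 4D)) ⟩
      (suc 4D ^ L) ^ 4D                      ≤⟨ ^-monoˡ-≤ 4D power≤ ⟩
      (2 ^ (h * K) * 4D ^ L) ^ 4D            ≡⟨ ^-distribʳ-* (2 ^ (h * K)) (4D ^ L) 4D ⟩
      (2 ^ (h * K)) ^ 4D * (4D ^ L) ^ 4D     ≡⟨ cong₂ _*_ (trans (^-*-assoc 2 (h * K) 4D) (cong (2 ^_) (xy∙z≈xz∙y h K 4D)))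
                                                  (trans (^-*-assoc 4D L 4D) (cong (4D ^_) (*-comm L 4D))) ⟩
      2 ^ (h * 4D * K) * 4D ^ (4D * L)       ∎))
      where
      open ≤-Reasoning
      4D : ℕ
      4D = 4 * D
      0<4D : 0 < 4D
      0<4D = *-mono-≤ {1} {4} (s≤s z≤n) 0<D
      0<X+2 : 0 < X + 2
      0<X+2 = ≤-trans (s≤s z≤n) (m≤n+m 2 X)
      expand₁ : ∀ D X → (X + 2) * D * suc (4 * D) ≡ 4 * D * D * X + D * X + (8 * D * D + 2 * D)
      expand₁ = solve-∀
      expand₂ : ∀ D X → 4 * D * D * X + D * X + 3 * D * X ≡ X * suc D * (4 * D)
      expand₂ = solve-∀
      small : 8 * D * D + 2 * D ≤ 3 * D * X
      small = begin
        8 * D * D + 2 * D            ≤⟨ +-monoʳ-≤ (8 * D * D) (*-monoʳ-≤ 2 (m≤m*n D D {{>-nonZero 0<D}})) ⟩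
        8 * D * D + 2 * (D * D)      ≤⟨ m≤m+n _ (2 * (D * D)) ⟩
        8 * D * D + 2 * (D * D) + 2 * (D * D) ≡⟨ collect D ⟩
        3 * D * (4 * D)              ≤⟨ *-monoʳ-≤ (3 * D) 4D≤X ⟩
        3 * D * X                    ∎
        where
        collect : ∀ D → 8 * D * D + 2 * (D * D) + 2 * (D * D) ≡ 3 * D * (4 * D)
        collect = solve-∀
      step : (X + 2) * D * suc 4D ≤ X * G * 4D
      step = begin
        (X + 2) * D * suc 4D                                    ≡⟨ expand₁ D X ⟩
        4 * D * D * X + D * X + (8 * D * D + 2 * D)             ≤⟨ +-monoʳ-≤ (4 * D * D * X + D * X) small ⟩
        4 * D * D * X + D * X + 3 * D * X                       ≡⟨ expand₂ D X ⟩
        X * suc D * 4D                                          ≤⟨ *-monoˡ-≤ 4D (*-monoʳ-≤ X D<G) ⟩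
        X * G * 4D                                              ∎
      cube : ∀ a b c → (a * b * c) ^ L ≡ a ^ L * b ^ L * c ^ L
      cube a b c = trans (^-distribʳ-* (a * b) c L) (cong (_* c ^ L) (^-distribʳ-* a b L))
      regroup₁ : ∀ x d s b → x * d * s * b ≡ x * d * (s * b)
      regroup₁ = solve-∀
      regroup₂ : ∀ x g f b → x * g * f * b ≡ x * (b * g) * f
      regroup₂ = solve-∀
      regroup₃ : ∀ x a d f → x * (a * d) * f ≡ x * d * (a * f)
      regroup₃ = solve-∀
      power≤ : suc 4D ^ L ≤ 2 ^ (h * K) * 4D ^ L
      power≤ = *-cancelˡ-≤ ((X + 2) ^ L * D ^ L) {{>-nonZero (*-mono-≤ (0<^ L 0<X+2) (0<^ L 0<D))}} (begin
        (X + 2) ^ L * D ^ L * suc 4D ^ L                 ≤⟨ *-monoʳ-≤ ((X + 2) ^ L * D ^ L) (m≤m*n (suc 4D ^ L) (B ^ K) {{>-nonZero (0<^ K 0<B)}}) ⟩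
        (X + 2) ^ L * D ^ L * (suc 4D ^ L * B ^ K)       ≡⟨ regroup₁ ((X + 2) ^ L) (D ^ L) (suc 4D ^ L) (B ^ K) ⟨
        (X + 2) ^ L * D ^ L * suc 4D ^ L * B ^ K         ≡⟨ cong (_* B ^ K) (cube (X + 2) D (suc 4D)) ⟨
        ((X + 2) * D * suc 4D) ^ L * B ^ K               ≤⟨ *-monoˡ-≤ (B ^ K) (^-monoˡ-≤ L step) ⟩
        (X * G * 4D) ^ L * B ^ K                         ≡⟨ cong (_* B ^ K) (cube X G 4D) ⟩
        X ^ L * G ^ L * 4D ^ L * B ^ K                   ≡⟨ regroup₂ (X ^ L) (G ^ L) (4D ^ L) (B ^ K) ⟩
        X ^ L * (B ^ K * G ^ L) * 4D ^ L                 ≤⟨ *-monoˡ-≤ (4D ^ L) lower ⟩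
        (X + 2) ^ L * (A ^ K * D ^ L) * 4D ^ L           ≡⟨ regroup₃ ((X + 2) ^ L) (A ^ K) (D ^ L) (4D ^ L) ⟩
        (X + 2) ^ L * D ^ L * (A ^ K * 4D ^ L)           ≤⟨ *-monoʳ-≤ ((X + 2) ^ L * D ^ L) (*-monoˡ-≤ (4D ^ L) (^≤2^ h K A≤)) ⟩
        (X + 2) ^ L * D ^ L * (2 ^ (h * K) * 4D ^ L)     ∎)

    halved : ∀ {u v} Z → 0 < X → 2 * Z ≤ X → X ^ L * u ≤ (X + 2) ^ L * v → Z ^ L * u ≤ suc Z ^ L * v
    halved {u} {v} Z 0<X 2Z≤X p = *-cancelˡ-≤ (X ^ L) {{>-nonZero (0<^ L 0<X)}} (begin
      X ^ L * (Z ^ L * u)             ≡⟨ x∙yz≈y∙xz (X ^ L) (Z ^ L) u ⟩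
      Z ^ L * (X ^ L * u)             ≤⟨ *-monoʳ-≤ (Z ^ L) p ⟩
      Z ^ L * ((X + 2) ^ L * v)       ≡⟨ *-assoc (Z ^ L) ((X + 2) ^ L) v ⟨
      Z ^ L * (X + 2) ^ L * v         ≡⟨ cong (_* v) (^-distribʳ-* Z (X + 2) L) ⟨
      (Z * (X + 2)) ^ L * v           ≤⟨ *-monoˡ-≤ v (^-monoˡ-≤ L (ratio-slack X Z 2Z≤X)) ⟩
      (suc Z * X) ^ L * v             ≡⟨ cong (_* v) (^-distribʳ-* (suc Z) X L) ⟩
      suc Z ^ L * X ^ L * v           ≡⟨ xy∙z≈y∙xz (suc Z ^ L) (X ^ L) v ⟩
      X ^ L * (suc Z ^ L * v)         ∎)
      where
      open ≤-Reasoning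

    -- Liouville: the integers AᴷDᴸ and BᴷGᴸ are different.
    trivial-bound : 0 < X → X ≤ 2 * suc (2 * L * 2 ^ (h * (K + L)))
    trivial-bound 0<X with halve X
    ... | Z , X≤2Z+2 , 2Z≤X with Z ≤? 2 * L * 2 ^ (h * (K + L))
    ... | yes Z≤ = ≤-trans X≤2Z+2 (*-monoʳ-≤ 2 (s≤s Z≤))
    ... | no Z≰ = contradiction (Near⇒≡ {E = L} (≤-<-trans z≤n Z>) (≤-trans (m≤m*n (2 * L) _ {{>-nonZero (m^n>0 2 (h * (K + L)))}}) (<⇒≤ Z>))
        (≤-<-trans (*-monoʳ-≤ (2 * L) size) Z>) (near (halved Z 0<X 2Z≤X upper) (halved Z 0<X 2Z≤X lower))) (independent K L 0<K 0<L)
      where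
      Z> : 2 * L * 2 ^ (h * (K + L)) < Z
      Z> = ≰⇒> Z≰
      size : A ^ K * D ^ L ≤ 2 ^ (h * (K + L))
      size = ≤-trans (*-mono-≤ (^≤2^ h K A≤) (^≤2^ h L D≤)) (≤-reflexive (trans (sym (^-distribˡ-+-* 2 (h * K) (h * L))) (cong (2 ^_) (sym (*-distribˡ-+ h K L)))))

  no-downs-absurd : ∀ K X → 0 < K → ¬ Approximates K 0 X
  no-downs-absurd K X 0<K (approximates upper _) = <⇒≱ (^-monoˡ-< K {{>-nonZero 0<K}} B<A)
    (subst₂ _≤_ (trans (+-identityʳ _) (*-identityʳ (A ^ K))) (trans (+-identityʳ _) (*-identityʳ (B ^ K))) upper)

  -- As L ≤ κ′K, also 2ᴸ is at most a fixed power of X, so a large L would admit a `Choice`. Hence L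
  -- is bounded, then K, and then X by Liouville's inequality.
  minimum-bound : ∀ Q → ∃ λ X₀ → ∀ K L X → 0 < K → 0 < X → Approximates K L X → 2 ^ K ≤ X ^ Q → X ≤ X₀
  minimum-bound Q = 4 * D + bound₀ , bound
    where
    κ κ′ ℓ₀ L₀ bound₀ : ℕ
    κ = (2 + h) * B
    κ′ = h * (4 * D)
    ℓ₀ = proj₁ (choice h κ (Q * κ′))
    L₀ = 2 ^ ℓ₀
    -- The value of `trivial-bound` for the largest possible L and K, namely L₀ and κL₀.
    bound₀ = 2 * suc (2 * L₀ * 2 ^ (h * (κ * L₀ + L₀)))
    bound : ∀ K L X → 0 < K → 0 < X → Approximates K L X → 2 ^ K ≤ X ^ Q → X ≤ 4 * D + bound₀
    bound K zero X 0<K 0<X approx _ = contradiction approx (no-downs-absurd K X 0<K)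
    bound K L@(suc _) X 0<K 0<X approx 2^K≤X^Q with 4 * D ≤? X
    ... | no 4D≰X = ≤-trans (<⇒≤ (≰⇒> 4D≰X)) (m≤m+n (4 * D) bound₀)
    ... | yes 4D≤X = ≤-trans (trivial-bound K L X (s≤s z≤n) 0<K approx 0<X) (≤-trans (*-monoʳ-≤ 2 (s≤s (*-mono-≤ (*-monoʳ-≤ 2 L≤L₀) (^-monoʳ-≤ 2 (*-monoʳ-≤ h (+-mono-≤ K≤κL₀ L≤L₀)))))) (m≤n+m bound₀ (4 * D)))
      where
      2^L≤ : 2 ^ L ≤ X ^ (Q * κ′)
      2^L≤ = begin
        2 ^ L               ≤⟨ ^-monoʳ-≤ 2 (L≤ K L X (s≤s z≤n) 0<K approx 4D≤X) ⟩
        2 ^ (κ′ * K)        ≡⟨ trans (cong (2 ^_) (*-comm κ′ K)) (sym (^-*-assoc 2 K κ′)) ⟩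
        (2 ^ K) ^ κ′        ≤⟨ ^-monoˡ-≤ κ′ 2^K≤X^Q ⟩
        (X ^ Q) ^ κ′        ≡⟨ ^-*-assoc X Q κ′ ⟩
        X ^ (Q * κ′)        ∎
        where open ≤-Reasoning
      L≤L₀ : L ≤ L₀
      L≤L₀ with binary-size L (s≤s z≤n)
      ... | ℓ , 2^ℓ≤L , L<2^ with ℓ₀ ≤? ℓ
      ... | yes ℓ₀≤ℓ = contradiction (proj₂ (choice h κ (Q * κ′)) ℓ L K X ℓ₀≤ℓ 2^ℓ≤L L<2^ (K≤ K L X (s≤s z≤n) 0<K approx 0<X) 2^L≤)
                         (no-choice K L X (s≤s z≤n) 0<K approx)
      ... | no ℓ₀≰ℓ = <⇒≤ (<-≤-trans L<2^ (^-monoʳ-≤ 2 (≰⇒> ℓ₀≰ℓ)))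
      K≤κL₀ : K ≤ κ * L₀
      K≤κL₀ = ≤-trans (K≤ K L X (s≤s z≤n) 0<K approx 0<X) (*-monoʳ-≤ κ L≤L₀)

-- Orbits started at their minimum

coprime-* : ∀ {m n o} → Coprime m n → Coprime m o → Coprime m (n * o)
coprime-* {m} {n} {o} mn mo {i} (i∣m , i∣no) = mo (i∣m , coprime-divisor (λ (j∣i , j∣n) → mn (∣-trans j∣i i∣m , j∣n)) i∣no)

coprime-^ʳ : ∀ {m n} k → Coprime m n → Coprime m (n ^ k)
coprime-^ʳ zero mn (_ , i∣1) = ∣1⇒≡1 i∣1
coprime-^ʳ (suc k) mn = coprime-* mn (coprime-^ʳ k mn)

coprime-^ : ∀ {m n} j k → Coprime m n → Coprime (m ^ j) (n ^ k)
coprime-^ j k mn = coprime-^ʳ k (Coprimality.sym (coprime-^ʳ j (Coprimality.sym mn)))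

<ᵇ-true : ∀ {m n} → m < n → (m <ᵇ n) ≡ true
<ᵇ-true {m} {n} m<n with m <ᵇ n | <⇒<ᵇ m<n
... | true | _ = refl

-- The two inequalities of `down` are γy ≤ x + 1 and x ≤ γ(y + 2) with the denominator of γ cleared.
-- Fixed points are allowed here and excluded by `moves` in `Orbit`.
data Step (b d x y : ℕ) : Set where
  up   : ∀ n → x ≡ b * n → y ≡ d * n → Step b d x y
  down : ¬ b ∣ x → y ≤ x →
         b * (d ∸ 1) * y ≤ d * (b ∸ 1) * (x + 1) →
         d * (b ∸ 1) * x ≤ b * (d ∸ 1) * (y + 2) → Step b d x y

localMinimum : ℕ → ℕ → ℕ → Bool
localMinimum u v w = (v <ᵇ u) ∧ (v <ᵇ w)

indicator : Bool → ℕ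
indicator p = if p then 1 else 0

total : (ℕ → ℕ) → ℕ → ℕ
total f zero = 0
total f (suc n) = total f n + f n

-- A closed walk as a function on ℕ, started at its smallest element; a cycle read forward and one
-- read backward both take this form.
record Orbit (b d p : ℕ) (w : ℕ → ℕ) : Set where
  field
    positive : 0 < w 0
    closed   : w p ≡ w 0
    minimal  : ∀ i → i ≤ p → w 0 ≤ w i
    step     : ∀ i → i < p → Step b d (w i) (w (suc i))
    moves    : ∀ i → i < p → w i ≢ w (suc i)

module Walk {b d p : ℕ} {w : ℕ → ℕ} (1<b : 1 < b) (b<d : b < d) (orbit : Orbit b d p w) where
  open Orbit orbit

  A B G D X : ℕ
  A = d
  B = b
  G = b * (d ∸ 1)
  D = d * (b ∸ 1)
  X = w 0

  0<b : 0 < b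
  0<b = <-trans (s≤s z≤n) 1<b

  up-increases : ∀ i n → i < p → w i ≡ b * n → w (suc i) ≡ d * n → w i < w (suc i)
  up-increases i zero i<p x≡ y≡ = contradiction (trans x≡ (trans (*-zeroʳ b) (sym (trans y≡ (*-zeroʳ d))))) (moves i i<p)
  up-increases i n@(suc _) i<p x≡ y≡ = subst₂ _<_ (sym x≡) (sym y≡) (*-monoˡ-< n b<d)

  -- If b divided d, each up step would land on a multiple of b and force another one. The first
  -- step from the minimum goes up, so the walk would keep rising and never close.
  b∤d : 0 < p → ¬ b ∣ d
  b∤d 0<p b∣d = <⇒≢ (proj₂ (all-up p ≤-refl) 0<p) (sym closed)
    where
    all-up : ∀ n → n ≤ p → (0 < n → b ∣ w n) × (0 < n → w 0 < w n)
    all-up zero _ = (λ ()) , (λ ())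
    all-up (suc zero) n≤p with step 0 n≤p
    ... | up n x≡ y≡ = (λ _ → subst (b ∣_) (sym y≡) (∣m⇒∣m*n n b∣d)) , (λ _ → up-increases 0 n n≤p x≡ y≡)
    ... | down _ y≤x _ _ = contradiction (≤-antisym (minimal 1 n≤p) y≤x) (moves 0 n≤p)
    all-up (suc n@(suc _)) n<p with all-up n (<⇒≤ n<p) | step n n<p
    ... | _ , inc | up m x≡ y≡ = (λ _ → subst (b ∣_) (sym y≡) (∣m⇒∣m*n m b∣d)) , (λ _ → <-trans (inc (s≤s z≤n)) (up-increases n m n<p x≡ y≡))
    ... | div , _ | down b∤x _ _ _ = contradiction (div (s≤s z≤n)) b∤x

  starts : ℕ → ℕ
  -- The global minimum counts as the start of a run without inspection of its predecessor, which
  -- has no index in ℕ.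
  starts zero = 1
  starts (suc i) = indicator (localMinimum (w i) (w (suc i)) (w (suc (suc i))))

  runs : ℕ → ℕ
  runs = total starts

  -- Void at index 0, where `starts` is 1 by definition.
  Fell : ℕ → Set
  Fell zero = ⊤
  Fell (suc i) = w (suc i) < w i

  starts-run : ∀ n → Fell n → w n < w (suc n) → starts n ≡ 1
  starts-run zero _ _ = refl
  starts-run (suc i) fell rise rewrite <ᵇ-true fell | <ᵇ-true rise = refl

  gcd≢0 : NonZero (gcd b d)
  gcd≢0 = ≢-nonZero (gcd[m,n]≢0 b d (inj₁ (>⇒≢ 0<b)))

  β δ q : ℕ
  β = _/_ b (gcd b d) {{gcd≢0}}
  δ = _/_ d (gcd b d) {{gcd≢0}}
  q = suc d

  β*g≡b : β * gcd b d ≡ b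
  β*g≡b = m/n*n≡m {{gcd≢0}} (gcd[m,n]∣m b d)

  δ*g≡d : δ * gcd b d ≡ d
  δ*g≡d = m/n*n≡m {{gcd≢0}} (gcd[m,n]∣n b d)

  β⊥δ : Coprime β δ
  β⊥δ = coprime-/gcd b d {{gcd≢0}}

  module _ (0<p : 0 < p) where
    2≤β : 2 ≤ β
    2≤β with β in eq
    ... | zero = contradiction (trans (sym (cong (_* gcd b d) eq)) β*g≡b) (<⇒≢ 0<b)
    ... | suc zero = contradiction (subst (_∣ d) (trans (sym (+-identityʳ _)) (trans (sym (cong (_* gcd b d) eq)) β*g≡b)) (gcd[m,n]∣n b d)) (b∤d 0<p)
    ... | suc (suc _) = s≤s (s≤s z≤n)

    -- k consecutive ups starting from z force βᵏ ∣ z.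
    run-length : ∀ k {y z} → 0 < z → β ^ k * y ≡ δ ^ k * z → 2 ^ k ≤ z
    run-length k {y} {z} 0<z eq = ≤-trans (^-monoˡ-≤ k 2≤β) (∣⇒≤ {{>-nonZero 0<z}}
      (coprime-divisor (coprime-^ k k β⊥δ) (subst (β ^ k ∣_) eq (m∣m*n y))))

    run-height : ∀ k {y z} → 0 < z → β ^ k * y ≡ δ ^ k * z → y ≤ z ^ q
    run-height k {y} {z} 0<z eq = begin
      y                  ≤⟨ m≤n*m y (β ^ k) {{>-nonZero (0<^ k (≤-trans (s≤s z≤n) 2≤β))}} ⟩
      β ^ k * y          ≡⟨ eq ⟩
      δ ^ k * z          ≤⟨ *-monoˡ-≤ z (^-monoˡ-≤ k (≤-trans (m/n≤m d (gcd b d) {{gcd≢0}}) (<⇒≤ (n<2^n d)))) ⟩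
      (2 ^ d) ^ k * z    ≡⟨ cong (_* z) (^-comm 2 d k) ⟩
      (2 ^ k) ^ d * z    ≤⟨ *-monoˡ-≤ z (^-monoˡ-≤ d (run-length k 0<z eq)) ⟩
      z ^ d * z          ≡⟨ *-comm (z ^ d) z ⟩
      z ^ q              ∎
      where open ≤-Reasoning

    -- With c finished runs of ups charged, the height is at most X^(q^c), since a run raises the
    -- exponent at most by the factor q, and each run adds to K at most log₂ of its starting value.
    -- Within a run the start `z` is remembered, because divisibility of `z` bounds the run as a
    -- whole.
    data Phase (n K : ℕ) : Set where
      descending : ∀ c → c ≤ runs n → Fell n → w n ≤ X ^ (q ^ c) → 2 ^ K ≤ X ^ (c * q ^ c) → Phase n K
      ascending  : ∀ c K′ k z → suc c ≤ runs n → 0 < z → K ≡ K′ + k → β ^ k * w n ≡ δ ^ k * z →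
                   z ≤ X ^ (q ^ c) → 2 ^ K′ ≤ X ^ (c * q ^ c) → Phase n K

    ascending-bounds : ∀ {n K} c K′ k z → 0 < z → K ≡ K′ + k → β ^ k * w n ≡ δ ^ k * z →
      z ≤ X ^ (q ^ c) → 2 ^ K′ ≤ X ^ (c * q ^ c) → w n ≤ X ^ (q ^ suc c) × 2 ^ K ≤ X ^ (suc c * q ^ suc c)
    ascending-bounds {n} {K} c K′ k z 0<z refl eq z≤ 2^K′≤ = height , length
      where
      open ≤-Reasoning
      height : w n ≤ X ^ (q ^ suc c)
      height = begin
        w n                  ≤⟨ run-height k 0<z eq ⟩
        z ^ q                ≤⟨ ^-monoˡ-≤ q z≤ ⟩
        (X ^ (q ^ c)) ^ q    ≡⟨ trans (^-*-assoc X (q ^ c) q) (cong (X ^_) (*-comm (q ^ c) q)) ⟩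
        X ^ (q ^ suc c)      ∎
      length : 2 ^ K ≤ X ^ (suc c * q ^ suc c)
      length = begin
        2 ^ (K′ + k)                        ≡⟨ ^-distribˡ-+-* 2 K′ k ⟩
        2 ^ K′ * 2 ^ k                      ≤⟨ *-mono-≤ 2^K′≤ (≤-trans (run-length k 0<z eq) z≤) ⟩
        X ^ (c * q ^ c) * X ^ (q ^ c)       ≡⟨ trans (*-comm (X ^ (c * q ^ c)) _) (sym (^-distribˡ-+-* X (q ^ c) (c * q ^ c))) ⟩
        X ^ (suc c * q ^ c)                 ≤⟨ ^-mono-exponent positive (*-monoʳ-≤ (suc c) (m≤n*m (q ^ c) q)) ⟩
        X ^ (suc c * q ^ suc c)             ∎

    Bounds : ℕ → ℕ → ℕ → Set
    Bounds c n K = w n ≤ X ^ (q ^ c) × 2 ^ K ≤ X ^ (c * q ^ c)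

    phase-bounds : ∀ {n K} → Phase n K → Bounds (runs n) n K
    phase-bounds {n} {K} = λ where
        (descending c c≤ _ w≤ 2^K≤) → weaken c≤ (w≤ , 2^K≤)
        (ascending c K′ k z c≤ 0<z K≡ eq z≤ 2^K′≤) → weaken c≤ (ascending-bounds c K′ k z 0<z K≡ eq z≤ 2^K′≤)
      where
      weaken : ∀ {c} → c ≤ runs n → Bounds c n K → Bounds (runs n) n K
      weaken c≤ (height , length) = ≤-trans height (^-mono-exponent positive (^-monoʳ-≤ q c≤)) ,
        ≤-trans length (^-mono-exponent positive (*-mono-≤ c≤ (^-monoʳ-≤ q c≤)))

    -- `upper` and `lower` say that `w n` is Xαᴷ/γᴸ up to a factor (1 + 2/X)ᴸ in either direction.
    -- `rises` remembers that the first step goes up.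
    record State (n : ℕ) : Set where
      field
        K L : ℕ
        upper : X ^ L * (A ^ K * D ^ L) * X ≤ (X + 2) ^ L * (B ^ K * G ^ L) * w n
        lower : X ^ L * (B ^ K * G ^ L) * w n ≤ (X + 2) ^ L * (A ^ K * D ^ L) * X
        rises : 0 < n → 0 < K
        phase : Phase n K

    initial : State 0
    initial = record
      { K = 0 ; L = 0 ; upper = ≤-refl ; lower = ≤-refl ; rises = λ ()
      ; phase = descending 0 z≤n tt (≤-reflexive (sym (^-identityʳ X))) ≤-refl }

    private
      pull-A : ∀ x a d y α → x * (α * a * d) * y ≡ α * (x * (a * d) * y)
      pull-A = solve-∀
      push-w : ∀ x e y α → α * (x * e * y) ≡ x * e * (α * y)
      push-w = solve-∀

    advance-up : ∀ n → n < p → State n → ∀ m → w n ≡ b * m → w (suc n) ≡ d * m → State (suc n)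
    advance-up n n<p st m x≡ y≡ = record
      { K = suc K ; L = L
      ; upper = begin
          X ^ L * (A ^ suc K * D ^ L) * X                       ≡⟨ pull-A (X ^ L) (A ^ K) (D ^ L) X A ⟩
          A * (X ^ L * (A ^ K * D ^ L) * X)                     ≤⟨ *-monoʳ-≤ A upper ⟩
          A * ((X + 2) ^ L * (B ^ K * G ^ L) * w n)             ≡⟨ move ((X + 2) ^ L) ⟩
          (X + 2) ^ L * (B ^ suc K * G ^ L) * w (suc n)         ∎
      ; lower = begin
          X ^ L * (B ^ suc K * G ^ L) * w (suc n)               ≡⟨ move (X ^ L) ⟨
          A * (X ^ L * (B ^ K * G ^ L) * w n)                   ≤⟨ *-monoʳ-≤ A lower ⟩
          A * ((X + 2) ^ L * (A ^ K * D ^ L) * X)               ≡⟨ pull-A ((X + 2) ^ L) (A ^ K) (D ^ L) X A ⟨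
          (X + 2) ^ L * (A ^ suc K * D ^ L) * X                 ∎
      ; rises = λ _ → s≤s z≤n
      ; phase = next phase }
      where
      open State st
      open ≤-Reasoning
      ratio : A * w n ≡ B * w (suc n)
      ratio = trans (cong (d *_) x≡) (trans (x∙yz≈y∙xz d b m) (cong (b *_) (sym y≡)))
      move : ∀ x → A * (x * (B ^ K * G ^ L) * w n) ≡ x * (B ^ suc K * G ^ L) * w (suc n)
      move x = begin-equality
        A * (x * (B ^ K * G ^ L) * w n)              ≡⟨ push-w x (B ^ K * G ^ L) (w n) A ⟩
        x * (B ^ K * G ^ L) * (A * w n)              ≡⟨ cong (x * (B ^ K * G ^ L) *_) ratio ⟩
        x * (B ^ K * G ^ L) * (B * w (suc n))        ≡⟨ push-w x (B ^ K * G ^ L) (w (suc n)) B ⟨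
        B * (x * (B ^ K * G ^ L) * w (suc n))        ≡⟨ pull-A x (B ^ K) (G ^ L) (w (suc n)) B ⟨
        x * (B ^ suc K * G ^ L) * w (suc n)          ∎
      reduced : β * w (suc n) ≡ δ * w n
      reduced = *-cancelʳ-≡ _ _ (gcd b d) {{gcd≢0}} (begin-equality
        β * w (suc n) * gcd b d        ≡⟨ xy∙z≈xz∙y β (w (suc n)) (gcd b d) ⟩
        β * gcd b d * w (suc n)        ≡⟨ cong (_* w (suc n)) β*g≡b ⟩
        b * w (suc n)                  ≡⟨ ratio ⟨
        d * w n                        ≡⟨ cong (_* w n) δ*g≡d ⟨
        δ * gcd b d * w n              ≡⟨ xy∙z≈xz∙y δ (w n) (gcd b d) ⟨
        δ * w n * gcd b d              ∎)
      extend : ∀ k z → β ^ k * w n ≡ δ ^ k * z → β ^ suc k * w (suc n) ≡ δ ^ suc k * z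
      extend k z eq = begin-equality
        β * β ^ k * w (suc n)          ≡⟨ xy∙z≈y∙xz β (β ^ k) (w (suc n)) ⟩
        β ^ k * (β * w (suc n))        ≡⟨ cong (β ^ k *_) reduced ⟩
        β ^ k * (δ * w n)              ≡⟨ x∙yz≈y∙xz (β ^ k) δ (w n) ⟩
        δ * (β ^ k * w n)              ≡⟨ cong (δ *_) eq ⟩
        δ * (δ ^ k * z)                ≡⟨ *-assoc δ (δ ^ k) z ⟨
        δ * δ ^ k * z                  ∎
      next : Phase n K → Phase (suc n) (suc K)
      next (descending c c≤ fell w≤ 2^K≤) = ascending c K 1 (w n)
        -- An up step after a descent makes n a start, and this pays for the run that begins.
        (subst (suc c ≤_) (trans (+-comm 1 (runs n)) (cong (runs n +_) (sym (starts-run n fell (up-increases n m n<p x≡ y≡))))) (s≤s c≤))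
        (<-≤-trans positive (minimal n (<⇒≤ n<p))) (+-comm 1 K) (extend 0 (w n) refl) w≤ 2^K≤
      next (ascending c K′ k z c≤ 0<z K≡ eq z≤ 2^K′≤) = ascending c K′ (suc k) z (≤-trans c≤ (m≤m+n (runs n) (starts n))) 0<z
        (trans (cong suc K≡) (sym (+-suc K′ k))) (extend k z eq) z≤ 2^K′≤

    -- The absolute errors 1 and 2 of a down step turn into the relative error 2/X because every
    -- element of the walk is at least X.
    advance-down : ∀ n → n < p → State n → w (suc n) ≤ w n →
      G * w (suc n) ≤ D * (w n + 1) → D * w n ≤ G * (w (suc n) + 2) → State (suc n)
    advance-down n n<p st y≤x Gy≤ Dx≤ = record
      { K = K ; L = suc L
      ; upper = begin
          X ^ suc L * (A ^ K * D ^ suc L) * X                       ≡⟨ extract X (X ^ L) (A ^ K) D (D ^ L) X ⟩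
          X * D * (X ^ L * (A ^ K * D ^ L) * X)                     ≤⟨ *-monoʳ-≤ (X * D) upper ⟩
          X * D * ((X + 2) ^ L * (B ^ K * G ^ L) * w n)             ≡⟨ x∙yz≈y∙xz (X * D) ((X + 2) ^ L * (B ^ K * G ^ L)) (w n) ⟩
          (X + 2) ^ L * (B ^ K * G ^ L) * (X * D * w n)             ≤⟨ *-monoʳ-≤ ((X + 2) ^ L * (B ^ K * G ^ L)) D-step ⟩
          (X + 2) ^ L * (B ^ K * G ^ L) * ((X + 2) * G * w (suc n)) ≡⟨ x∙yz≈y∙xz ((X + 2) * G) ((X + 2) ^ L * (B ^ K * G ^ L)) (w (suc n)) ⟨
          (X + 2) * G * ((X + 2) ^ L * (B ^ K * G ^ L) * w (suc n)) ≡⟨ extract (X + 2) ((X + 2) ^ L) (B ^ K) G (G ^ L) (w (suc n)) ⟨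
          (X + 2) ^ suc L * (B ^ K * G ^ suc L) * w (suc n)         ∎
      ; lower = begin
          X ^ suc L * (B ^ K * G ^ suc L) * w (suc n)               ≡⟨ extract X (X ^ L) (B ^ K) G (G ^ L) (w (suc n)) ⟩
          X * G * (X ^ L * (B ^ K * G ^ L) * w (suc n))             ≡⟨ x∙yz≈y∙xz (X * G) (X ^ L * (B ^ K * G ^ L)) (w (suc n)) ⟩
          X ^ L * (B ^ K * G ^ L) * (X * G * w (suc n))             ≤⟨ *-monoʳ-≤ (X ^ L * (B ^ K * G ^ L)) G-step ⟩
          X ^ L * (B ^ K * G ^ L) * ((X + 2) * D * w n)             ≡⟨ x∙yz≈y∙xz ((X + 2) * D) (X ^ L * (B ^ K * G ^ L)) (w n) ⟨
          (X + 2) * D * (X ^ L * (B ^ K * G ^ L) * w n)             ≤⟨ *-monoʳ-≤ ((X + 2) * D) lower ⟩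
          (X + 2) * D * ((X + 2) ^ L * (A ^ K * D ^ L) * X)         ≡⟨ extract (X + 2) ((X + 2) ^ L) (A ^ K) D (D ^ L) X ⟨
          (X + 2) ^ suc L * (A ^ K * D ^ suc L) * X                 ∎
      ; rises = λ _ → risen n n<p y≤x rises
      ; phase = next phase }
      where
      open State st
      open ≤-Reasoning
      extract : ∀ x xl a g gl y → x * xl * (a * (g * gl)) * y ≡ x * g * (xl * (a * gl) * y)
      extract = solve-∀
      X≤y : X ≤ w (suc n)
      X≤y = minimal (suc n) n<p
      X≤x : X ≤ w n
      X≤x = minimal n (<⇒≤ n<p)
      slide : ∀ x y → x ≤ 2 * y → x * (y + 1) ≤ (x + 2) * y
      slide x y x≤2y = begin
        x * (y + 1)       ≡⟨ expand₁ x y ⟩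
        x * y + x         ≤⟨ +-monoʳ-≤ (x * y) x≤2y ⟩
        x * y + 2 * y     ≡⟨ *-distribʳ-+ y x 2 ⟨
        (x + 2) * y       ∎
        where
        expand₁ : ∀ x y → x * (y + 1) ≡ x * y + x
        expand₁ = solve-∀
      D-step : X * D * w n ≤ (X + 2) * G * w (suc n)
      D-step = begin
        X * D * w n                      ≡⟨ *-assoc X D (w n) ⟩
        X * (D * w n)                    ≤⟨ *-monoʳ-≤ X Dx≤ ⟩
        X * (G * (w (suc n) + 2))        ≡⟨ expand X G (w (suc n)) ⟩
        G * (X * w (suc n) + 2 * X)      ≤⟨ *-monoʳ-≤ G (+-monoʳ-≤ (X * w (suc n)) (*-monoʳ-≤ 2 X≤y)) ⟩
        G * (X * w (suc n) + 2 * w (suc n)) ≡⟨ collect X G (w (suc n)) ⟩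
        (X + 2) * G * w (suc n)          ∎
        where
        expand : ∀ x g y → x * (g * (y + 2)) ≡ g * (x * y + 2 * x)
        expand = solve-∀
        collect : ∀ x g y → g * (x * y + 2 * y) ≡ (x + 2) * g * y
        collect = solve-∀
      G-step : X * G * w (suc n) ≤ (X + 2) * D * w n
      G-step = begin
        X * G * w (suc n)                ≡⟨ *-assoc X G (w (suc n)) ⟩
        X * (G * w (suc n))              ≤⟨ *-monoʳ-≤ X Gy≤ ⟩
        X * (D * (w n + 1))              ≡⟨ x∙yz≈y∙xz X D (w n + 1) ⟩
        D * (X * (w n + 1))              ≤⟨ *-monoʳ-≤ D (slide X (w n) (≤-trans X≤x (m≤n*m (w n) 2))) ⟩
        D * ((X + 2) * w n)              ≡⟨ x∙yz≈yx∙z D (X + 2) (w n) ⟩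
        (X + 2) * D * w n                ∎
      risen : ∀ n → n < p → w (suc n) ≤ w n → (0 < n → 0 < K) → 0 < K
      risen zero n<p y≤x _ = contradiction (≤-antisym (minimal 1 n<p) y≤x) (moves 0 n<p)
      risen (suc n) _ _ rises = rises (s≤s z≤n)
      fell : w (suc n) < w n
      fell = ≤∧≢⇒< y≤x (λ eq → moves n n<p (sym eq))
      grow : runs n ≤ runs (suc n)
      grow = m≤m+n (runs n) (starts n)
      next : Phase n K → Phase (suc n) K
      next (descending c c≤ _ w≤ 2^K≤) = descending c (≤-trans c≤ grow) fell (≤-trans y≤x w≤) 2^K≤
      next (ascending c K′ k z c≤ 0<z K≡ eq z≤ 2^K′≤) with ascending-bounds {n} c K′ k z 0<z K≡ eq z≤ 2^K′≤
      ... | w≤ , 2^K≤ = descending (suc c) (≤-trans c≤ grow) fell (≤-trans y≤x w≤) 2^K≤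

    states : ∀ n → n ≤ p → State n
    states zero _ = initial
    states (suc n) n<p with step n n<p
    ... | up m x≡ y≡ = advance-up n n<p (states n (<⇒≤ n<p)) m x≡ y≡
    ... | down _ y≤x Gy≤ Dx≤ = advance-down n n<p (states n (<⇒≤ n<p)) y≤x Gy≤ Dx≤

    runs-mono : ∀ {m n} → m ≤ n → runs m ≤ runs n
    runs-mono {m} {n} m≤n = subst (λ k → runs m ≤ runs k) (m+[n∸m]≡n m≤n) (go m (n ∸ m))
      where
      go : ∀ m k → runs m ≤ runs (m + k)
      go m zero = ≤-reflexive (cong runs (sym (+-identityʳ m)))
      go m (suc k) = ≤-trans (go m k) (≤-trans (m≤m+n (runs (m + k)) (starts (m + k))) (≤-reflexive (cong runs (sym (+-suc m k)))))

    height : ∀ n → n ≤ p → w n ≤ X ^ (q ^ runs p)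
    height n n≤p = ≤-trans (proj₁ (phase-bounds (State.phase (states n n≤p)))) (^-mono-exponent positive (^-monoʳ-≤ q (runs-mono n≤p)))

    -- At n = p the walk is back at X, which cancels and leaves αᴷ against γᴸ.
    cycle-equation : ∃₂ λ K L → 0 < K × 2 ^ K ≤ X ^ (runs p * q ^ runs p) ×
      X ^ L * (A ^ K * D ^ L) ≤ (X + 2) ^ L * (B ^ K * G ^ L) × X ^ L * (B ^ K * G ^ L) ≤ (X + 2) ^ L * (A ^ K * D ^ L)
    cycle-equation = K , L , rises 0<p , proj₂ (phase-bounds phase) , cancel (subst (λ y → X ^ L * (A ^ K * D ^ L) * X ≤ (X + 2) ^ L * (B ^ K * G ^ L) * y) closed upper) ,
      cancel (subst (λ y → X ^ L * (B ^ K * G ^ L) * y ≤ (X + 2) ^ L * (A ^ K * D ^ L) * X) closed lower)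
      where
      open State (states p ≤-refl)
      cancel : ∀ {u v} → u * X ≤ v * X → u ≤ v
      cancel {u} {v} = *-cancelʳ-≤ u v X {{>-nonZero positive}}

open import Defs
open import Data.List.Base using (List; []; _∷_; length; filter; filterᵇ; applyUpTo; upTo; concatMap; cartesianProductWith)
open import Data.List.Properties using (filter-accept; filter-reject)
open import Data.List.Membership.Propositional using (_∈_; lose)
open import Data.List.Membership.Propositional.Properties using (∈-upTo⁺; ∈-cartesianProductWith⁺; ∈-concatMap⁺; ∈-filter⁺; ∈-filter⁻)
open import Data.List.Relation.Unary.All using (All; []; _∷_)
open import Data.List.Relation.Unary.AllPairs using ([]; _∷_)
open import Data.List.Relation.Unary.Any using (here)
open import Data.List.Relation.Unary.Unique.Propositional using (Unique)
open import Data.List.Relation.Unary.Unique.DecPropositional _≟_ using (unique?)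

-- The permutation P(a,b,c,d) and its cycles

-- q · #{non-multiples of q in [1, r]} = (q − 1) r + (r mod q), and i is the number of non-multiples before r.
nth-nonMultiple : ∀ q′ n (f : ℕ → ℕ) m a e → (∀ j → f j ≡ suc (m + j)) → m ≡ suc q′ * a + e → e < suc q′ → ∀ {i r} →
  Nth (filter (λ x → ¬? (suc q′ ∣? x)) (applyUpTo f n)) i r →
  ∃ λ ε → 0 < ε × ε ≤ q′ × ¬ suc q′ ∣ r × suc q′ * suc i + (q′ * m + e) ≡ q′ * r + ε
nth-nonMultiple q′ (suc n) f m a e f≡ m≡ (s≤s e≤q′) {i} {r} nth with suc q′ ∣? f 0 | e <? q′
-- `suc q′` divides m + 1 exactly when e = q′; the two inconsistent combinations are disposed of
-- first.
... | yes q∣f0 | yes e<q′ = contradiction (∣⇒≤ (∣m+n∣m⇒∣n (subst (suc q′ ∣_)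
    (trans (f≡ 0) (trans (cong suc (trans (+-identityʳ m) m≡)) (sym (+-suc (suc q′ * a) e)))) q∣f0) (m∣m*n a))) (<⇒≱ (s≤s e<q′))
... | no q∤f0 | no e≮q′ = contradiction (subst (suc q′ ∣_) (sym (trans (f≡ 0) (trans (cong suc (trans (+-identityʳ m)
    (trans m≡ (cong (suc q′ * a +_) (≤-antisym e≤q′ (≮⇒≥ e≮q′)))))) (wrap q′ a)))) (m∣m*n (suc a))) q∤f0
  where
  wrap : ∀ e a → suc (suc e * a + e) ≡ suc e * suc a
  wrap = solve-∀
... | yes q∣f0 | no e≮q′
  with nth-nonMultiple q′ n (f ∘ suc) (suc m) (suc a) 0 (λ j → trans (f≡ (suc j)) (cong suc (+-suc m j)))
         (trans (cong suc (trans m≡ (cong (suc q′ * a +_) (≤-antisym e≤q′ (≮⇒≥ e≮q′))))) (wrap q′ a)) (s≤s z≤n)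
         (subst (λ l → Nth l i r) (filter-reject (λ x → ¬? (suc q′ ∣? x)) (λ q∤f0 → q∤f0 q∣f0)) nth)
  where
  wrap : ∀ e a → suc (suc e * a + e) ≡ suc e * suc a + 0
  wrap = solve-∀
... | ε , 0<ε , ε≤ , q∤r , eq = ε , 0<ε , ε≤ , q∤r ,
    trans (cong (suc q′ * suc i +_) (trans (cong (q′ * m +_) (≤-antisym e≤q′ (≮⇒≥ e≮q′))) (rank q′ m))) eq
  where
  rank : ∀ e m → e * m + e ≡ e * suc m + 0
  rank = solve-∀
nth-nonMultiple q′ (suc n) f m a e f≡ m≡ (s≤s e≤q′) nth | no q∤f0 | yes e<q′ =
  first-or-later (subst (λ l → Nth l _ _) (filter-accept (λ x → ¬? (suc q′ ∣? x)) q∤f0) nth)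
  where
  rank₀ : ∀ q m e → suc q * 1 + (q * m + e) ≡ q * suc m + suc e
  rank₀ = solve-∀
  rank : ∀ q i m e → suc q * suc (suc i) + (q * m + e) ≡ suc q * suc i + (q * suc m + suc e)
  rank = solve-∀
  first-or-later : ∀ {i r} → Nth (f 0 ∷ filter (λ x → ¬? (suc q′ ∣? x)) (applyUpTo (f ∘ suc) n)) i r →
    ∃ λ ε → 0 < ε × ε ≤ q′ × ¬ suc q′ ∣ r × suc q′ * suc i + (q′ * m + e) ≡ q′ * r + ε
  first-or-later here = suc e , s≤s z≤n , e<q′ , q∤f0 ,
    trans (rank₀ q′ m e) (cong (λ r → q′ * r + suc e) (sym (trans (f≡ 0) (cong suc (+-identityʳ m)))))
  first-or-later (there {i = i} nth) with nth-nonMultiple q′ n (f ∘ suc) (suc m) a (suc e) (λ j → trans (f≡ (suc j)) (cong suc (+-suc m j)))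
                                 (trans (cong suc m≡) (sym (+-suc (suc q′ * a) e))) (s≤s e<q′) nth
  ... | ε , 0<ε , ε≤ , q∤r , eq = ε , 0<ε , ε≤ , q∤r , trans (rank q′ i m e) eq

nonMultiples-rank : ∀ k q {i r} → 0 < q → Nth (nonMultiples k q) i r →
  ∃ λ ε → 0 < ε × ε ≤ q ∸ 1 × ¬ q ∣ r × q * suc i ≡ (q ∸ 1) * r + ε
nonMultiples-rank k (suc q′) {i} _ nth with nth-nonMultiple q′ (k * suc q′ ∸ 1) suc 0 0 0 (λ j → refl) (sym (trans (+-identityʳ _) (*-zeroʳ (suc q′)))) (s≤s z≤n) nth
... | ε , 0<ε , ε≤ , q∤r , eq = ε , 0<ε , ε≤ , q∤r , trans (sym (trans (cong (suc q′ * suc i +_) (trans (+-identityʳ _) (*-zeroʳ q′))) (+-identityʳ _))) eq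

P-sym : ∀ {a b c d x y} → P a b c d x y → P c d a b y x
P-sym (inj₁ (n , x≡ , y≡)) = inj₁ (n , y≡ , x≡)
P-sym (inj₂ (n , i , r , s , nr , ns , x≡ , y≡)) = inj₂ (n , i , s , r , ns , nr , y≡ , x≡)

-- r and s have the same index i, so the rank formulas for r, times d, and for s, times b, both
-- express bd(i + 1). The hypothesis on a and c matches the multiples abn and cdn in the same way.
-- Only the residues ε and ε′ remain as errors.
P⇒Step : ∀ {a b c d x y} → 0 < b → b ≤ d → a * (b ∸ 1) ≡ c * (d ∸ 1) → P a b c d x y → Step b d x y
P⇒Step _ _ _ (inj₁ (n , x≡ , y≡)) = up n x≡ y≡
P⇒Step {a} {suc b} {c} {suc d} {x} {y} 0<b b≤d N≡ (inj₂ (n , i , r , s , nr , ns , refl , refl))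
  with nonMultiples-rank a (suc b) 0<b nr | nonMultiples-rank c (suc d) (s≤s z≤n) ns
... | ε , 0<ε , ε≤b , b∤r , eqr | ε′ , 0<ε′ , ε′≤d , _ , eqs =
  down (λ b∣x → b∤r (∣m+n∣m⇒∣n b∣x (∣m⇒∣m*n n (n∣m*n a)))) y≤x Gy≤ Dx≤
  where
  open ≤-Reasoning
  G D : ℕ
  G = suc b * d
  D = suc d * b
  expand : ∀ b d a n r ε → suc d * b * (a * suc b * n + r) + suc d * ε ≡ suc b * suc d * (a * b * n) + suc d * (b * r + ε)
  expand = solve-∀
  balance : D * x + suc d * ε ≡ G * y + suc b * ε′
  balance = begin-equality
    D * x + suc d * ε                                                 ≡⟨ expand b d a n r ε ⟩
    suc b * suc d * (a * b * n) + suc d * (b * r + ε)                 ≡⟨ cong₂ (λ u v → suc b * suc d * (u * n) + suc d * v) N≡ (sym eqr) ⟩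
    suc b * suc d * (c * d * n) + suc d * (suc b * suc i)             ≡⟨ cong₂ _+_ (cong (_* (c * d * n)) (*-comm (suc b) (suc d))) (x∙yz≈y∙xz (suc d) (suc b) (suc i)) ⟩
    suc d * suc b * (c * d * n) + suc b * (suc d * suc i)             ≡⟨ cong (λ v → suc d * suc b * (c * d * n) + suc b * v) eqs ⟩
    suc d * suc b * (c * d * n) + suc b * (d * s + ε′)                ≡⟨ expand d b c n s ε′ ⟨
    G * y + suc b * ε′                                                ∎
  Gy+b≤ : G * y + suc b ≤ D * (x + 1)
  Gy+b≤ = begin
    G * y + suc b            ≤⟨ +-monoʳ-≤ (G * y) (m≤m*n (suc b) ε′ {{>-nonZero 0<ε′}}) ⟩
    G * y + suc b * ε′       ≡⟨ balance ⟨
    D * x + suc d * ε        ≤⟨ +-monoʳ-≤ (D * x) (*-monoʳ-≤ (suc d) ε≤b) ⟩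
    D * x + D                ≡⟨ cong (D * x +_) (*-identityʳ D) ⟨
    D * x + D * 1            ≡⟨ *-distribˡ-+ D x 1 ⟨
    D * (x + 1)              ∎
  Gy≤ : G * y ≤ D * (x + 1)
  Gy≤ = ≤-trans (m≤m+n (G * y) (suc b)) Gy+b≤
  Dx≤ : D * x ≤ G * (y + 2)
  Dx≤ = begin
    D * x                    ≤⟨ m≤m+n (D * x) (suc d * ε) ⟩
    D * x + suc d * ε        ≡⟨ balance ⟩
    G * y + suc b * ε′       ≤⟨ +-monoʳ-≤ (G * y) (*-monoʳ-≤ (suc b) ε′≤d) ⟩
    G * y + G                ≤⟨ +-monoʳ-≤ (G * y) (m≤m*n G 2) ⟩
    G * y + G * 2            ≡⟨ *-distribˡ-+ G y 2 ⟨
    G * (y + 2)              ∎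
  D≤G : D ≤ G
  D≤G = begin
    suc d * b        ≡⟨⟩
    b + d * b        ≤⟨ +-monoˡ-≤ (d * b) (≤-pred b≤d) ⟩
    d + d * b        ≡⟨ trans (sym (*-suc d b)) (*-comm d (suc b)) ⟩
    suc b * d        ∎
  y≤x : y ≤ x
  y≤x with y ≤? x
  ... | yes y≤x = y≤x
  -- The summand `suc b`, present because ε′ ≥ 1, rules out y ≥ x + 1, where D ≤ G would give D(x +
  -- 1) ≤ Gy.
  ... | no y≰x = contradiction (begin
    G * y + suc b      ≤⟨ Gy+b≤ ⟩
    D * (x + 1)        ≤⟨ *-mono-≤ D≤G (≤-trans (≤-reflexive (+-comm x 1)) (≰⇒> y≰x)) ⟩
    G * y              ∎) (m+1+n≰m (G * y))

-- Gathering powers turns equality into d^(r+s) (b - 1)ˢ = b^(r+s) (d - 1)ˢ. As d is coprime to d -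
-- 1, d^(r+s) would divide the smaller number b^(r+s).
multiplicatively-independent : ∀ {b d} → 1 < b → b < d → ∀ r s → 0 < r → 0 < s → d ^ r * (d * (b ∸ 1)) ^ s ≢ b ^ r * (b * (d ∸ 1)) ^ s
multiplicatively-independent {b} {d@(suc d′)} 1<b b<d r s 0<r 0<s eq = <⇒≱ (^-monoˡ-< (r + s) {{>-nonZero (≤-trans 0<r (m≤m+n r s))}} b<d)
  (∣⇒≤ {{>-nonZero (0<^ (r + s) (<-trans (s≤s z≤n) 1<b))}} divides-power)
  where
  gather : ∀ u v → u ^ r * (u * v) ^ s ≡ u ^ (r + s) * v ^ s
  gather u v = trans (cong (u ^ r *_) (^-distribʳ-* u v s)) (trans (sym (*-assoc (u ^ r) (u ^ s) (v ^ s))) (cong (_* v ^ s) (sym (^-distribˡ-+-* u r s))))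
  coprime : Coprime d d′
  coprime = subst (λ k → Coprime k d′) (+-comm d′ 1) (coprime-+ (1-coprimeTo d′))
  divides-power : d ^ (r + s) ∣ b ^ (r + s)
  divides-power = coprime-divisor {n = d′ ^ s} (coprime-^ (r + s) s coprime) (subst (d ^ (r + s) ∣_)
    (trans (sym (gather d (b ∸ 1))) (trans eq (trans (gather b d′) (*-comm (b ^ (r + s)) (d′ ^ s))))) (m∣m*n ((b ∸ 1) ^ s)))

-- c(d + 1)^c is the exponent Q in 2ᴷ ≤ X^Q for at most c runs. Once the minimum is bounded,
-- `height` bounds all elements.
orbit-bound : ∀ {b d} (1<b : 1 < b) (b<d : b < d) c → ∃ λ N → ∀ p w (orbit : Orbit b d p w) → 0 < p →
  Walk.runs 1<b b<d orbit p ≤ c → ∀ n → n ≤ p → w n ≤ N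
orbit-bound {b} {d@(suc d′)} 1<b b<d c = from (minimum-bound (c * suc d ^ c))
  where
  0<b : 0 < b
  0<b = <-trans (s≤s z≤n) 1<b
  G D h : ℕ
  G = b * d′
  D = d * (b ∸ 1)
  -- Crude: each of the four numbers is at most `h`, and h ≤ 2ʰ.
  h = d + b + G + D
  0<D : 0 < D
  0<D = *-mono-≤ {1} {d} (s≤s z≤n) (m<n⇒0<n∸m 1<b)
  D<G : ∀ b → 0 < b → b < d → d * (b ∸ 1) < b * d′
  D<G (suc b) _ b<d = begin-strict
    b + d′ * b         <⟨ +-monoˡ-< (d′ * b) (≤-pred b<d) ⟩
    d′ + d′ * b        ≡⟨ trans (sym (*-suc d′ b)) (*-comm d′ (suc b)) ⟩
    suc b * d′         ∎
    where open ≤-Reasoning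
  ≤2^h : ∀ {a} → a ≤ h → a ≤ 2 ^ h
  ≤2^h a≤h = ≤-trans a≤h (<⇒≤ (n<2^n h))
  open LinearForms d b G D h 0<b b<d 0<D (D<G b 0<b b<d)
    (≤2^h (≤-trans (m≤m+n d b) (≤-trans (m≤m+n (d + b) G) (m≤m+n (d + b + G) D))))
    (≤2^h (≤-trans (m≤n+m b d) (≤-trans (m≤m+n (d + b) G) (m≤m+n (d + b + G) D))))
    (≤2^h (≤-trans (m≤n+m G (d + b)) (m≤m+n (d + b + G) D)))
    (≤2^h (m≤n+m D (d + b + G)))
    (multiplicatively-independent 1<b b<d)
  from : (∃ λ X₀ → ∀ K L X → 0 < K → 0 < X → Approximates K L X → 2 ^ K ≤ X ^ (c * suc d ^ c) → X ≤ X₀) →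
    ∃ λ N → ∀ p w (orbit : Orbit b d p w) → 0 < p → Walk.runs 1<b b<d orbit p ≤ c → ∀ n → n ≤ p → w n ≤ N
  -- The base is `suc X₀` because monotonicity in the exponent needs a positive base.
  from (X₀ , bound) = suc X₀ ^ (suc d ^ c) , elements
    where
    elements : ∀ p w (orbit : Orbit b d p w) → 0 < p → Walk.runs 1<b b<d orbit p ≤ c → ∀ n → n ≤ p → w n ≤ suc X₀ ^ (suc d ^ c)
    elements p w orbit 0<p runs≤c n n≤p = begin
      w n                             ≤⟨ height 0<p n n≤p ⟩
      w 0 ^ (suc d ^ runs p)          ≤⟨ ^-monoˡ-≤ (suc d ^ runs p) (m≤n⇒m≤1+n (minimum≤ (cycle-equation 0<p))) ⟩
      suc X₀ ^ (suc d ^ runs p)       ≤⟨ ^-mono-exponent {suc X₀} (s≤s z≤n) (^-monoʳ-≤ (suc d) runs≤c) ⟩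
      suc X₀ ^ (suc d ^ c)            ∎
      where
      open ≤-Reasoning
      open Walk 1<b b<d orbit using (runs; height; cycle-equation)
      open Orbit orbit
      minimum≤ : (∃₂ λ K L → 0 < K × 2 ^ K ≤ w 0 ^ (runs p * suc d ^ runs p) ×
        w 0 ^ L * (d ^ K * D ^ L) ≤ (w 0 + 2) ^ L * (b ^ K * G ^ L) × w 0 ^ L * (b ^ K * G ^ L) ≤ (w 0 + 2) ^ L * (d ^ K * D ^ L)) → w 0 ≤ X₀
      minimum≤ (K , L , 0<K , 2^K≤ , upper , lower) = bound K L (w 0) 0<K positive (approximates upper lower)
        (≤-trans 2^K≤ (^-mono-exponent positive (*-mono-≤ runs≤c (^-monoʳ-≤ (suc d) runs≤c))))

-- Cycles given as lists

at-All : ∀ {p} {P : ℕ → Set p} {xs} → All P xs → ∀ i → i < length xs → P (at xs i)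
at-All (px ∷ pxs) zero _ = px
at-All (px ∷ pxs) (suc i) (s≤s i<) = at-All pxs i i<

at-injective : ∀ {xs} → Unique xs → ∀ i j → i < length xs → j < length xs → at xs i ≡ at xs j → i ≡ j
at-injective (_ ∷ _) zero zero _ _ _ = refl
at-injective (x≢ ∷ _) zero (suc j) _ (s≤s j<) eq = contradiction eq (at-All x≢ j j<)
at-injective (x≢ ∷ _) (suc i) zero (s≤s i<) _ eq = contradiction (sym eq) (at-All x≢ i i<)
at-injective (_ ∷ unique) (suc i) (suc j) (s≤s i<) (s≤s j<) eq = cong suc (at-injective unique i j i< j< eq)

total-cong : ∀ {f g} n → (∀ i → i < n → f i ≡ g i) → total f n ≡ total g n
total-cong zero f≡g = refl
total-cong (suc n) f≡g = cong₂ _+_ (total-cong n (λ i i<n → f≡g i (m<n⇒m<1+n i<n))) (f≡g n (n<1+n n))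

total-front : ∀ f n → total f (suc n) ≡ f 0 + total (f ∘ suc) n
total-front f zero = +-comm 0 (f 0)
total-front f (suc n) = trans (cong (_+ f (suc n)) (total-front f n)) (+-assoc (f 0) _ _)

total-reverse : ∀ f n → total (λ i → f (n ∸ suc i)) n ≡ total f n
total-reverse f zero = refl
total-reverse f (suc n) = trans (total-front (λ i → f (n ∸ i)) n) (trans (cong (f n +_) (total-reverse f n)) (+-comm (f n) _))

total-rotate : ∀ f p → (∀ i → f (i + p) ≡ f i) → ∀ k → total (λ i → f (k + i)) p ≡ total f p
total-rotate f p periodic zero = refl
total-rotate f p periodic (suc k) = trans (+-cancelˡ-≡ (f k) _ _ (begin
  f k + total (λ i → f (suc k + i)) p                  ≡⟨ cong₂ _+_ (cong f (sym (+-identityʳ k))) (total-cong p (λ i _ → cong f (sym (+-suc k i)))) ⟩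
  f (k + 0) + total (λ i → f (k + suc i)) p            ≡⟨ total-front (λ i → f (k + i)) p ⟨
  total (λ i → f (k + i)) p + f (k + p)                ≡⟨ cong (total (λ i → f (k + i)) p +_) (periodic k) ⟩
  total (λ i → f (k + i)) p + f k                      ≡⟨ +-comm _ (f k) ⟩
  f k + total (λ i → f (k + i)) p                      ∎)) (total-rotate f p periodic k)
  where open ≡-Reasoning

length-filterᵇ : ∀ φ (f : ℕ → ℕ) n → length (filterᵇ φ (applyUpTo f n)) ≡ total (indicator ∘ φ ∘ f) n
length-filterᵇ φ f zero = refl
length-filterᵇ φ f (suc n) = trans (head (φ (f 0)) refl) (trans (cong (indicator (φ (f 0)) +_) (length-filterᵇ φ (f ∘ suc) n)) (sym (total-front (indicator ∘ φ ∘ f) n)))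
  where
  head : ∀ v → φ (f 0) ≡ v → length (filterᵇ φ (f 0 ∷ applyUpTo (f ∘ suc) n)) ≡ indicator (φ (f 0)) + length (filterᵇ φ (applyUpTo (f ∘ suc) n))
  head true eq rewrite eq = refl
  head false eq rewrite eq = refl

argmin : ∀ (f : ℕ → ℕ) n → ∃ λ i → i ≤ n × (∀ j → j ≤ n → f i ≤ f j)
argmin f zero = 0 , z≤n , λ { zero _ → ≤-refl }
argmin f (suc n) with argmin f n
... | i , i≤n , least with f i ≤? f (suc n)
... | yes fi≤ = i , m≤n⇒m≤1+n i≤n , λ j j≤ → below j (m≤n⇒m<n∨m≡n j≤)
  where
  below : ∀ j → j < suc n ⊎ j ≡ suc n → f i ≤ f j
  below j (inj₁ (s≤s j≤n)) = least j j≤n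
  below j (inj₂ refl) = fi≤
... | no fi≰ = suc n , ≤-refl , λ j j≤ → below j (m≤n⇒m<n∨m≡n j≤)
  where
  below : ∀ j → j < suc n ⊎ j ≡ suc n → f (suc n) ≤ f j
  below j (inj₁ (s≤s j≤n)) = ≤-trans (<⇒≤ (≰⇒> fi≰)) (least j j≤n)
  below j (inj₂ refl) = ≤-refl

<ᵇ-irrefl : ∀ x → (x <ᵇ x) ≡ false
<ᵇ-irrefl zero = refl
<ᵇ-irrefl (suc x) = <ᵇ-irrefl x

no-minimum-in-singleton : ∀ x → numLocalMin (x ∷ []) ≡ 0
no-minimum-in-singleton x rewrite <ᵇ-irrefl x = refl

step-positive : ∀ {b d x y} → 1 < b → Step b d x y → x ≢ y → 0 < x
step-positive {x = suc _} _ _ _ = s≤s z≤n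
step-positive {b} {d} {zero} 1<b (up n 0≡bn y≡dn) 0≢y with m*n≡0⇒m≡0∨n≡0 b (sym 0≡bn)
... | inj₁ refl = contradiction 1<b (λ ())
... | inj₂ refl = contradiction (sym (trans y≡dn (*-zeroʳ d))) 0≢y
step-positive {b} {x = zero} _ (down b∤0 _ _ _) _ = contradiction (b ∣0) b∤0

module Cyclic (x₀ x₁ : ℕ) (ys : List ℕ) (unique : Unique (x₀ ∷ x₁ ∷ ys)) where
  xs : List ℕ
  xs = x₀ ∷ x₁ ∷ ys

  p′ p : ℕ
  p′ = suc (length ys)
  p = suc p′

  -- The periodic extension of the list: rotating it to the minimum becomes an addition of indices.
  g : ℕ → ℕ
  g i = at xs (i % p)

  periodic : ∀ i → g (i + p) ≡ g i
  periodic i = cong (at xs) ([m+n]%n≡m%n i p)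

  %-+ʳ : ∀ i j → (i + j % p) % p ≡ (i + j) % p
  %-+ʳ i j = trans (%-distribˡ-+ i (j % p) p) (trans (cong (λ k → (i % p + k) % p) (m%n%n≡m%n j p)) (sym (%-distribˡ-+ i j p)))

  g-small : ∀ i → i < p → g i ≡ at xs i
  g-small i i<p = cong (at xs) (m<n⇒m%n≡m i<p)

  g-next : ∀ i → at xs (nextIx xs (i % p)) ≡ g (suc i)
  g-next i = cong (at xs) (%-+ʳ 1 i)

  moves : ∀ i → g i ≢ g (suc i)
  moves i eq = successor≢ (i % p) (m%n<n i p) (trans (at-injective unique (i % p) (suc i % p) (m%n<n i p) (m%n<n (suc i) p) eq) (sym (%-+ʳ 1 i)))
    where
    successor≢ : ∀ r → r < p → r ≢ suc r % p
    successor≢ r r<p eq with m≤n⇒m<n∨m≡n r<p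
    ... | inj₁ sr<p = contradiction (trans eq (m<n⇒m%n≡m sr<p)) (<⇒≢ (n<1+n r))
    ... | inj₂ refl = contradiction (trans eq (n%n≡0 p)) (λ ())

  -- The centre is j + 1 rather than j, so that no predecessor has to be taken in ℕ.
  ν : ℕ → ℕ
  ν j = indicator (localMinimum (g j) (g (suc j)) (g (suc (suc j))))

  ν-periodic : ∀ j → ν (j + p) ≡ ν j
  ν-periodic j = cong indicator (trans (cong (λ u → localMinimum u (g (suc j + p)) (g (suc (suc j) + p))) (periodic j))
    (cong₂ (localMinimum (g j)) (periodic (suc j)) (periodic (suc (suc j)))))

  localMin-ν : ∀ i → i < p → indicator (isLocalMin xs i) ≡ ν (p′ + i)
  localMin-ν i i<p = cong indicator (begin
    localMinimum (at xs (prevIx xs i)) (at xs i) (at xs (nextIx xs i))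
      ≡⟨ cong₂ (λ u v → localMinimum u v (at xs (nextIx xs i))) previous current ⟩
    localMinimum (g (p′ + i)) (g (suc (p′ + i))) (at xs (nextIx xs i))
      ≡⟨ cong (localMinimum (g (p′ + i)) (g (suc (p′ + i)))) next ⟩
    localMinimum (g (p′ + i)) (g (suc (p′ + i))) (g (suc (suc (p′ + i)))) ∎)
    where
    open ≡-Reasoning
    previous : at xs (prevIx xs i) ≡ g (p′ + i)
    previous = cong (λ k → at xs (k % p)) (trans (cong (_∸ 1) (+-suc i p′)) (+-comm i p′))
    current : at xs i ≡ g (p + i)
    current = trans (sym (g-small i i<p)) (trans (sym (periodic i)) (cong g (+-comm i p)))
    next : at xs (nextIx xs i) ≡ g (suc (p + i))
    next = trans (cong (at xs ∘ nextIx xs) (sym (m<n⇒m%n≡m i<p))) (trans (g-next i) (trans (sym (periodic (suc i))) (cong g (cong suc (+-comm i p)))))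

  numLocalMin-ν : ∀ k → numLocalMin xs ≡ total (λ i → ν (k + i)) p
  numLocalMin-ν k = begin
    numLocalMin xs                                 ≡⟨ length-filterᵇ (isLocalMin xs) id p ⟩
    total (indicator ∘ isLocalMin xs) p            ≡⟨ total-cong p localMin-ν ⟩
    total (λ i → ν (p′ + i)) p                     ≡⟨ total-rotate ν p ν-periodic p′ ⟩
    total ν p                                      ≡⟨ total-rotate ν p ν-periodic k ⟨
    total (λ i → ν (k + i)) p                      ∎
    where open ≡-Reasoning

  i₀ : ℕ
  i₀ = proj₁ (argmin g p′)

  g-minimal : ∀ i → g i₀ ≤ g i
  g-minimal i = ≤-trans (proj₂ (proj₂ (argmin g p′)) (i % p) (≤-pred (m%n<n i p))) (≤-reflexive (cong (at xs) (m%n%n≡m%n i p)))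

  reach : ∀ i → ∃ λ r → r ≤ p × g (i₀ + r) ≡ g i
  -- This is i - i₀ modulo p, since p′ is -1 modulo p.
  reach i = (i + i₀ * p′) % p , <⇒≤ (m%n<n (i + i₀ * p′) p) ,
    cong (at xs) (trans (%-+ʳ i₀ (i + i₀ * p′)) (trans (cong (_% p) (regroup i₀ i p′)) ([m+kn]%n≡m%n i i₀ p)))
    where
    regroup : ∀ k i q → k + (i + k * q) ≡ i + k * suc q
    regroup = solve-∀

  module Forward {b d : ℕ} (1<b : 1 < b) (b<d : b < d) (steps : ∀ i → Step b d (g i) (g (suc i))) where
    w : ℕ → ℕ
    w n = g (i₀ + n)

    advance : ∀ n → g (suc (i₀ + n)) ≡ w (suc n)
    advance n = cong g (sym (+-suc i₀ n))

    w-moves : ∀ n → w n ≢ w (suc n)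
    w-moves n eq = moves (i₀ + n) (trans eq (sym (advance n)))

    w-step : ∀ n → Step b d (w n) (w (suc n))
    w-step n = subst (Step b d (w n)) (advance n) (steps (i₀ + n))

    w0≡ : w 0 ≡ g i₀
    w0≡ = cong g (+-identityʳ i₀)

    orbit : Orbit b d p w
    orbit = record
      { positive = step-positive 1<b (w-step 0) (w-moves 0)
      ; closed = trans (periodic i₀) (sym w0≡)
      ; minimal = λ n _ → ≤-trans (≤-reflexive w0≡) (g-minimal (i₀ + n))
      ; step = λ n _ → w-step n
      ; moves = λ n _ → w-moves n }

    -- The start at index 0 is counted separately and the other p′ terms test for local minima.
    -- Adding the term centred at i₀ + p, the minimum itself, completes a period.
    runs≤ : Walk.runs 1<b b<d orbit p ≤ suc (numLocalMin xs)
    runs≤ = begin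
      Walk.runs 1<b b<d orbit p
        ≡⟨ total-front (Walk.starts 1<b b<d orbit) p′ ⟩
      suc (total (λ n → Walk.starts 1<b b<d orbit (suc n)) p′)
        ≡⟨ cong suc (total-cong p′ (λ n _ → cong₂ (λ u v → indicator (localMinimum (w n) u v)) (sym (advance n))
             (trans (sym (advance (suc n))) (cong (g ∘ suc) (+-suc i₀ n))))) ⟩
      suc (total (λ n → ν (i₀ + n)) p′)
        ≤⟨ s≤s (m≤m+n _ (ν (i₀ + p′))) ⟩
      suc (total (λ n → ν (i₀ + n)) p)
        ≡⟨ cong suc (numLocalMin-ν i₀) ⟨
      suc (numLocalMin xs) ∎
      where open ≤-Reasoning

    covers : ∀ i → ∃ λ n → n ≤ p × w n ≡ g i
    covers = reach

  -- Serves the case in which the inverse map, obtained by exchanging (a, b) with (c, d), has the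
  -- increasing form. The cycle is read backward from its minimum; for n ≤ p the truncated
  -- subtraction in `w` is exact.
  module Backward {b d : ℕ} (1<b : 1 < b) (b<d : b < d) (steps : ∀ i → Step b d (g (suc i)) (g i)) where
    w : ℕ → ℕ
    w n = g (i₀ + p ∸ n)

    retreat : ∀ n → n < p → g (suc (i₀ + p ∸ suc n)) ≡ w n
    retreat n n<p = cong g (sym (+-∸-assoc 1 (≤-trans n<p (m≤n+m p i₀))))

    w-moves : ∀ n → n < p → w n ≢ w (suc n)
    w-moves n n<p eq = moves (i₀ + p ∸ suc n) (trans (sym eq) (sym (retreat n n<p)))

    w-step : ∀ n → n < p → Step b d (w n) (w (suc n))
    w-step n n<p = subst (λ x → Step b d x (w (suc n))) (retreat n n<p) (steps (i₀ + p ∸ suc n))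

    w0≡ : w 0 ≡ g i₀
    w0≡ = periodic i₀

    orbit : Orbit b d p w
    orbit = record
      { positive = step-positive 1<b (w-step 0 (s≤s z≤n)) (w-moves 0 (s≤s z≤n))
      ; closed = trans (cong g (m+n∸n≡m i₀ p)) (sym w0≡)
      ; minimal = λ n _ → ≤-trans (≤-reflexive w0≡) (g-minimal (i₀ + p ∸ n))
      ; step = w-step
      ; moves = w-moves }

    starts-ν : ∀ n → n < p′ → Walk.starts 1<b b<d orbit (suc n) ≡ ν (i₀ + (p′ ∸ suc n))
    starts-ν n n<p′ = begin
      indicator (localMinimum (w n) (w (suc n)) (g (i₀ + p ∸ suc (suc n))))
        ≡⟨ cong (λ j → indicator (localMinimum (w n) (w (suc n)) (g j))) index ⟩
      indicator (localMinimum (w n) (w (suc n)) (g j))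
        ≡⟨ cong₂ (λ u v → indicator (localMinimum u v (g j))) (sym w-n) (sym w-suc) ⟩
      -- Reversal exchanges the two neighbours, and being a local minimum is symmetric in them.
      indicator (localMinimum (g (suc (suc j))) (g (suc j)) (g j))
        ≡⟨ cong indicator (∧-comm (g (suc j) <ᵇ g (suc (suc j))) (g (suc j) <ᵇ g j)) ⟩
      ν j ∎
      where
      open ≡-Reasoning
      j = i₀ + (p′ ∸ suc n)
      index : i₀ + p ∸ suc (suc n) ≡ j
      index = +-∸-assoc i₀ (s≤s n<p′)
      w-suc : g (suc j) ≡ w (suc n)
      w-suc = trans (cong (g ∘ suc) (sym index)) (retreat (suc n) (s≤s n<p′))
      w-n : g (suc (suc j)) ≡ w n
      w-n = trans (cong (g ∘ suc) (trans (cong suc (sym index)) (sym (+-∸-assoc 1 (≤-trans (s≤s n<p′) (m≤n+m p i₀)))))) (retreat n (m<n⇒m<1+n n<p′))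

    runs≤ : Walk.runs 1<b b<d orbit p ≤ suc (numLocalMin xs)
    runs≤ = begin
      Walk.runs 1<b b<d orbit p
        ≡⟨ total-front (Walk.starts 1<b b<d orbit) p′ ⟩
      suc (total (λ n → Walk.starts 1<b b<d orbit (suc n)) p′)
        ≡⟨ cong suc (total-cong p′ starts-ν) ⟩
      suc (total (λ n → ν (i₀ + (p′ ∸ suc n))) p′)
        ≡⟨ cong suc (total-reverse (λ n → ν (i₀ + n)) p′) ⟩
      suc (total (λ n → ν (i₀ + n)) p′)
        ≤⟨ s≤s (m≤m+n _ (ν (i₀ + p′))) ⟩
      suc (total (λ n → ν (i₀ + n)) p)
        ≡⟨ cong suc (numLocalMin-ν i₀) ⟨
      suc (numLocalMin xs) ∎
      where open ≤-Reasoning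

    covers : ∀ i → ∃ λ n → n ≤ p × w n ≡ g i
    covers i with reach i
    ... | r , r≤p , eq = p ∸ r , m∸n≤m p r , trans (cong g (trans (+-∸-assoc i₀ (m∸n≤m p r)) (cong (i₀ +_) (m∸[m∸n]≡n r≤p)))) eq

-- With equal b and d, `up` fixes its argument, while a `down` step of both the map and its inverse
-- gives the two opposite inequalities.
P-identity : ∀ {a b c x y} → 0 < b → a * (b ∸ 1) ≡ c * (b ∸ 1) → P a b c b x y → x ≡ y
P-identity {a} {b} {c} 0<b N≡ Pxy with P⇒Step {a} {b} {c} {b} 0<b ≤-refl N≡ Pxy | P⇒Step {c} {b} {a} {b} 0<b ≤-refl (sym N≡) (P-sym {a} {b} {c} {b} Pxy)
... | up n x≡ y≡ | _ = trans x≡ (sym y≡)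
... | down _ _ _ _ | up n y≡ x≡ = trans x≡ (sym y≡)
... | down _ y≤x _ _ | down _ x≤y _ _ = ≤-antisym x≤y y≤x

Bounded : (ℕ → ℕ → Set) → ℕ → ℕ → Set
Bounded F m N = ∀ xs → IsMCycle F m xs → ∀ i → i < length xs → at xs i ≤ N

-- A fixed point is its own neighbour and so no local minimum; as m is positive, only lists with at
-- least two elements remain, the ones that `Cyclic` treats.
nonsingleton : ∀ {F m N} → 0 < m →
  (∀ x₀ x₁ ys → IsMCycle F m (x₀ ∷ x₁ ∷ ys) → ∀ i → i < length (x₀ ∷ x₁ ∷ ys) → at (x₀ ∷ x₁ ∷ ys) i ≤ N) → Bounded F m N
nonsingleton 0<m bounded (x ∷ []) (_ , minima , _) = contradiction (trans (sym (no-minimum-in-singleton x)) minima) (<⇒≢ 0<m)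
nonsingleton 0<m bounded (x₀ ∷ x₁ ∷ ys) = bounded x₀ x₁ ys

module _ {a b c d : ℕ} (1<b : 1 < b) (1<d : 1 < d) (N≡ : a * (b ∸ 1) ≡ c * (d ∸ 1)) {m : ℕ} (0<m : 0 < m) where

  bounded-increasing : b < d → ∃ (Bounded (P a b c d) m)
  bounded-increasing b<d with orbit-bound 1<b b<d (suc m)
  ... | N , bound = N , nonsingleton {P a b c d} 0<m λ x₀ x₁ ys ((_ , unique , F) , minima , _) i i< →
    let module C = Cyclic x₀ x₁ ys unique
        module W = C.Forward 1<b b<d (λ i → P⇒Step {a} {b} {c} {d} (<⇒≤ 1<b) (<⇒≤ b<d) N≡
                     (subst (P a b c d (C.g i)) (C.g-next i) (F (i % C.p) (m%n<n i C.p))))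
        n , n≤p , eq = W.covers i
    in subst (_≤ N) (trans eq (C.g-small i i<)) (bound C.p W.w W.orbit (s≤s z≤n) (≤-trans W.runs≤ (≤-reflexive (cong suc minima))) n n≤p)

  bounded-decreasing : d < b → ∃ (Bounded (P a b c d) m)
  bounded-decreasing d<b with orbit-bound 1<d d<b (suc m)
  ... | N , bound = N , nonsingleton {P a b c d} 0<m λ x₀ x₁ ys ((_ , unique , F) , minima , _) i i< →
    let module C = Cyclic x₀ x₁ ys unique
        module W = C.Backward 1<d d<b (λ i → P⇒Step {c} {d} {a} {b} (<⇒≤ 1<d) (<⇒≤ d<b) (sym N≡)
                     (P-sym {a} {b} {c} {d} (subst (P a b c d (C.g i)) (C.g-next i) (F (i % C.p) (m%n<n i C.p)))))
        n , n≤p , eq = W.covers i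
    in subst (_≤ N) (trans eq (C.g-small i i<)) (bound C.p W.w W.orbit (s≤s z≤n) (≤-trans W.runs≤ (≤-reflexive (cong suc minima))) n n≤p)

  bounded-identity : b ≡ d → ∃ (Bounded (P a b c d) m)
  bounded-identity refl = 0 , nonsingleton {P a b c b} 0<m λ x₀ x₁ ys ((_ , unique , F) , _) i _ →
    let module C = Cyclic x₀ x₁ ys unique
    in contradiction (P-identity {a} {b} {c} (<⇒≤ 1<b) N≡ (subst (P a b c b (C.g 0)) (C.g-next 0) (F 0 (s≤s z≤n)))) (C.moves 0)

  cycles-bounded : ∃ (Bounded (P a b c d) m)
  cycles-bounded with <-cmp b d
  ... | tri< b<d _ _ = bounded-increasing b<d
  ... | tri≈ _ b≡d _ = bounded-identity b≡d
  ... | tri> _ _ d<b = bounded-decreasing d<b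

-- Enumeration of the bounded cycles

Nth-functional : ∀ {l i r s} → Nth l i r → Nth l i s → r ≡ s
Nth-functional here here = refl
Nth-functional (there nr) (there ns) = Nth-functional nr ns

Nth-< : ∀ {l i r} → Nth l i r → i < length l
Nth-< here = s≤s z≤n
Nth-< (there n) = s≤s (Nth-< n)

nth? : ∀ l i → Dec (∃ (Nth l i))
nth? [] i = no λ ()
nth? (x ∷ l) zero = yes (x , here)
nth? (x ∷ l) (suc i) = map′ (λ (r , n) → r , there n) (λ { (r , there n) → r , n }) (nth? l i)

-- The search is finite: n is at most x because a and b are positive, and i is an index into a
-- finite list.
P? : ∀ a b c d → 0 < a → 0 < b → ∀ x y → Dec (P a b c d x y)
P? a b c d 0<a 0<b x y = multiple? ⊎-dec nonMultiple?
  where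
  b≢0 : NonZero b
  b≢0 = >-nonZero 0<b
  ab≢0 : NonZero (a * b)
  ab≢0 = >-nonZero (*-mono-≤ 0<a 0<b)
  multiple? : Dec (Σ ℕ λ n → x ≡ b * n × y ≡ d * n)
  multiple? = map′ (λ (n , _ , eqs) → n , eqs)
    (λ (n , x≡ , y≡) → n , s≤s (≤-trans (m≤n*m n b {{b≢0}}) (≤-reflexive (sym x≡))) , x≡ , y≡)
    (anyUpTo? (λ n → (x ≟ b * n) ×-dec (y ≟ d * n)) (suc x))
  Image : ℕ → ℕ → Set
  Image n i = Σ ℕ λ r → Σ ℕ λ s → Nth (nonMultiples a b) i r × Nth (nonMultiples c d) i s × x ≡ a * b * n + r × y ≡ c * d * n + s
  image? : ∀ n i → Dec (Image n i)
  image? n i with nth? (nonMultiples a b) i | nth? (nonMultiples c d) i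
  ... | no ¬r | _ = no λ (r , _ , nr , _) → ¬r (r , nr)
  ... | yes _ | no ¬s = no λ (_ , s , _ , ns , _) → ¬s (s , ns)
  ... | yes (r , nr) | yes (s , ns) = map′ (λ (x≡ , y≡) → r , s , nr , ns , x≡ , y≡)
    (λ (r′ , s′ , nr′ , ns′ , x≡ , y≡) → trans x≡ (cong (a * b * n +_) (Nth-functional nr′ nr)) , trans y≡ (cong (c * d * n +_) (Nth-functional ns′ ns)))
    ((x ≟ a * b * n + r) ×-dec (y ≟ c * d * n + s))
  nonMultiple? : Dec (Σ ℕ λ n → Σ ℕ λ i → Image n i)
  nonMultiple? = map′ (λ (n , _ , i , _ , im) → n , i , im)
    (λ (n , i , im@(r , s , nr , ns , x≡ , y≡)) → n , s≤s (≤-trans (m≤n*m n (a * b) {{ab≢0}}) (≤-trans (m≤m+n (a * b * n) r) (≤-reflexive (sym x≡)))) , i , Nth-< nr , im)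
    (anyUpTo? (λ n → anyUpTo? (image? n) (length (nonMultiples a b))) (suc x))

isMCycle? : ∀ {F} → (∀ x y → Dec (F x y)) → ∀ m xs → Dec (IsMCycle F m xs)
isMCycle? F? m xs = ((1 ≤? length xs) ×-dec unique? xs ×-dec
    map′ (λ h i i< → h {i} i<) (λ h {i} i< → h i i<) (allUpTo? (λ i → F? (at xs i) (at xs (nextIx xs i))) (length xs)))
  ×-dec (numLocalMin xs ≟ m) ×-dec (numLocalMax xs ≟ m)

listsOfLength : ℕ → ℕ → List (List ℕ)
listsOfLength N zero = [] ∷ []
listsOfLength N (suc k) = cartesianProductWith _∷_ (upTo (suc N)) (listsOfLength N k)

∈-listsOfLength : ∀ N xs → (∀ i → i < length xs → at xs i ≤ N) → xs ∈ listsOfLength N (length xs)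
∈-listsOfLength N [] _ = here refl
∈-listsOfLength N (x ∷ xs) x≤N = ∈-cartesianProductWith⁺ _∷_ (∈-upTo⁺ (s≤s (x≤N 0 (s≤s z≤n)))) (∈-listsOfLength N xs (λ i i< → x≤N (suc i) (s≤s i<)))

-- The entries inject the positions of the list into {0, ..., N}.
length-bound : ∀ N xs → Unique xs → (∀ i → i < length xs → at xs i ≤ N) → length xs ≤ suc N
length-bound N xs unique x≤N = Fin.injective⇒≤ {f = λ i → fromℕ< (s≤s (x≤N (toℕ i) (toℕ<n i)))}
  (λ {i} {j} eq → Fin.toℕ-injective (at-injective unique (toℕ i) (toℕ j) (toℕ<n i) (toℕ<n j)
    (trans (sym (Fin.toℕ-fromℕ< (s≤s (x≤N (toℕ i) (toℕ<n i))))) (trans (cong toℕ eq) (Fin.toℕ-fromℕ< (s≤s (x≤N (toℕ j) (toℕ<n j))))))))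

mainTheorem1 : (a b c d : ℕ) → 1 ≤ a → 1 < b → 1 ≤ c → 1 < d →
    a * (b ∸ 1) ≡ c * (d ∸ 1) →
    (m : ℕ) → 1 ≤ m →
    Σ (List (List ℕ)) λ L →
    (∀ xs → IsMCycle (P a b c d) m xs → xs ∈ L) ×
    (∀ xs → xs ∈ L → IsMCycle (P a b c d) m xs)
mainTheorem1 a b c d 1≤a 1<b 1≤c 1<d N≡ m 1≤m with cycles-bounded {a} {b} {c} {d} 1<b 1<d N≡ {m} 1≤m
... | N , bounded = filter cycle? candidates , complete , λ xs xs∈L → proj₂ (∈-filter⁻ cycle? {xs = candidates} xs∈L)
  where
  candidates : List (List ℕ)
  -- Lengths from 0 to N + 1 are tried, hence the double `suc`.
  candidates = concatMap (listsOfLength N) (upTo (suc (suc N)))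
  cycle? : ∀ xs → Dec (IsMCycle (P a b c d) m xs)
  cycle? = isMCycle? (P? a b c d 1≤a (<⇒≤ 1<b)) m
  complete : ∀ xs → IsMCycle (P a b c d) m xs → xs ∈ filter cycle? candidates
  complete xs cycle@((_ , unique , _) , _) = ∈-filter⁺ cycle?
    (∈-concatMap⁺ (listsOfLength N) (lose (∈-upTo⁺ (s≤s (length-bound N xs unique (bounded xs cycle)))) (∈-listsOfLength N xs (bounded xs cycle)))) cycle
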